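{- Let $\ell\ge 13$ and let $G$ be an $\ell$-partite graph with (nonempty, finite) parts $V_1,\ldots,V_\ell$ such that $$d(V_i,V_j)=\frac{\|G[V_i\cup V_j]\|}{|V_i||V_j|}\ge\frac12\quad\text{for all } i\ne j.$$ Then $G$ contains a triangle, or $G$ is isomorphic to a graph in $\mathcal{G}^3_\ell$.
   Context: All graphs are simple and finite; $\|H\|$ is the number of edges of $H$. Let $(\pi_1,\pi_2)$ be the two permutations of $\{1,2\}$, $\pi_1=\mathrm{id}$, $\pi_2=(2,1)$. A graph is in $\bar{\mathcal{G}}^3_\ell$ if it has vertex set $\{(i,s,t):1\le i\le\ell,\ 1\le s\le 2,\ 1\le t\le n_i^s\}$ and edge set $\{(i,s,t)(i',s',t'):i\ne i',\ s\ne s'\}$, where the nonnegative integers $n_i^s$ satisfy $n_1^1\ge n_1^2$, $n_2^2\ge n_2^1$, $n_i^1=n_i^2$ for $2<i\le\ell$, and $n_i^1+n_i^2>0$ for all $i$. Such a graph is $\ell$-partite with parts $\{(i,s,t):s,t\}$, $1\le i\le \ell$. The class $\mathcal{G}^3_\ell$ consists of all graphs obtained from a graph in $\bar{\mathcal{G}}^3_\ell$ by deleting some of the edges in $\{(1,s,t)(2,s',t'): s\ne s'\}$. -}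

module Defs where

open import Data.Nat using (ℕ; zero; suc; _+_; _*_; _≤_; _<_)
open import Data.Fin using (Fin; toℕ) renaming (_≟_ to _≟ᶠ_)
open import Data.Bool using (Bool; true; false; _∧_)
open import Data.List using (List; length; filter; allFin; map)
open import Data.Nat.ListAction using (sum)
open import Data.Product using (Σ; ∃; ∃-syntax; _×_; _,_)
open import Relation.Nullary using (¬_; Dec; yes; no)
open import Relation.Nullary.Decidable using (⌊_⌋)
open import Relation.Binary.PropositionalEquality using (_≡_; _≢_)
open import Function.Bundles using (_↔_; _⇔_; Inverse)

record Graph (N : ℕ) : Set where
  field
    adj       : Fin N → Fin N → Bool
    adj-sym   : ∀ u v → adj u v ≡ adj v u
    adj-irref : ∀ u → adj u u ≡ false
open Graph public

Partition : ℕ → ℕ → Set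
Partition N ℓ = Fin N → Fin ℓ

partSize : ∀ {N ℓ} → Partition N ℓ → Fin ℓ → ℕ
partSize {N} p i = length (filter (λ u → p u ≟ᶠ i) (allFin N))

-- Number of ordered pairs (u , v) with u ∈ V_i, v ∈ V_j, uv ∈ E(G).
-- For i ≢ j in an ℓ-partite graph this is ‖G[V_i ∪ V_j]‖.
crossEdges : ∀ {N ℓ} → Graph N → Partition N ℓ → Fin ℓ → Fin ℓ → ℕ
crossEdges {N} G p i j =
  sum (map (λ u → length (filter (λ v → adj G u v Data.Bool.≟ true)
                                 (filter (λ v → p v ≟ᶠ j) (allFin N))))
           (filter (λ u → p u ≟ᶠ i) (allFin N)))

IsPartite : ∀ {N ℓ} → Graph N → Partition N ℓ → Set
IsPartite {N} {ℓ} G p =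
  (∀ u v → adj G u v ≡ true → p u ≢ p v) × (∀ (i : Fin ℓ) → ∃[ u ] p u ≡ i)

HalfDense : ∀ {N ℓ} → Graph N → Partition N ℓ → Set
HalfDense {N} {ℓ} G p =
  ∀ (i j : Fin ℓ) → i ≢ j → partSize p i * partSize p j ≤ 2 * crossEdges G p i j

HasTriangle : ∀ {N} → Graph N → Set
HasTriangle {N} G =
  ∃[ u ] ∃[ v ] ∃[ w ] (adj G u v ≡ true × adj G v w ≡ true × adj G u w ≡ true)

-- The class 𝒢³_ℓ.  Indices i ∈ Fin ℓ stand for 1..ℓ (toℕ i = i - 1);
-- s ∈ Fin 2 stands for s ∈ {1,2} (Fin.zero ↦ 1, Fin.suc Fin.zero ↦ 2).

s1 s2 : Fin 2
s1 = Fin.zero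
s2 = Fin.suc Fin.zero

Admissible : ∀ {ℓ} → (Fin ℓ → Fin 2 → ℕ) → Set
Admissible {ℓ} n =
  (∀ i → toℕ i ≡ 0 → n i s2 ≤ n i s1) ×
  (∀ i → toℕ i ≡ 1 → n i s1 ≤ n i s2) ×
  (∀ i → 2 ≤ toℕ i → n i s1 ≡ n i s2) ×
  (∀ i → 0 < n i s1 + n i s2)

GVertex : ∀ {ℓ} → (Fin ℓ → Fin 2 → ℕ) → Set
GVertex {ℓ} n = Σ (Fin ℓ) λ i → Σ (Fin 2) λ s → Fin (n i s)

barEdge : ∀ {ℓ} {n : Fin ℓ → Fin 2 → ℕ} → GVertex n → GVertex n → Set
barEdge (i , s , _) (i' , s' , _) = (i ≢ i') × (s ≢ s')

Between12 : ∀ {ℓ} {n : Fin ℓ → Fin 2 → ℕ} → GVertex n → GVertex n → Set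
Between12 (i , _ , _) (i' , _ , _) =
  (toℕ i ≡ 0 × toℕ i' ≡ 1) Data.Sum.⊎ (toℕ i ≡ 1 × toℕ i' ≡ 0)
  where import Data.Sum

-- A (symmetric) edge relation E on GVertex n is obtained from the \bar𝒢³_ℓ
-- graph by deleting some edges (i,s,t)(i',s',t') with {i,i'} = {1,2}, s ≢ s'.
InG3 : ∀ {ℓ} (n : Fin ℓ → Fin 2 → ℕ) → (GVertex n → GVertex n → Set) → Set
InG3 n E =
  Admissible n ×
  (∀ x y → E x y → E y x) ×
  (∀ x y → E x y → barEdge {n = n} x y) ×
  (∀ x y → barEdge {n = n} x y → ¬ Between12 {n = n} x y → E x y)

IsoToG3 : ∀ {N} → ℕ → Graph N → Set₁
IsoToG3 {N} ℓ G =
  ∃[ n ] Σ (GVertex {ℓ} n → GVertex n → Set) λ E → InG3 n E ×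
    Σ (Fin N ↔ GVertex n) λ f →
      ∀ u v → (adj G u v ≡ true) ⇔ E (Inverse.to f u) (Inverse.to f v)

{-# OPTIONS --safe #-}

-- Weight the vertices so that every part has mass M, and suppose that there is no triangle.
-- For a cut s with s-mass (M + x_i) / 2 in V_i, density at least 1/2 between V_i and V_j says that
-- 2 miss + x_i x_j ≤ 2 bad, where bad counts the edges inside the classes and miss the nonedges across.
-- For the independent cut N(v), charging each bad edge to the nonedges that it forces towards a third
-- part shows that v sees more than half of V_k for at most two k. The degrees are therefore so close
-- to their means that a Mantel count gives an edge uv for which N(u) and N(v) leave out mass at most
-- M / 6 in all other parts together. In at least seven parts, neither N(u) nor N(v) has more than
-- half of the mass. There we colour N(u) and N(v) differently, and each remaining vertex according
-- to the class in which it has few neighbours. On the at least four parts whose x has the same sign,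
-- miss ≤ bad, while the charging argument gives 5M bad ≤ (5M - 1) miss; so both vanish, and at least
-- three of these parts have x = 0. They form a balanced complete bipartite core, and by averaging every
-- other vertex sees exactly one colour class of it. Hence G is bipartite, and the inequality
-- 2 miss + x_i x_j ≤ 0 for its bipartition is the structure of the class.

module Submission where

open import Defs
open import Data.Bool using (Bool; true; false; _∧_; _∨_; not; _xor_; if_then_else_)
open import Data.Bool.Properties using (xor-comm; ∧-comm; xor-identityʳ) renaming (_≟_ to _≟ᵇ_)
open import Data.Empty using (⊥; ⊥-elim)
open import Data.Fin using (Fin; zero; suc; toℕ) renaming (_≟_ to _≟ᶠ_)
open import Data.Fin.Permutation using (Permutation′; _⟨$⟩ʳ_; _⟨$⟩ˡ_; inverseʳ; inverseˡ; _∘ₚ_; transpose)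
open import Data.Fin.Properties using (any?; suc-injective)
open import Data.Integer using (ℤ; +_; -[1+_]; _+_; _*_; _-_; -_; 0ℤ; 1ℤ; nonNegative; positive; +≤+; +<+; _⊔_)
  renaming (_≤_ to _≤ᶻ_; _<_ to _<ᶻ_; _≤?_ to _≤ᶻ?_; _≟_ to _≟ᶻ_)
import Data.Integer.Properties as ℤₚ
open import Data.Integer.Tactic.RingSolver using (solve)
open import Data.List using (_∷_; []; length; filter; tabulate; map)
import Data.Nat as ℕ
open import Data.Nat using (ℕ; _≤_; zero; suc; z≤n; s≤s)
open import Data.Nat.ListAction using () renaming (sum to sumᴸ)
import Data.Nat.Properties as ℕₚ
open import Data.Product using (Σ; ∃-syntax; _×_; _,_; proj₁; proj₂)
open import Data.Sum using (_⊎_; inj₁; inj₂)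
open import Function using (_∘_; case_of_; id)
open import Function.Bundles using (mk↔ₛ′; mk⇔)
open import Relation.Binary.PropositionalEquality hiding (J)
open import Relation.Nullary using (¬_; Dec; yes; no; does)
open import Relation.Nullary.Decidable using (from-yes; _→-dec_; _×-dec_; dec-true; dec-false)
open import Relation.Unary using (Decidable)
open import Algebra.Properties.Semiring.Sum ℤₚ.+-*-semiring
  using (sum; sum-cong-≗; ∑-distrib-+; ∑-comm; *-distribˡ-sum; sum-replicate-zero)

-- The constants are tied together. The Mantel count bounds the average of `slack` over the edges by
-- 2M/(ℓ-1), which is at most M/6 exactly when ℓ ≥ 13. The parts and the majorities of the two ends
-- exclude at most 2 + 2 + 2 parts, and the remaining 7 are what a pigeonhole needs to find 4 with
-- the same sign of x. The obstacle is the set `R` of vertices outside both neighbourhoods, of mass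
-- ρ ≤ M/6: such a vertex can have bad edges of mass close to 2M/3 + M/6 = 5M/6, while a bad edge
-- forces nonedges of mass M - ρ, which may be no more than 5M/6. The two bounds meet, and the
-- argument survives on two points. The threshold 2M/3 is strict, and in integers this is the -1 of
-- 5M - 1. And the nonedges forced by a bad edge can be found with their far end outside `R`, so
-- that a nonedge is charged from both of its ends only when both lie outside `R`, where the bad
-- edges at a vertex have mass at most M/6.

infixl 6 _⊕_
infixl 7 _⊗_

-- Inequalities are proved by writing the difference of the two sides as a
-- combination, by _⊕_ and _⊗_, of differences known to be nonnegative; the
-- ring solver checks the identity.

gap : ∀ {i j} → i ≤ᶻ j → 0ℤ ≤ᶻ j - i
gap = ℤₚ.i≤j⇒0≤j-i

_⊕_ : ∀ {i j} → 0ℤ ≤ᶻ i → 0ℤ ≤ᶻ j → 0ℤ ≤ᶻ i + j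
_⊕_ = ℤₚ.+-mono-≤

_⊗_ : ∀ {i j} → 0ℤ ≤ᶻ i → 0ℤ ≤ᶻ j → 0ℤ ≤ᶻ i * j
_⊗_ {i} {j} p q = subst (_≤ᶻ i * j) (ℤₚ.*-zeroʳ i) (ℤₚ.*-monoˡ-≤-nonNeg i {{nonNegative p}} q)

nat : ∀ n → 0ℤ ≤ᶻ + n
nat n = +≤+ z≤n

from-gap : ∀ {i j g} → 0ℤ ≤ᶻ g → g ≡ j - i → i ≤ᶻ j
from-gap p refl = ℤₚ.0≤i-j⇒j≤i p

negative-gap : ∀ {g} → 0ℤ ≤ᶻ g → g ≡ - 1ℤ → ⊥
negative-gap p refl = case p of λ ()

<⇒1+≤ : ∀ {i j} → i <ᶻ j → 1ℤ + i ≤ᶻ j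
<⇒1+≤ = ℤₚ.i<j⇒suc[i]≤j

≰⇒1+≤ : ∀ {i j} → ¬ (i ≤ᶻ j) → 1ℤ + j ≤ᶻ i
≰⇒1+≤ = <⇒1+≤ ∘ ℤₚ.≰⇒>

cancel-pos : ∀ {i j} m → 1ℤ ≤ᶻ m → m * i ≤ᶻ m * j → i ≤ᶻ j
cancel-pos {i} {j} m 1≤m = ℤₚ.*-cancelˡ-≤-pos i j m {{positive (ℤₚ.<-≤-trans (+<+ (s≤s z≤n)) 1≤m)}}

1≤-* : ∀ {i j} → 1ℤ ≤ᶻ i → 1ℤ ≤ᶻ j → 1ℤ ≤ᶻ i * j
1≤-* {i} {j} 1≤i 1≤j = from-gap (gap 1≤i ⊗ gap 1≤j ⊕ gap 1≤i ⊕ gap 1≤j) (solve (i ∷ j ∷ []))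

-- Exhaustive checks over Booleans.

-- Together with `from-yes` this makes the type checker evaluate a truth table. Most pointwise
-- inequalities behind the counting arguments are proved in this way and then integrated.
∀? : ∀ {P : Bool → Set} → (∀ b → Dec (P b)) → Dec (∀ b → P b)
∀? d with d false | d true
... | no ¬p | _     = no λ f → ¬p (f false)
... | yes _ | no ¬p = no λ f → ¬p (f true)
... | yes p | yes q = yes λ { false → p ; true → q }

by-value : ∀ {a} (P : Bool → Set a) b → (b ≡ false → P false) → (b ≡ true → P true) → P b
by-value P false f t = f refl
by-value P true  f t = t refl

ι : Bool → ℤ
ι true  = 1ℤ
ι false = 0ℤ

ι-≥0 : ∀ b → 0ℤ ≤ᶻ ι b
ι-≥0 = from-yes (∀? λ b → 0ℤ ≤ᶻ? ι b)

ι-≤1 : ∀ b → ι b ≤ᶻ 1ℤ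
ι-≤1 = from-yes (∀? λ b → ι b ≤ᶻ? 1ℤ)

ι-true : ∀ {b} → 1ℤ ≤ᶻ ι b → b ≡ true
ι-true {true} _ = refl
ι-true {false} (+≤+ ())

∧-true : ∀ {a b} → a ∧ b ≡ true → a ≡ true × b ≡ true
∧-true {true} {true} _ = refl , refl

_==_ : ∀ {n} → Fin n → Fin n → Bool
i == j = does (i ≟ᶠ j)

==⇒≡ : ∀ {n} {i j : Fin n} → (i == j) ≡ true → i ≡ j
==⇒≡ {i = i} {j} eq with i ≟ᶠ j
... | yes i≡j = i≡j

==-refl : ∀ {n} (i : Fin n) → (i == i) ≡ true
==-refl i = dec-true (i ≟ᶠ i) refl

==-≢ : ∀ {n} {i j : Fin n} → i ≢ j → (i == j) ≡ false
==-≢ {i = i} {j} = dec-false (i ≟ᶠ j)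

==-sym : ∀ {n} (i j : Fin n) → (i == j) ≡ (j == i)
==-sym i j with i ≟ᶠ j
... | yes refl = sym (==-refl i)
... | no i≢j   = sym (==-≢ (i≢j ∘ sym))

-- Finite sums of integers.

sum-mono : ∀ {n} {f g : Fin n → ℤ} → (∀ i → f i ≤ᶻ g i) → sum f ≤ᶻ sum g
sum-mono {zero}  f≤g = ℤₚ.≤-refl
sum-mono {suc n} f≤g = ℤₚ.+-mono-≤ (f≤g zero) (sum-mono (f≤g ∘ suc))

sum-≥0 : ∀ {n} {f : Fin n → ℤ} → (∀ i → 0ℤ ≤ᶻ f i) → 0ℤ ≤ᶻ sum f
sum-≥0 {zero}  0≤f = ℤₚ.≤-refl
sum-≥0 {suc n} 0≤f = 0≤f zero ⊕ sum-≥0 (0≤f ∘ suc)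

term-≤-sum : ∀ {n} {f : Fin n → ℤ} → (∀ i → 0ℤ ≤ᶻ f i) → ∀ i → f i ≤ᶻ sum f
term-≤-sum {suc n} {f} 0≤f zero = from-gap (sum-≥0 (0≤f ∘ suc)) (lemma (f zero) _)
  where lemma : ∀ a b → b ≡ (a + b) - a
        lemma a b = solve (a ∷ b ∷ [])
term-≤-sum {suc n} {f} 0≤f (suc i) =
  from-gap (0≤f zero ⊕ gap (term-≤-sum (0≤f ∘ suc) i)) (lemma (f zero) _ _)
  where lemma : ∀ a b c → a + (b - c) ≡ (a + b) - c
        lemma a b c = solve (a ∷ b ∷ c ∷ [])

sum-const : ∀ n c → sum {n} (λ _ → c) ≡ + n * c
sum-const zero    c = sym (ℤₚ.*-zeroˡ c)
sum-const (suc n) c = trans (cong (λ s → c + s) (sum-const n c)) (sym (ℤₚ.suc-* (+ n) c))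

sum-== : ∀ {n} (i : Fin n) (f : Fin n → ℤ) → sum (λ k → ι (i == k) * f k) ≡ f i
sum-== {suc n} zero f =
  trans (cong₂ _+_ (ℤₚ.*-identityˡ (f zero))
          (trans (sum-cong-≗ {n} λ k → ℤₚ.*-zeroˡ (f (suc k))) (sum-replicate-zero n)))
        (ℤₚ.+-identityʳ (f zero))
sum-== {suc n} (suc i) f =
  trans (cong₂ _+_ (ℤₚ.*-zeroˡ (f zero)) (sum-== i (f ∘ suc))) (ℤₚ.+-identityˡ _)

pos? : ∀ i → (i ≤ᶻ 0ℤ) ⊎ (1ℤ ≤ᶻ i)
pos? i with i ≤ᶻ? 0ℤ
... | yes i≤0 = inj₁ i≤0
... | no  i≰0 = inj₂ (≰⇒1+≤ i≰0)

sum-≤0 : ∀ {n} {f : Fin n → ℤ} → (∀ i → f i ≤ᶻ 0ℤ) → sum f ≤ᶻ 0ℤ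
sum-≤0 {n} {f} f≤0 = subst (sum f ≤ᶻ_) (sum-replicate-zero n) (sum-mono f≤0)

sum-one-positive : ∀ {n} (f : Fin n → ℤ) (m : ℤ) → 0ℤ ≤ᶻ m → (∀ i → f i ≤ᶻ m) →
  (∀ i j → i ≢ j → 1ℤ ≤ᶻ f i → 1ℤ ≤ᶻ f j → ⊥) → sum f ≤ᶻ m
sum-one-positive {zero}  f m 0≤m f≤m one = 0≤m
sum-one-positive {suc n} f m 0≤m f≤m one with pos? (f zero)
... | inj₁ f₀≤0 = from-gap (gap (sum-one-positive (f ∘ suc) m 0≤m (f≤m ∘ suc)
                     λ i j i≢j → one (suc i) (suc j) (i≢j ∘ suc-injective)) ⊕ gap f₀≤0)
                     (lemma (f zero) m _)
  where lemma : ∀ a b c → (b - c) + (0ℤ - a) ≡ b - (a + c)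
        lemma a b c = solve (a ∷ b ∷ c ∷ [])
... | inj₂ 0<f₀ = from-gap (gap (f≤m zero) ⊕ gap rest) (lemma (f zero) m _)
  where
  f≤0 : ∀ i → f (suc i) ≤ᶻ 0ℤ
  f≤0 i with pos? (f (suc i))
  ... | inj₁ ≤0 = ≤0
  ... | inj₂ 0< = ⊥-elim (one zero (suc i) (λ ()) 0<f₀ 0<)
  rest : sum (f ∘ suc) ≤ᶻ 0ℤ
  rest = sum-≤0 f≤0
  lemma : ∀ a b c → (b - a) + (0ℤ - c) ≡ b - (a + c)
  lemma a b c = solve (a ∷ b ∷ c ∷ [])

-- Nonpositive entries are dropped one by one. Once a positive entry is split off, no two positive
-- ones remain, so `sum-one-positive` applies with the bound `m - f zero`. The pair bound is asked
-- for positive entries only, since `product-bound` yields it only for majorities.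
sum-two-positive : ∀ {n} (f : Fin n → ℤ) (m : ℤ) → 0ℤ ≤ᶻ m → (∀ i → f i ≤ᶻ m) →
  (∀ i j → i ≢ j → 1ℤ ≤ᶻ f i → 1ℤ ≤ᶻ f j → f i + f j ≤ᶻ m) →
  (∀ i j k → i ≢ j → i ≢ k → j ≢ k → 1ℤ ≤ᶻ f i → 1ℤ ≤ᶻ f j → 1ℤ ≤ᶻ f k → ⊥) → sum f ≤ᶻ m
sum-two-positive {zero}  f m 0≤m f≤m pair triple = 0≤m
sum-two-positive {suc n} f m 0≤m f≤m pair triple with pos? (f zero)
... | inj₁ f₀≤0 = from-gap (gap (sum-two-positive (f ∘ suc) m 0≤m (f≤m ∘ suc)
                     (λ i j i≢j → pair (suc i) (suc j) (i≢j ∘ suc-injective))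
                     λ i j k i≢j i≢k j≢k → triple (suc i) (suc j) (suc k) (i≢j ∘ suc-injective)
                       (i≢k ∘ suc-injective) (j≢k ∘ suc-injective)) ⊕ gap f₀≤0)
                     (lemma (f zero) m _)
  where lemma : ∀ a b c → (b - c) + (0ℤ - a) ≡ b - (a + c)
        lemma a b c = solve (a ∷ b ∷ c ∷ [])
... | inj₂ 0<f₀ = from-gap (gap rest) (lemma (f zero) m _)
  where
  f≤ : ∀ i → f (suc i) ≤ᶻ m - f zero
  f≤ i with pos? (f (suc i))
  ... | inj₁ ≤0 = ℤₚ.≤-trans ≤0 (gap (f≤m zero))
  ... | inj₂ 0< = from-gap (gap (pair zero (suc i) (λ ()) 0<f₀ 0<)) (lemma′ (f zero) (f (suc i)) m)
    where lemma′ : ∀ a b m → m - (a + b) ≡ (m - a) - b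
          lemma′ a b m = solve (a ∷ b ∷ m ∷ [])
  rest : sum (f ∘ suc) ≤ᶻ m - f zero
  rest = sum-one-positive (f ∘ suc) (m - f zero) (gap (f≤m zero)) f≤
    λ i j i≢j → triple zero (suc i) (suc j) (λ ()) (λ ()) (i≢j ∘ suc-injective) 0<f₀
  lemma : ∀ a b c → (b - a) - c ≡ b - (a + c)
  lemma a b c = solve (a ∷ b ∷ c ∷ [])

sum-pigeonhole : ∀ {n} {f g : Fin n → ℤ} → 1ℤ + sum f ≤ᶻ sum g → ∃[ i ] 1ℤ + f i ≤ᶻ g i
sum-pigeonhole {n} {f} {g} f<g with any? (λ i → 1ℤ + f i ≤ᶻ? g i)
... | yes found = found
... | no none = ⊥-elim (negative-gap (gap f<g ⊕ gap (sum-mono λ i → g≤f i)) (lemma (sum f) (sum g)))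
  where
  g≤f : ∀ i → g i ≤ᶻ f i
  g≤f i = ℤₚ.≮⇒≥ λ f<g → none (i , <⇒1+≤ f<g)
  lemma : ∀ a b → (b - (1ℤ + a)) + (a - b) ≡ - 1ℤ
  lemma a b = solve (a ∷ b ∷ [])

-- Below, x and x′ say whether a vertex lies in A and in B; x ∨ (not x′ ∧ t) is its colour.

settled-bad : ∀ a x x′ y y′ t t′ → not x ∧ not x′ ≡ false → x ∧ x′ ≡ false → y ∧ y′ ≡ false →
  x ∧ y ∧ a ≡ false → x′ ∧ y′ ∧ a ≡ false →
  ι (a ∧ not ((x ∨ (not x′ ∧ t)) xor (y ∨ (not y′ ∧ t′)))) ≤ᶻ ι (not y ∧ not y′)
settled-bad = from-yes (∀? λ a → ∀? λ x → ∀? λ x′ → ∀? λ y → ∀? λ y′ → ∀? λ t → ∀? λ t′ →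
  (not x ∧ not x′ ≟ᵇ false) →-dec (x ∧ x′ ≟ᵇ false) →-dec (y ∧ y′ ≟ᵇ false) →-dec
  (x ∧ y ∧ a ≟ᵇ false) →-dec (x′ ∧ y′ ∧ a ≟ᵇ false) →-dec
  (ι (a ∧ not ((x ∨ (not x′ ∧ t)) xor (y ∨ (not y′ ∧ t′)))) ≤ᶻ? ι (not y ∧ not y′)))

-- A vertex `x` outside `A` and `B` that is coloured `true` shares its colour with `A` and differs
-- from `B`, so its bad edges end in `A` or outside both.
unsettled-bad-A : ∀ a x x′ y y′ t t′ → not x ∧ not x′ ≡ true → y ∧ y′ ≡ false → t ≡ true →
  ι (a ∧ not ((x ∨ (not x′ ∧ t)) xor (y ∨ (not y′ ∧ t′)))) ≤ᶻ ι a * ι y + ι (not y ∧ not y′)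
unsettled-bad-A = from-yes (∀? λ a → ∀? λ x → ∀? λ x′ → ∀? λ y → ∀? λ y′ → ∀? λ t → ∀? λ t′ →
  (not x ∧ not x′ ≟ᵇ true) →-dec (y ∧ y′ ≟ᵇ false) →-dec (t ≟ᵇ true) →-dec
  (ι (a ∧ not ((x ∨ (not x′ ∧ t)) xor (y ∨ (not y′ ∧ t′)))) ≤ᶻ? ι a * ι y + ι (not y ∧ not y′)))

unsettled-bad-B : ∀ a x x′ y y′ t t′ → not x ∧ not x′ ≡ true → y ∧ y′ ≡ false → t ≡ false →
  ι (a ∧ not ((x ∨ (not x′ ∧ t)) xor (y ∨ (not y′ ∧ t′)))) ≤ᶻ ι a * ι y′ + ι (not y ∧ not y′)
unsettled-bad-B = from-yes (∀? λ a → ∀? λ x → ∀? λ x′ → ∀? λ y → ∀? λ y′ → ∀? λ t → ∀? λ t′ →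
  (not x ∧ not x′ ≟ᵇ true) →-dec (y ∧ y′ ≟ᵇ false) →-dec (t ≟ᵇ false) →-dec
  (ι (a ∧ not ((x ∨ (not x′ ∧ t)) xor (y ∨ (not y′ ∧ t′)))) ≤ᶻ? ι a * ι y′ + ι (not y ∧ not y′)))

-- A vertex of `A` is coloured `true`, so any nonedge from it to a `false` vertex of another part is
-- counted on the right, and `a′ ∧ a ≡ false` supplies one unless the vertex shares a part with one
-- of the two ends. The colours come with equations so that the statement matches `far` at
-- `colour x` and `colour y`.
opposite-A : ∀ c c′ s s′ a a′ z z′ t → c ≡ false → c′ ≡ false → a′ ∧ a ≡ false →
  ι z ≤ᶻ (ι s * ι z + ι s′ * ι z) +
    (ι ((not s ∧ not (not z ∧ not z′)) ∧ ((c xor (z ∨ (not z′ ∧ t))) ∧ not a))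
    + ι ((not s′ ∧ not (not z ∧ not z′)) ∧ ((c′ xor (z ∨ (not z′ ∧ t))) ∧ not a′)))
opposite-A c c′ s s′ a a′ z z′ t refl refl = from-yes (∀? λ s → ∀? λ s′ → ∀? λ a → ∀? λ a′ → ∀? λ z → ∀? λ z′ → ∀? λ t →
  (a′ ∧ a ≟ᵇ false) →-dec
  (ι z ≤ᶻ? (ι s * ι z + ι s′ * ι z) +
    (ι ((not s ∧ not (not z ∧ not z′)) ∧ ((false xor (z ∨ (not z′ ∧ t))) ∧ not a))
    + ι ((not s′ ∧ not (not z ∧ not z′)) ∧ ((false xor (z ∨ (not z′ ∧ t))) ∧ not a′))))) s s′ a a′ z z′ t

opposite-B : ∀ c c′ s s′ a a′ z z′ t → c ≡ true → c′ ≡ true → a′ ∧ a ≡ false → z ∧ z′ ≡ false →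
  ι z′ ≤ᶻ (ι s * ι z′ + ι s′ * ι z′) +
    (ι ((not s ∧ not (not z ∧ not z′)) ∧ ((c xor (z ∨ (not z′ ∧ t))) ∧ not a))
    + ι ((not s′ ∧ not (not z ∧ not z′)) ∧ ((c′ xor (z ∨ (not z′ ∧ t))) ∧ not a′)))
opposite-B c c′ s s′ a a′ z z′ t refl refl = from-yes (∀? λ s → ∀? λ s′ → ∀? λ a → ∀? λ a′ → ∀? λ z → ∀? λ z′ → ∀? λ t →
  (a′ ∧ a ≟ᵇ false) →-dec (z ∧ z′ ≟ᵇ false) →-dec
  (ι z′ ≤ᶻ? (ι s * ι z′ + ι s′ * ι z′) +
    (ι ((not s ∧ not (not z ∧ not z′)) ∧ ((true xor (z ∨ (not z′ ∧ t))) ∧ not a))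
    + ι ((not s′ ∧ not (not z ∧ not z′)) ∧ ((true xor (z ∨ (not z′ ∧ t))) ∧ not a′))))) s s′ a a′ z z′ t

-- Integration over parts of equal mass.

module Measure {N ℓ} (p : Partition N ℓ) (w : Fin N → ℤ) (M : ℤ)
  (1≤w : ∀ v → 1ℤ ≤ᶻ w v) (1≤M : 1ℤ ≤ᶻ M)
  (mass : ∀ k → sum (λ v → w v * (ι (k == p v) * 1ℤ)) ≡ M) where

  -- ν j integrates over the union of the parts V_k with j k = true.
  opaque
    ν : (Fin ℓ → Bool) → (Fin N → ℤ) → ℤ
    ν j f = sum (λ v → w v * (ι (j (p v)) * f v))

    ν-def : ∀ j f → ν j f ≡ sum (λ v → w v * (ι (j (p v)) * f v))
    ν-def j f = refl

  μ : Fin ℓ → (Fin N → ℤ) → ℤ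
  μ k = ν (k ==_)

  ν² : (Fin ℓ → Bool) → (Fin ℓ → Bool) → (Fin N → Fin N → ℤ) → ℤ
  ν² j j′ f = ν j λ x → ν j′ (f x)

  0≤M : 0ℤ ≤ᶻ M
  0≤M = ℤₚ.≤-trans (nat 1) 1≤M

  0≤w : ∀ v → 0ℤ ≤ᶻ w v
  0≤w v = ℤₚ.≤-trans (nat 1) (1≤w v)

  count : (Fin ℓ → Bool) → ℤ
  count j = sum (ι ∘ j)

  opaque
    unfolding ν
    ν-cong : ∀ j {f g} → (∀ v → j (p v) ≡ true → f v ≡ g v) → ν j f ≡ ν j g
    ν-cong j {f} {g} f≡g = sum-cong-≗ {N} λ v → cong (w v *_) (term v)
      where
      term : ∀ v → ι (j (p v)) * f v ≡ ι (j (p v)) * g v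
      term v with j (p v) in eq
      ... | true  = cong (1ℤ *_) (f≡g v eq)
      ... | false = refl

  opaque
    unfolding ν
    ν-mono : ∀ j {f g} → (∀ v → j (p v) ≡ true → f v ≤ᶻ g v) → ν j f ≤ᶻ ν j g
    ν-mono j {f} {g} f≤g = sum-mono λ v → ℤₚ.*-monoˡ-≤-nonNeg (w v) {{nonNegative (0≤w v)}} (term v)
      where
      term : ∀ v → ι (j (p v)) * f v ≤ᶻ ι (j (p v)) * g v
      term v with j (p v) in eq
      ... | true  = ℤₚ.*-monoˡ-≤-nonNeg 1ℤ (f≤g v eq)
      ... | false = ℤₚ.≤-refl

  opaque
    unfolding ν
    ν-+ : ∀ j f g → ν j (λ v → f v + g v) ≡ ν j f + ν j g
    ν-+ j f g = trans (sum-cong-≗ {N} λ v → lemma (w v) (ι (j (p v))) (f v) (g v))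
                      (∑-distrib-+ {N} _ _)
      where lemma : ∀ a b c d → a * (b * (c + d)) ≡ a * (b * c) + a * (b * d)
            lemma a b c d = solve (a ∷ b ∷ c ∷ d ∷ [])

  opaque
    unfolding ν
    ν-* : ∀ j c f → ν j (λ v → c * f v) ≡ c * ν j f
    ν-* j c f = trans (sum-cong-≗ {N} λ v → lemma (w v) (ι (j (p v))) c (f v))
                      (sym (*-distribˡ-sum {N} c _))
      where lemma : ∀ a b c d → a * (b * (c * d)) ≡ c * (a * (b * d))
            lemma a b c d = solve (a ∷ b ∷ c ∷ d ∷ [])

  ν-*ʳ : ∀ j c f → ν j (λ v → f v * c) ≡ ν j f * c
  ν-*ʳ j c f = trans (ν-cong j λ v _ → ℤₚ.*-comm (f v) c) (trans (ν-* j c f) (ℤₚ.*-comm c _))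

  ν-≥0 : ∀ j {f} → (∀ v → j (p v) ≡ true → 0ℤ ≤ᶻ f v) → 0ℤ ≤ᶻ ν j f
  ν-≥0 j 0≤f = subst (_≤ᶻ ν j _) (trans (ν-* j 0ℤ (λ _ → 0ℤ)) (ℤₚ.*-zeroˡ (ν j (λ _ → 0ℤ)))) (ν-mono j 0≤f)

  opaque
    unfolding ν
    ν-swap : ∀ j j′ f → ν² j j′ f ≡ ν² j′ j (λ y x → f x y)
    ν-swap j j′ f = trans (sum-cong-≗ {N} pull) (trans (∑-comm {N} {N} t)
                      (sum-cong-≗ {N} λ y → sym (push y)))
      where
      t : Fin N → Fin N → ℤ
      t x y = w x * (ι (j (p x)) * (w y * (ι (j′ (p y)) * f x y)))
      pull : ∀ x → w x * (ι (j (p x)) * ν j′ (f x)) ≡ sum (t x)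
      pull x = trans (sym (ℤₚ.*-assoc (w x) _ _)) (trans (*-distribˡ-sum {N} (w x * ι (j (p x))) _)
                 (sum-cong-≗ {N} λ y → ℤₚ.*-assoc (w x) (ι (j (p x))) (w y * (ι (j′ (p y)) * f x y))))
      push : ∀ y → w y * (ι (j′ (p y)) * ν j (λ x → f x y)) ≡ sum (λ x → t x y)
      push y = trans (sym (ℤₚ.*-assoc (w y) (ι (j′ (p y))) _)) (trans (*-distribˡ-sum {N} (w y * ι (j′ (p y))) _)
                 (sum-cong-≗ {N} λ x → lemma (w x) (ι (j (p x))) (w y) (ι (j′ (p y))) (f x y)))
        where lemma : ∀ a b c d e → (c * d) * (a * (b * e)) ≡ a * (b * (c * (d * e)))
              lemma a b c d e = solve (a ∷ b ∷ c ∷ d ∷ e ∷ [])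

  opaque
    unfolding ν
    -- All weights are at least 1, so a single nonnegative term cannot be positive under an integral
    -- that is at most 0.
    ν-vanish : ∀ j {f} → (∀ v → j (p v) ≡ true → 0ℤ ≤ᶻ f v) → ν j f ≤ᶻ 0ℤ →
      ∀ v → j (p v) ≡ true → f v ≤ᶻ 0ℤ
    ν-vanish j {f} 0≤f ν≤0 v jv = cancel-pos (w v) (1≤w v)
      (ℤₚ.≤-trans (subst (λ b → w v * f v ≤ᶻ w v * (ι b * f v)) (sym jv)
                     (ℤₚ.≤-reflexive (cong (w v *_) (sym (ℤₚ.*-identityˡ (f v))))))
        (ℤₚ.≤-trans (term-≤-sum (λ u → 0≤w u ⊗ term u) v)
          (ℤₚ.≤-trans ν≤0 (ℤₚ.≤-reflexive (sym (ℤₚ.*-zeroʳ (w v)))))))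
      where
      term : ∀ u → 0ℤ ≤ᶻ ι (j (p u)) * f u
      term u with j (p u) in eq
      ... | true  = nat 1 ⊗ 0≤f u eq
      ... | false = ℤₚ.≤-refl

  opaque
    unfolding ν
    ν-⊆ : ∀ j j′ {f} → (∀ k → j k ≡ true → j′ k ≡ true) → (∀ v → 0ℤ ≤ᶻ f v) → ν j f ≤ᶻ ν j′ f
    ν-⊆ j j′ {f} j⊆j′ 0≤f = sum-mono λ v → ℤₚ.*-monoˡ-≤-nonNeg (w v) {{nonNegative (0≤w v)}} (term v)
      where
      term : ∀ v → ι (j (p v)) * f v ≤ᶻ ι (j′ (p v)) * f v
      term v with j (p v) in eq
      ... | true rewrite j⊆j′ (p v) eq = ℤₚ.≤-refl
      ... | false = ι-≥0 (j′ (p v)) ⊗ 0≤f v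

  opaque
    unfolding ν
    ν-parts : ∀ j f → ν j f ≡ sum (λ k → ι (j k) * μ k f)
    ν-parts j f = sym (trans (sum-cong-≗ {ℓ} λ k → *-distribˡ-sum {N} (ι (j k)) _)
      (trans (∑-comm {ℓ} {N} _) (sum-cong-≗ {N} λ v →
        trans (sum-cong-≗ {ℓ} λ k → term v k) (sum-== (p v) (λ k → w v * (ι (j k) * f v))))))
      where
      lemma : ∀ a b c d → a * (b * (c * d)) ≡ c * (b * (a * d))
      lemma a b c d = solve (a ∷ b ∷ c ∷ d ∷ [])
      term : ∀ v k → ι (j k) * (w v * (ι (k == p v) * f v)) ≡ ι (p v == k) * (w v * (ι (j k) * f v))
      term v k = trans (lemma (ι (j k)) (w v) (ι (k == p v)) (f v))
                       (cong (λ b → ι b * (w v * (ι (j k) * f v))) (==-sym k (p v)))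

  opaque
    unfolding ν
    ν-restrict : ∀ j k f → ν j (λ v → ι (k == p v) * f v) ≡ ι (j k) * μ k f
    ν-restrict j k f = trans (sum-cong-≗ {N} term) (sym (*-distribˡ-sum {N} (ι (j k)) _))
      where
      swap : ∀ a b c d → a * (b * (c * d)) ≡ b * (a * (c * d))
      swap a b c d = solve (a ∷ b ∷ c ∷ d ∷ [])
      zeros : ∀ a b c d → a * (b * (0ℤ * d)) ≡ c * (a * (0ℤ * d))
      zeros a b c d = solve (a ∷ b ∷ c ∷ d ∷ [])
      term : ∀ v → w v * (ι (j (p v)) * (ι (k == p v) * f v)) ≡ ι (j k) * (w v * (ι (k == p v) * f v))
      term v with k ≟ᶠ p v
      ... | yes refl = swap (w v) (ι (j (p v))) 1ℤ (f v)
      ... | no _     = zeros (w v) (ι (j (p v))) (ι (j k)) (f v)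

  -- In contrast to `ν-mono`, nothing is assumed pointwise: the density hypothesis compares
  -- integrals over parts and says nothing about single vertices.
  ν-parts-mono : ∀ j {f g} → (∀ k → j k ≡ true → μ k f ≤ᶻ μ k g) → ν j f ≤ᶻ ν j g
  ν-parts-mono j {f} {g} f≤g = subst₂ _≤ᶻ_ (sym (ν-parts j f)) (sym (ν-parts j g)) (sum-mono term)
    where
    term : ∀ k → ι (j k) * μ k f ≤ᶻ ι (j k) * μ k g
    term k with j k in eq
    ... | true  = ℤₚ.*-monoˡ-≤-nonNeg 1ℤ (f≤g k eq)
    ... | false = ℤₚ.≤-refl

  μ-mono : ∀ k {f g} → (∀ v → p v ≡ k → f v ≤ᶻ g v) → μ k f ≤ᶻ μ k g
  μ-mono k f≤g = ν-mono (k ==_) λ v eq → f≤g v (sym (==⇒≡ eq))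

  μ-cong : ∀ k {f g} → (∀ v → p v ≡ k → f v ≡ g v) → μ k f ≡ μ k g
  μ-cong k f≡g = ν-cong (k ==_) λ v eq → f≡g v (sym (==⇒≡ eq))

  opaque
    unfolding ν
    μ-const : ∀ k c → μ k (λ _ → c) ≡ c * M
    μ-const k c = trans (ν-cong (k ==_) λ _ _ → sym (ℤₚ.*-identityʳ c))
                    (trans (ν-* (k ==_) c (λ _ → 1ℤ)) (cong (c *_) (mass k)))

  ν-const : ∀ j c → ν j (λ _ → c) ≡ c * (count j * M)
  ν-const j c = trans (ν-parts j _) (trans (sum-cong-≗ {ℓ} λ k → term k)
    (trans (sym (*-distribˡ-sum {ℓ} (c * M) _)) (lemma c M (count j))))
    where
    lemma : ∀ a b c → (a * b) * c ≡ a * (c * b)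
    lemma a b c = solve (a ∷ b ∷ c ∷ [])
    term : ∀ k → ι (j k) * μ k (λ _ → c) ≡ c * M * ι (j k)
    term k = trans (cong (ι (j k) *_) (μ-const k c)) (ℤₚ.*-comm (ι (j k)) _)

  ν²-mono : ∀ j j′ {f g} → (∀ x y → j (p x) ≡ true → j′ (p y) ≡ true → f x y ≤ᶻ g x y) →
    ν² j j′ f ≤ᶻ ν² j j′ g
  ν²-mono j j′ f≤g = ν-mono j λ x jx → ν-mono j′ λ y jy → f≤g x y jx jy

  ν²-+ : ∀ j j′ f g → ν² j j′ (λ x y → f x y + g x y) ≡ ν² j j′ f + ν² j j′ g
  ν²-+ j j′ f g = trans (ν-cong j λ x _ → ν-+ j′ (f x) (g x)) (ν-+ j _ _)

  ν²-* : ∀ j j′ c f → ν² j j′ (λ x y → c * f x y) ≡ c * ν² j j′ f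
  ν²-* j j′ c f = trans (ν-cong j λ x _ → ν-* j′ c (f x)) (ν-* j c _)

  ν²-product : ∀ j j′ f g → ν² j j′ (λ x y → f x * g y) ≡ ν j f * ν j′ g
  ν²-product j j′ f g = trans (ν-cong j λ x _ → ν-* j′ (f x) g) (ν-*ʳ j (ν j′ g) f)

  ν²-≥0 : ∀ j j′ {f} → (∀ x y → 0ℤ ≤ᶻ f x y) → 0ℤ ≤ᶻ ν² j j′ f
  ν²-≥0 j j′ 0≤f = ν-≥0 j λ x _ → ν-≥0 j′ λ y _ → 0≤f x y

  ν²-parts-mono : ∀ j j′ {f g} →
    (∀ k l → j k ≡ true → j′ l ≡ true → ν² (k ==_) (l ==_) f ≤ᶻ ν² (k ==_) (l ==_) g) →
    ν² j j′ f ≤ᶻ ν² j j′ g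
  ν²-parts-mono j j′ {f} {g} f≤g = ν-parts-mono j λ k jk →
    subst₂ _≤ᶻ_ (ν-swap j′ (k ==_) (λ y x → f x y)) (ν-swap j′ (k ==_) (λ y x → g x y))
      (ν-parts-mono j′ λ l jl →
        subst₂ _≤ᶻ_ (ν-swap (k ==_) (l ==_) f) (ν-swap (k ==_) (l ==_) g) (f≤g k l jk jl))

-- Cuts and independent sets in a triangle-free graph.

module TriangleFree {N ℓ} (G : Graph N) (p : Partition N ℓ) (w : Fin N → ℤ) (M : ℤ)
  (1≤w : ∀ v → 1ℤ ≤ᶻ w v) (1≤M : 1ℤ ≤ᶻ M)
  (mass : ∀ k → sum (λ v → w v * (ι (k == p v) * 1ℤ)) ≡ M)
  (partite : ∀ u v → adj G u v ≡ true → p u ≢ p v)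
  (triangle-free : ∀ x y z → adj G x y ≡ true → adj G y z ≡ true → adj G x z ≡ true → ⊥)
  (dense : ∀ i j → i ≢ j →
    M * M ≤ᶻ + 2 * Measure.ν² p w M 1≤w 1≤M mass (i ==_) (j ==_) (λ x y → ι (adj G x y)))
  where

  open Measure p w M 1≤w 1≤M mass

  e : Fin N → Fin N → ℤ
  e x y = ι (adj G x y)

  e-sym : ∀ x y → e x y ≡ e y x
  e-sym x y = cong ι (adj-sym G x y)

  -- The part test in `miss` discards pairs inside a part, which are nonedges in any case.
  bad miss : (Fin N → Bool) → Fin N → Fin N → ℤ
  bad  s x y = ι (adj G x y ∧ not (s x xor s y))
  miss s x y = ι (not (p x == p y) ∧ (not (adj G x y) ∧ (s x xor s y)))

  excess : (Fin N → Bool) → Fin ℓ → ℤ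
  excess s k = + 2 * μ k (ι ∘ s) - M

  μ-not : ∀ k s → μ k (ι ∘ not ∘ s) ≡ M - μ k (ι ∘ s)
  μ-not k s = trans (lemma (μ k (ι ∘ s)) (μ k (ι ∘ not ∘ s)))
    (cong (_- μ k (ι ∘ s)) (trans (sym (ν-+ (k ==_) (ι ∘ not ∘ s) (ι ∘ s)))
      (trans (μ-cong k λ v _ → ι-not (s v)) (trans (μ-const k 1ℤ) (ℤₚ.*-identityˡ M)))))
    where
    lemma : ∀ a b → b ≡ (b + a) - a
    lemma a b = solve (a ∷ b ∷ [])
    ι-not : ∀ b → ι (not b) + ι b ≡ 1ℤ
    ι-not = from-yes (∀? λ b → (ι (not b) + ι b) ≟ᶻ 1ℤ)

  cut-identity : ∀ a x y → ι a + ι (not a ∧ (x xor y)) ≡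
    (ι x * ι (not y) + ι (not x) * ι y) + ι (a ∧ not (x xor y))
  cut-identity = from-yes (∀? λ a → ∀? λ x → ∀? λ y → (ι a + ι (not a ∧ (x xor y))) ≟ᶻ
    ((ι x * ι (not y) + ι (not x) * ι y) + ι (a ∧ not (x xor y))))

  -- Integrating `cut-identity` shows that edges and misses together weigh as much as crossing pairs
  -- and bad edges together. Twice the mass of the crossing pairs is `M * M` minus the product of
  -- the excesses.
  cut-density : ∀ s i j → i ≢ j →
    + 2 * ν² (i ==_) (j ==_) (miss s) + excess s i * excess s j ≤ᶻ + 2 * ν² (i ==_) (j ==_) (bad s)
  cut-density s i j i≢j = arith a a′ E Mi B M identity (dense i j i≢j)
    where
    a a′ E Mi B : ℤ
    a  = μ i (ι ∘ s)
    a′ = μ j (ι ∘ s)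
    E  = ν² (i ==_) (j ==_) e
    Mi = ν² (i ==_) (j ==_) (miss s)
    B  = ν² (i ==_) (j ==_) (bad s)
    pointwise : ∀ x → p x ≡ i → ∀ y → p y ≡ j → e x y + miss s x y ≡
      (ι (s x) * ι (not (s y)) + ι (not (s x)) * ι (s y)) + bad s x y
    pointwise x refl y refl rewrite ==-≢ i≢j = cut-identity (adj G x y) (s x) (s y)
    identity : E + Mi ≡ (a * (M - a′) + (M - a) * a′) + B
    identity = begin
      E + Mi
        ≡⟨ sym (ν²-+ (i ==_) (j ==_) e (miss s)) ⟩
      ν² (i ==_) (j ==_) (λ x y → e x y + miss s x y)
        ≡⟨ μ-cong i (λ x px → μ-cong j (λ y py → pointwise x px y py)) ⟩
      ν² (i ==_) (j ==_) (λ x y → (ι (s x) * ι (not (s y)) + ι (not (s x)) * ι (s y)) + bad s x y)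
        ≡⟨ ν²-+ (i ==_) (j ==_) _ _ ⟩
      ν² (i ==_) (j ==_) (λ x y → ι (s x) * ι (not (s y)) + ι (not (s x)) * ι (s y)) + B
        ≡⟨ cong (_+ B) (ν²-+ (i ==_) (j ==_) _ _) ⟩
      (ν² (i ==_) (j ==_) (λ x y → ι (s x) * ι (not (s y)))
        + ν² (i ==_) (j ==_) (λ x y → ι (not (s x)) * ι (s y))) + B
        ≡⟨ cong (_+ B) (cong₂ _+_
             (trans (ν²-product (i ==_) (j ==_) (ι ∘ s) (ι ∘ not ∘ s)) (cong (a *_) (μ-not j s)))
             (trans (ν²-product (i ==_) (j ==_) (ι ∘ not ∘ s) (ι ∘ s)) (cong (_* a′) (μ-not i s)))) ⟩
      (a * (M - a′) + (M - a) * a′) + B ∎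
      where open ≡-Reasoning
    arith : ∀ a a′ E Mi B M → E + Mi ≡ (a * (M - a′) + (M - a) * a′) + B → M * M ≤ᶻ + 2 * E →
      + 2 * Mi + (+ 2 * a - M) * (+ 2 * a′ - M) ≤ᶻ + 2 * B
    arith a a′ E Mi B M eq M²≤2E = from-gap
      (gap M²≤2E ⊕ nat 2 ⊗ gap (ℤₚ.≤-reflexive eq))
      (solve (a ∷ a′ ∷ E ∷ Mi ∷ B ∷ M ∷ []))

  d : Fin ℓ → Fin N → ℤ
  d k v = μ k (e v)

  e-≥0 : ∀ x y → 0ℤ ≤ᶻ e x y
  e-≥0 x y = ι-≥0 (adj G x y)

  d-≥0 : ∀ k v → 0ℤ ≤ᶻ d k v
  d-≥0 k v = ν-≥0 (k ==_) λ y _ → e-≥0 v y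

  μ-ι-≤M : ∀ k s → μ k (ι ∘ s) ≤ᶻ M
  μ-ι-≤M k s = subst (μ k (ι ∘ s) ≤ᶻ_) (trans (μ-const k 1ℤ) (ℤₚ.*-identityˡ M))
    (μ-mono k λ v _ → ι-≤1 (s v))

  e-same-part : ∀ x y → p x ≡ p y → adj G x y ≡ false
  e-same-part x y px≡py with adj G x y in eq
  ... | false = refl
  ... | true  = ⊥-elim (partite x y eq px≡py)

  d-own : ∀ v → d (p v) v ≡ 0ℤ
  d-own v = trans (μ-cong (p v) λ y py → cong ι (e-same-part v y (sym py))) (trans (μ-const (p v) 0ℤ) (ℤₚ.*-zeroˡ M))

  Independent : (Fin N → Bool) → Set
  Independent s = ∀ x y → s x ≡ true → s y ≡ true → adj G x y ≡ true → ⊥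

  neighbours-independent : ∀ v → Independent (adj G v)
  neighbours-independent v x y vx vy xy = triangle-free v x y vx xy vy

  conflict : ∀ {a b c} → (a ≡ true → b ≡ true → c ≡ true → ⊥) → a ∧ b ∧ c ≡ false
  conflict {true}  {true}  {true}  f = ⊥-elim (f refl refl refl)
  conflict {true}  {true}  {false} f = refl
  conflict {true}  {false} {_}     f = refl
  conflict {false} {_}     {_}     f = refl

  -- A bad edge xy forces each z in the independent set to miss x or y.
  charging : ∀ a b c x y z → a ∧ b ∧ c ≡ false →
    x ∧ y ∧ a ≡ false → y ∧ z ∧ b ≡ false → x ∧ z ∧ c ≡ false →
    ι (a ∧ not (x xor y)) * ι z + ι y * ι (c ∧ not (x xor z)) + ι x * ι (b ∧ not (y xor z)) ≤ᶻ
    ι (not a ∧ (x xor y)) * ι (not z) + ι (not y) * ι (not c ∧ (x xor z)) + ι (not x) * ι (not b ∧ (y xor z))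
  charging = from-yes (∀? λ a → ∀? λ b → ∀? λ c → ∀? λ x → ∀? λ y → ∀? λ z →
    (a ∧ b ∧ c ≟ᵇ false) →-dec (x ∧ y ∧ a ≟ᵇ false) →-dec (y ∧ z ∧ b ≟ᵇ false) →-dec (x ∧ z ∧ c ≟ᵇ false) →-dec
    (ι (a ∧ not (x xor y)) * ι z + ι y * ι (c ∧ not (x xor z)) + ι x * ι (b ∧ not (y xor z)) ≤ᶻ?
    ι (not a ∧ (x xor y)) * ι (not z) + ι (not y) * ι (not c ∧ (x xor z)) + ι (not x) * ι (not b ∧ (y xor z))))

  triple-integral : ∀ j k m (f : Fin N → Fin N → ℤ) (g : Fin N → ℤ) →
    μ j (λ x → ν² (k ==_) (m ==_) (λ y z → f x y * g z + g y * f x z + g x * f y z)) ≡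
    ν² (j ==_) (k ==_) f * μ m g + μ k g * ν² (j ==_) (m ==_) f + μ j g * ν² (k ==_) (m ==_) f
  triple-integral j k m f g = begin
    μ j (λ x → ν² (k ==_) (m ==_) (λ y z → f x y * g z + g y * f x z + g x * f y z))
      ≡⟨ μ-cong j (λ x _ → trans (ν²-+ (k ==_) (m ==_) _ _) (cong₂ _+_
           (trans (ν²-+ (k ==_) (m ==_) _ _) (cong₂ _+_
             (ν²-product (k ==_) (m ==_) (f x) g)
             (ν²-product (k ==_) (m ==_) g (f x))))
           (ν²-* (k ==_) (m ==_) (g x) f))) ⟩
    μ j (λ x → μ k (f x) * μ m g + μ k g * μ m (f x) + g x * ν² (k ==_) (m ==_) f)
      ≡⟨ trans (ν-+ (j ==_) _ _) (cong₂ _+_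
           (trans (ν-+ (j ==_) _ _) (cong₂ _+_
             (ν-*ʳ (j ==_) (μ m g) (λ x → μ k (f x)))
             (ν-* (j ==_) (μ k g) (λ x → μ m (f x)))))
           (ν-*ʳ (j ==_) (ν² (k ==_) (m ==_) f) g)) ⟩
    ν² (j ==_) (k ==_) f * μ m g + μ k g * ν² (j ==_) (m ==_) f + μ j g * ν² (k ==_) (m ==_) f ∎
    where open ≡-Reasoning

  -- In the integral of `charging`, each bad mass is weighted by the mass of `s` in the third part,
  -- and each miss mass by the rest of that part, which is smaller if `s` is a majority there. But
  -- by `cut-density` each bad mass exceeds the miss mass by half the product of two positive
  -- excesses.
  no-three-majorities : ∀ s → Independent s → ∀ j k m → j ≢ k → j ≢ m → k ≢ m →
    1ℤ ≤ᶻ excess s j → 1ℤ ≤ᶻ excess s k → 1ℤ ≤ᶻ excess s m → ⊥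
  no-three-majorities s ind j k m j≢k j≢m k≢m xj xk xm =
    arith M (μ j (ι ∘ s)) (μ k (ι ∘ s)) (μ m (ι ∘ s))
      (ν² (j ==_) (k ==_) (bad s)) (ν² (j ==_) (m ==_) (bad s)) (ν² (k ==_) (m ==_) (bad s))
      (ν² (j ==_) (k ==_) (miss s)) (ν² (j ==_) (m ==_) (miss s)) (ν² (k ==_) (m ==_) (miss s))
      0≤M (miss≥0 j k) (miss≥0 j m) (miss≥0 k m) xj xk xm
      (cut-density s j k j≢k) (cut-density s j m j≢m) (cut-density s k m k≢m)
      charged
    where
    miss≥0 : ∀ j k → 0ℤ ≤ᶻ ν² (j ==_) (k ==_) (miss s)
    miss≥0 j k = ν²-≥0 (j ==_) (k ==_) λ x y → ι-≥0 _
    pointwise : ∀ x → p x ≡ j → ∀ y → p y ≡ k → ∀ z → p z ≡ m →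
      bad s x y * ι (s z) + ι (s y) * bad s x z + ι (s x) * bad s y z ≤ᶻ
      miss s x y * ι (not (s z)) + ι (not (s y)) * miss s x z + ι (not (s x)) * miss s y z
    pointwise x refl y refl z refl rewrite ==-≢ j≢k | ==-≢ j≢m | ==-≢ k≢m =
      charging (adj G x y) (adj G y z) (adj G x z) (s x) (s y) (s z)
        (conflict (triangle-free x y z)) (conflict (ind x y)) (conflict (ind y z)) (conflict (ind x z))
    charged : ν² (j ==_) (k ==_) (bad s) * μ m (ι ∘ s) + μ k (ι ∘ s) * ν² (j ==_) (m ==_) (bad s)
        + μ j (ι ∘ s) * ν² (k ==_) (m ==_) (bad s) ≤ᶻ
      ν² (j ==_) (k ==_) (miss s) * (M - μ m (ι ∘ s)) + (M - μ k (ι ∘ s)) * ν² (j ==_) (m ==_) (miss s)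
        + (M - μ j (ι ∘ s)) * ν² (k ==_) (m ==_) (miss s)
    charged = subst₂ _≤ᶻ_ (triple-integral j k m (bad s) (ι ∘ s))
      (trans (triple-integral j k m (miss s) (ι ∘ not ∘ s))
        (cong₂ _+_ (cong₂ _+_ (cong (ν² (j ==_) (k ==_) (miss s) *_) (μ-not m s))
                              (cong (_* ν² (j ==_) (m ==_) (miss s)) (μ-not k s)))
                   (cong (_* ν² (k ==_) (m ==_) (miss s)) (μ-not j s))))
      (μ-mono j λ x px → μ-mono k λ y py → μ-mono m λ z pz → pointwise x px y py z pz)
    half : ∀ a M → 0ℤ ≤ᶻ M → 1ℤ ≤ᶻ + 2 * a - M → 1ℤ ≤ᶻ a
    half a M 0≤M 1≤x with pos? a
    ... | inj₂ 1≤a = 1≤a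
    ... | inj₁ a≤0 = ⊥-elim (absurd a M 0≤M 1≤x a≤0)
      where
      absurd : ∀ a M → 0ℤ ≤ᶻ M → 1ℤ ≤ᶻ + 2 * a - M → a ≤ᶻ 0ℤ → ⊥
      absurd a M 0≤M 1≤x a≤0 = negative-gap (gap 1≤x ⊕ 0≤M ⊕ nat 2 ⊗ gap a≤0) (solve (a ∷ M ∷ []))
    arith : ∀ M a b c Bab Bac Bbc Mab Mac Mbc → 0ℤ ≤ᶻ M → 0ℤ ≤ᶻ Mab → 0ℤ ≤ᶻ Mac → 0ℤ ≤ᶻ Mbc →
      1ℤ ≤ᶻ + 2 * a - M → 1ℤ ≤ᶻ + 2 * b - M → 1ℤ ≤ᶻ + 2 * c - M →
      + 2 * Mab + (+ 2 * a - M) * (+ 2 * b - M) ≤ᶻ + 2 * Bab →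
      + 2 * Mac + (+ 2 * a - M) * (+ 2 * c - M) ≤ᶻ + 2 * Bac →
      + 2 * Mbc + (+ 2 * b - M) * (+ 2 * c - M) ≤ᶻ + 2 * Bbc →
      Bab * c + b * Bac + a * Bbc ≤ᶻ Mab * (M - c) + (M - b) * Mac + (M - a) * Mbc → ⊥
    arith M a b c Bab Bac Bbc Mab Mac Mbc 0≤M 0≤Mab 0≤Mac 0≤Mbc xa xb xc hab hac hbc h =
      negative-gap
        (nat 2 ⊗ gap h ⊕ 0≤b ⊗ gap hac ⊕ 0≤a ⊗ gap hbc ⊕ 0≤c ⊗ gap hab
          ⊕ nat 2 ⊗ 0≤Mab ⊗ (gap xc ⊕ nat 1) ⊕ nat 2 ⊗ 0≤Mac ⊗ (gap xb ⊕ nat 1) ⊕ nat 2 ⊗ 0≤Mbc ⊗ (gap xa ⊕ nat 1)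
          ⊕ 0≤b ⊗ (gap xa ⊕ nat 1) ⊗ (gap xc ⊕ nat 1) ⊕ 0≤a ⊗ (gap xb ⊕ nat 1) ⊗ (gap xc ⊕ nat 1)
          ⊕ gap (1≤-* (half c M 0≤M xc) (1≤-* xa xb)))
        (solve (M ∷ a ∷ b ∷ c ∷ Bab ∷ Bac ∷ Bbc ∷ Mab ∷ Mac ∷ Mbc ∷ []))
      where
      0≤a : 0ℤ ≤ᶻ a
      0≤a = ℤₚ.≤-trans (nat 1) (half a M 0≤M xa)
      0≤b : 0ℤ ≤ᶻ b
      0≤b = ℤₚ.≤-trans (nat 1) (half b M 0≤M xb)
      0≤c : 0ℤ ≤ᶻ c
      0≤c = ℤₚ.≤-trans (nat 1) (half c M 0≤M xc)

  -- Pairs inside `s` are nonedges, and at most half of the mass of pairs between two parts consists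
  -- of nonedges.
  product-bound : ∀ s → Independent s → ∀ j k → j ≢ k → + 2 * (μ j (ι ∘ s) * μ k (ι ∘ s)) ≤ᶻ M * M
  product-bound s ind j k j≢k =
    arith M (ν² (j ==_) (k ==_) e) (μ j (ι ∘ s) * μ k (ι ∘ s)) (dense j k j≢k)
      (subst₂ _≤ᶻ_ (trans (ν²-+ (j ==_) (k ==_) e _)
                      (cong₂ _+_ (refl {x = ν² (j ==_) (k ==_) e}) (ν²-product (j ==_) (k ==_) (ι ∘ s) (ι ∘ s))))
        (trans (μ-cong j (λ x _ → trans (μ-const k 1ℤ) (ℤₚ.*-identityˡ M))) (μ-const j M))
        (ν²-mono (j ==_) (k ==_) λ x y _ _ → pointwise (adj G x y) (s x) (s y) (conflict (ind x y))))
    where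
    pointwise : ∀ a x y → x ∧ y ∧ a ≡ false → ι a + ι x * ι y ≤ᶻ 1ℤ
    pointwise = from-yes (∀? λ a → ∀? λ x → ∀? λ y → (x ∧ y ∧ a ≟ᵇ false) →-dec (ι a + ι x * ι y ≤ᶻ? 1ℤ))
    arith : ∀ M E q → M * M ≤ᶻ + 2 * E → E + q ≤ᶻ M * M → + 2 * q ≤ᶻ M * M
    arith M E q h h′ = from-gap (gap h ⊕ nat 2 ⊗ gap h′) (solve (M ∷ E ∷ q ∷ []))

  -- Degrees in excess of one half.

  surplus : Fin N → Fin ℓ → ℤ
  surplus v k = excess (adj G v) k ⊔ 0ℤ

  surplus-positive : ∀ v k → 1ℤ ≤ᶻ surplus v k → surplus v k ≡ excess (adj G v) k
  surplus-positive v k 1≤s with ℤₚ.⊔-sel (excess (adj G v) k) 0ℤ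
  ... | inj₁ eq = eq
  ... | inj₂ eq with subst (1ℤ ≤ᶻ_) eq 1≤s
  ... | +≤+ ()

  surplus-excess : ∀ v k → 1ℤ ≤ᶻ surplus v k → 1ℤ ≤ᶻ excess (adj G v) k
  surplus-excess v k 1≤s = subst (1ℤ ≤ᶻ_) (surplus-positive v k 1≤s) 1≤s

  no-three-surpluses : ∀ v i j k → i ≢ j → i ≢ k → j ≢ k →
    1ℤ ≤ᶻ surplus v i → 1ℤ ≤ᶻ surplus v j → 1ℤ ≤ᶻ surplus v k → ⊥
  no-three-surpluses v i j k i≢j i≢k j≢k si sj sk =
    no-three-majorities (adj G v) (neighbours-independent v) i j k i≢j i≢k j≢k
      (surplus-excess v i si) (surplus-excess v j sj) (surplus-excess v k sk)

  sum-surplus : ∀ v → sum (surplus v) ≤ᶻ M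
  sum-surplus v = sum-two-positive (surplus v) M 0≤M single pair (no-three-surpluses v)
    where
    single : ∀ k → surplus v k ≤ᶻ M
    single k = ℤₚ.⊔-lub (arith (d k v) M (μ-ι-≤M k (adj G v))) 0≤M
      where
      arith : ∀ a M → a ≤ᶻ M → + 2 * a - M ≤ᶻ M
      arith a M h = from-gap (nat 2 ⊗ gap h) (solve (a ∷ M ∷ []))
    pair : ∀ j k → j ≢ k → 1ℤ ≤ᶻ surplus v j → 1ℤ ≤ᶻ surplus v k → surplus v j + surplus v k ≤ᶻ M
    pair j k j≢k sj sk = subst (_≤ᶻ M) (sym (cong₂ _+_ (surplus-positive v j sj) (surplus-positive v k sk)))
      (cancel-pos M 1≤M (arith M (d j v) (d k v) (surplus-excess v j sj) (surplus-excess v k sk)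
        (product-bound (adj G v) (neighbours-independent v) j k j≢k)))
      where
      arith : ∀ M a b → 1ℤ ≤ᶻ + 2 * a - M → 1ℤ ≤ᶻ + 2 * b - M → + 2 * (a * b) ≤ᶻ M * M →
        M * ((+ 2 * a - M) + (+ 2 * b - M)) ≤ᶻ M * M
      arith M a b xa xb h = from-gap ((gap xa ⊕ nat 1) ⊗ (gap xb ⊕ nat 1) ⊕ nat 2 ⊗ gap h)
        (solve (M ∷ a ∷ b ∷ []))

  -- The part of `x` contributes no degree where half of its mass would be allowed. After doubling,
  -- this saves `M`, which pays for the total surplus.
  degree-bound : ∀ j x → j (p x) ≡ true → + 2 * ν j (e x) ≤ᶻ count j * M
  degree-bound j x jx = begin
    + 2 * ν j (e x)
      ≡⟨ cong (+ 2 *_) (ν-parts j (e x)) ⟩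
    + 2 * sum (λ k → ι (j k) * d k x)
      ≡⟨ *-distribˡ-sum {ℓ} (+ 2) _ ⟩
    sum (λ k → + 2 * (ι (j k) * d k x))
      ≤⟨ sum-mono term ⟩
    sum (λ k → surplus x k + (M * ι (j k) + ι (p x == k) * (- M)))
      ≡⟨ trans (∑-distrib-+ {ℓ} (surplus x) _) (cong₂ _+_ (refl {x = sum (surplus x)})
           (trans (∑-distrib-+ {ℓ} _ _) (cong₂ _+_ (sym (*-distribˡ-sum {ℓ} M _)) (sum-== (p x) (λ _ → - M))))) ⟩
    sum (surplus x) + (M * count j + - M)
      ≤⟨ arith (sum (surplus x)) M (count j) (sum-surplus x) ⟩
    count j * M ∎
    where
    open ℤₚ.≤-Reasoning
    arith : ∀ s M c → s ≤ᶻ M → s + (M * c + - M) ≤ᶻ c * M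
    arith s M c h = from-gap (gap h) (solve (s ∷ M ∷ c ∷ []))
    term : ∀ k → + 2 * (ι (j k) * d k x) ≤ᶻ surplus x k + (M * ι (j k) + ι (p x == k) * (- M))
    term k with p x ≟ᶠ k
    ... | yes refl = own (surplus x (p x)) M (ι (j (p x))) (d (p x) x) (cong ι jx) (d-own x)
      (ℤₚ.i≤j⊔i (excess (adj G x) (p x)) 0ℤ)
      where
      own : ∀ s M i a → i ≡ 1ℤ → a ≡ 0ℤ → 0ℤ ≤ᶻ s → + 2 * (i * a) ≤ᶻ s + (M * i + 1ℤ * (- M))
      own s M i a refl refl 0≤s = from-gap 0≤s (lemma s M)
        where
        lemma : ∀ s M → s ≡ s + (M * 1ℤ + 1ℤ * (- M)) - + 2 * (1ℤ * 0ℤ)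
        lemma s M = solve (s ∷ M ∷ [])
    ... | no _ = other (surplus x k) M (j k) (d k x)
      (ℤₚ.i≤j⊔i (excess (adj G x) k) 0ℤ) (ℤₚ.i≤i⊔j (excess (adj G x) k) 0ℤ)
      where
      other : ∀ s M b a → 0ℤ ≤ᶻ s → + 2 * a - M ≤ᶻ s → + 2 * (ι b * a) ≤ᶻ s + (M * ι b + 0ℤ * (- M))
      other s M true a 0≤s h = from-gap (gap h) (lemma s M a)
        where
        lemma : ∀ s M a → s - (+ 2 * a - M) ≡ s + (M * 1ℤ + 0ℤ * (- M)) - + 2 * (1ℤ * a)
        lemma s M a = solve (s ∷ M ∷ a ∷ [])
      other s M false a 0≤s h = from-gap 0≤s (lemma s M a)
        where
        lemma : ∀ s M a → s ≡ s + (M * 0ℤ + 0ℤ * (- M)) - + 2 * (0ℤ * a)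
        lemma s M a = solve (s ∷ M ∷ a ∷ [])

  all-parts : Fin ℓ → Bool
  all-parts _ = true

  D : Fin N → ℤ
  D v = ν all-parts (e v)

  D-sum : ∀ v → D v ≡ sum (λ k → d k v)
  D-sum v = trans (ν-parts all-parts (e v)) (sum-cong-≗ {ℓ} λ k → ℤₚ.*-identityˡ (d k v))

  count-all : count all-parts ≡ + ℓ
  count-all = trans (sum-const ℓ 1ℤ) (ℤₚ.*-identityʳ (+ ℓ))

  ν-const-all : ∀ c → ν all-parts (λ _ → c) ≡ c * (+ ℓ * M)
  ν-const-all c = trans (ν-const all-parts c) (cong (λ n → c * (n * M)) count-all)

  -- A Mantel count for an edge with small slack.

  away : Fin N → Fin N → Fin ℓ → Bool
  away u v k = not (p u == k) ∧ not (p v == k)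

  -- If `u` and `v` are adjacent, their neighbourhoods are disjoint, and this is the mass outside
  -- both in the parts that contain neither `u` nor `v`.
  slack : Fin N → Fin N → ℤ
  slack u v = sum (λ k → ι (away u v k) * (M - d k u - d k v))

  -- Over all parts, the integrand of `slack` sums to ℓM - D u - D v. The two omitted parts account
  -- for M - d (p u) v and M - d (p v) u, since a vertex has no neighbours in its own part.
  slack-identity : ∀ u v → adj G u v ≡ true →
    slack u v + D u + D v ≡ (+ ℓ - + 2) * M + d (p u) v + d (p v) u
  slack-identity u v uv = arith (+ ℓ) M (slack u v) (sum t) (D u) (D v) (d (p u) v) (d (p v) u)
    (d (p u) u) (d (p v) v) (d-own u) (d-own v) split total
    where
    t : Fin ℓ → ℤ
    t k = M - d k u - d k v
    weights : ∀ a b t → a ∧ b ≡ false → ι (not a ∧ not b) * t ≡ t + (ι a * (- t) + ι b * (- t))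
    weights true  false t _ = solve (t ∷ [])
    weights false true  t _ = solve (t ∷ [])
    weights false false t _ = solve (t ∷ [])
    apart : ∀ k → (p u == k) ∧ (p v == k) ≡ false
    apart k with p u ≟ᶠ k | p v ≟ᶠ k
    ... | yes refl | yes pv≡pu = ⊥-elim (partite u v uv (sym pv≡pu))
    ... | yes _ | no _ = refl
    ... | no _  | _    = refl
    split : slack u v ≡ sum t + ((- t (p u)) + (- t (p v)))
    split = trans (sum-cong-≗ {ℓ} λ k → weights (p u == k) (p v == k) (t k) (apart k))
      (trans (∑-distrib-+ {ℓ} t _) (cong₂ _+_ (refl {x = sum t})
        (trans (∑-distrib-+ {ℓ} _ _) (cong₂ _+_ (sum-== (p u) (-_ ∘ t)) (sum-== (p v) (-_ ∘ t))))))
    total : sum t + D u + D v ≡ + ℓ * M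
    total = trans (cong₂ _+_ (cong₂ _+_ (refl {x = sum t}) (D-sum u)) (D-sum v))
      (trans (cong₂ _+_ (sym (∑-distrib-+ {ℓ} t _)) (refl {x = sum (λ k → d k v)}))
        (trans (sym (∑-distrib-+ {ℓ} _ _))
          (trans (sum-cong-≗ {ℓ} λ k → cancel M (d k u) (d k v)) (sum-const ℓ M))))
      where
      cancel : ∀ M a b → (M - a - b) + a + b ≡ M
      cancel M a b = solve (M ∷ a ∷ b ∷ [])
    arith : ∀ L M σ τ Du Dv a b x y → x ≡ 0ℤ → y ≡ 0ℤ →
      σ ≡ τ + ((- (M - x - a)) + (- (M - b - y))) → τ + Du + Dv ≡ L * M →
      σ + Du + Dv ≡ (L - + 2) * M + a + b
    arith L M σ τ Du Dv a b x y refl refl refl eq =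
      trans (move M τ Du Dv a b) (trans (cong (λ s → s - + 2 * M + a + b) eq) (collect L M a b))
      where
      move : ∀ M τ Du Dv a b →
        τ + ((- (M - 0ℤ - a)) + (- (M - b - 0ℤ))) + Du + Dv ≡ (τ + Du + Dv) - + 2 * M + a + b
      move M τ Du Dv a b = solve (M ∷ τ ∷ Du ∷ Dv ∷ a ∷ b ∷ [])
      collect : ∀ L M a b → L * M - + 2 * M + a + b ≡ (L - + 2) * M + a + b
      collect L M a b = solve (L ∷ M ∷ a ∷ b ∷ [])

  Q : Fin N → ℤ
  Q v = sum (λ k → d k v * d k v)

  -- A degree a ≤ M/2 satisfies 2a² ≤ M a. Beyond M/2 the surplus s pays, with 2a² ≤ M s + M a, and
  -- by `sum-surplus` it costs at most M² over all parts.
  Q-bound : ∀ v → + 2 * Q v ≤ᶻ M * M + M * D v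
  Q-bound v = begin
    + 2 * Q v
      ≡⟨ *-distribˡ-sum {ℓ} (+ 2) _ ⟩
    sum (λ k → + 2 * (d k v * d k v))
      ≤⟨ sum-mono (λ k → term (d k v) (surplus v k) (d-≥0 k v) (μ-ι-≤M k (adj G v))
           (ℤₚ.i≤j⊔i (excess (adj G v) k) 0ℤ) (ℤₚ.i≤i⊔j (excess (adj G v) k) 0ℤ)) ⟩
    sum (λ k → M * surplus v k + M * d k v)
      ≡⟨ trans (∑-distrib-+ {ℓ} _ _) (cong₂ _+_ (sym (*-distribˡ-sum {ℓ} M _)) (sym (*-distribˡ-sum {ℓ} M _))) ⟩
    M * sum (surplus v) + M * sum (λ k → d k v)
      ≡⟨ cong (λ s → M * sum (surplus v) + M * s) (sym (D-sum v)) ⟩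
    M * sum (surplus v) + M * D v
      ≤⟨ ℤₚ.+-monoˡ-≤ (M * D v) (ℤₚ.*-monoˡ-≤-nonNeg M {{nonNegative 0≤M}} (sum-surplus v)) ⟩
    M * M + M * D v ∎
    where
    open ℤₚ.≤-Reasoning
    term : ∀ a s → 0ℤ ≤ᶻ a → a ≤ᶻ M → 0ℤ ≤ᶻ s → + 2 * a - M ≤ᶻ s → + 2 * (a * a) ≤ᶻ M * s + M * a
    term a s 0≤a a≤M 0≤s h = from-gap (0≤a ⊗ gap h ⊕ gap a≤M ⊗ 0≤s) (lemma a s M)
      where
      lemma : ∀ a s M → a * (s - (+ 2 * a - M)) + (M - a) * s ≡ M * s + M * a - + 2 * (a * a)
      lemma a s M = solve (a ∷ s ∷ M ∷ [])

  module _ (13≤ℓ : + 13 ≤ᶻ + ℓ) where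

    private
      E S T : ℤ
      E = ν all-parts D
      S = ν all-parts (λ v → D v * D v)
      T = ν all-parts Q

    -- This is `slack-identity` summed over ordered adjacent pairs. Each degree is counted once per
    -- neighbour, which gives `S`; grouping the neighbours `v` of `u` by their part turns the sum of
    -- `d (p v) u` into the sum of squares `Q u`, which gives `T`.
    weighted-slack : ν² all-parts all-parts (λ u v → e u v * slack u v) + S + S ≡
      E * ((+ ℓ - + 2) * M) + T + T
    weighted-slack = begin
      X + S + S
        ≡⟨ cong₂ (λ a b → X + a + b) (sym deg₁) (sym deg₂) ⟩
      X + ∬ (λ u v → e u v * D u) + ∬ (λ u v → e u v * D v)
        ≡⟨ trans (cong₂ _+_ (sym (ν²-+ all-parts all-parts _ _)) refl) (sym (ν²-+ all-parts all-parts _ _)) ⟩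
      ∬ (λ u v → e u v * slack u v + e u v * D u + e u v * D v)
        ≡⟨ ν-cong all-parts (λ u _ → ν-cong all-parts λ v _ → pointwise u v) ⟩
      ∬ (λ u v → e u v * ((+ ℓ - + 2) * M) + e u v * d (p u) v + e u v * d (p v) u)
        ≡⟨ trans (ν²-+ all-parts all-parts _ _) (cong₂ _+_ (ν²-+ all-parts all-parts _ _) refl) ⟩
      ∬ (λ u v → e u v * ((+ ℓ - + 2) * M)) + ∬ (λ u v → e u v * d (p u) v) + ∬ (λ u v → e u v * d (p v) u)
        ≡⟨ cong₂ _+_ (cong₂ _+_ scalar sq₂) sq₁ ⟩
      E * ((+ ℓ - + 2) * M) + T + T ∎
      where
      open ≡-Reasoning
      ∬ : (Fin N → Fin N → ℤ) → ℤ
      ∬ = ν² all-parts all-parts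
      X : ℤ
      X = ∬ (λ u v → e u v * slack u v)
      flip : ∀ f → ∬ (λ u v → e u v * f v u) ≡ ∬ (λ u v → e u v * f u v)
      flip f = trans (ν-swap all-parts all-parts _)
        (ν-cong all-parts λ v _ → ν-cong all-parts λ u _ → cong (_* f v u) (e-sym u v))
      deg₁ : ∬ (λ u v → e u v * D u) ≡ S
      deg₁ = ν-cong all-parts λ u _ → ν-*ʳ all-parts (D u) (e u)
      deg₂ : ∬ (λ u v → e u v * D v) ≡ S
      deg₂ = trans (flip λ u v → D u) deg₁
      scalar : ∬ (λ u v → e u v * ((+ ℓ - + 2) * M)) ≡ E * ((+ ℓ - + 2) * M)
      scalar = trans (ν-cong all-parts λ u _ → ν-*ʳ all-parts ((+ ℓ - + 2) * M) (e u)) (ν-*ʳ all-parts ((+ ℓ - + 2) * M) D)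
      sq₁ : ∬ (λ u v → e u v * d (p v) u) ≡ T
      sq₁ = ν-cong all-parts λ u _ → trans (ν-parts all-parts _) (sum-cong-≗ {ℓ} λ k →
        trans (ℤₚ.*-identityˡ (μ k (λ v → e u v * d (p v) u)))
          (trans (μ-cong k λ v pv → cong (λ k → e u v * d k u) pv) (ν-*ʳ (k ==_) (d k u) (e u))))
      sq₂ : ∬ (λ u v → e u v * d (p u) v) ≡ T
      sq₂ = trans (flip λ u v → d (p v) u) sq₁
      pointwise : ∀ u v → e u v * slack u v + e u v * D u + e u v * D v ≡
        e u v * ((+ ℓ - + 2) * M) + e u v * d (p u) v + e u v * d (p v) u
      pointwise u v with adj G u v in uv
      ... | true  = trans (one (slack u v) (D u) (D v))
                      (trans (slack-identity u v uv) (sym (one ((+ ℓ - + 2) * M) (d (p u) v) (d (p v) u))))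
        where
        one : ∀ a b c → 1ℤ * a + 1ℤ * b + 1ℤ * c ≡ a + b + c
        one a b c = solve (a ∷ b ∷ c ∷ [])
      ... | false = refl

    -- The hypothesis says nothing about a pair of equal parts; there the indicator of `p x == p y`
    -- replaces the edges, at a total cost of M · ℓM. Each edge is counted in both directions in
    -- `E`.
    edge-mass : (+ ℓ * M) * (+ ℓ * M) ≤ᶻ + 2 * E + M * (+ ℓ * M)
    edge-mass = subst₂ _≤ᶻ_ total split (ν²-parts-mono all-parts all-parts λ k l _ _ → pair k l)
      where
      total : ν² all-parts all-parts (λ _ _ → 1ℤ) ≡ (+ ℓ * M) * (+ ℓ * M)
      total = trans (ν-cong all-parts λ _ _ → trans (ν-const-all 1ℤ) (ℤₚ.*-identityˡ (+ ℓ * M))) (ν-const-all (+ ℓ * M))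
      split : ν² all-parts all-parts (λ x y → + 2 * e x y + ι (p x == p y)) ≡ + 2 * E + M * (+ ℓ * M)
      split = trans (ν²-+ all-parts all-parts _ _) (cong₂ _+_ (ν²-* all-parts all-parts (+ 2) e)
        (trans (ν-cong all-parts λ x _ → trans (ν-parts all-parts _) (trans (sum-cong-≗ {ℓ} λ k →
            trans (ℤₚ.*-identityˡ (μ k (λ y → ι (p x == p y))))
              (trans (μ-cong k λ y py → cong (λ k → ι (p x == k)) py) (μ-const k (ι (p x == k)))))
            (sum-== (p x) (λ _ → M)))) (ν-const-all M)))
      pair : ∀ k l → ν² (k ==_) (l ==_) (λ _ _ → 1ℤ) ≤ᶻ ν² (k ==_) (l ==_) (λ x y → + 2 * e x y + ι (p x == p y))
      pair k l with k ≟ᶠ l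
      ... | yes refl = μ-mono k λ x px → μ-mono k λ y py → from-gap (nat 2 ⊗ e-≥0 x y)
              (trans (lemma (e x y)) (cong (λ b → + 2 * e x y + ι b - 1ℤ)
                (sym (trans (cong₂ _==_ px py) (==-refl k)))))
        where
        lemma : ∀ a → + 2 * a ≡ + 2 * a + 1ℤ - 1ℤ
        lemma a = solve (a ∷ [])
      ... | no k≢l = ℤₚ.≤-trans (ℤₚ.≤-reflexive (trans
              (μ-cong k λ _ _ → trans (μ-const l 1ℤ) (ℤₚ.*-identityˡ M)) (μ-const k M)))
              (ℤₚ.≤-trans (dense k l k≢l) (ℤₚ.≤-trans
                (ℤₚ.≤-reflexive (sym (ν²-* (k ==_) (l ==_) (+ 2) e)))
                (μ-mono k λ x _ → μ-mono l λ y _ → from-gap (ι-≥0 (p x == p y)) (lemma (e x y) (ι (p x == p y))))))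
        where
        lemma : ∀ a b → b ≡ + 2 * a + b - + 2 * a
        lemma a b = solve (a ∷ b ∷ [])

    tight-edge : ∃[ u ] ∃[ v ] (adj G u v ≡ true × + 6 * slack u v ≤ᶻ M)
    tight-edge with any? (λ u → any? λ v → (adj G u v ≟ᵇ true) ×-dec (+ 6 * slack u v ≤ᶻ? M))
    ... | yes found = found
    ... | no none = ⊥-elim (arith (+ ℓ) M E X S T 13≤ℓ 1≤M
            weighted-slack loose mean-square squares edge-mass)
      where
      X : ℤ
      X = ν² all-parts all-parts (λ u v → e u v * slack u v)
      loose : (1ℤ + M) * E ≤ᶻ + 6 * X
      loose = subst₂ _≤ᶻ_ (ν²-* all-parts all-parts (1ℤ + M) e) (ν²-* all-parts all-parts (+ 6) _)
        (ν²-mono all-parts all-parts λ u v _ _ → pointwise u v)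
        where
        pointwise : ∀ u v → (1ℤ + M) * e u v ≤ᶻ + 6 * (e u v * slack u v)
        pointwise u v with adj G u v in uv
        ... | true  = from-gap (gap (≰⇒1+≤ λ h → none (u , v , uv , h))) (lemma M (slack u v))
          where
          lemma : ∀ M s → + 6 * s - (1ℤ + M) ≡ + 6 * (1ℤ * s) - (1ℤ + M) * 1ℤ
          lemma M s = solve (M ∷ s ∷ [])
        ... | false = ℤₚ.≤-reflexive (lemma M (slack u v))
          where
          lemma : ∀ M s → (1ℤ + M) * 0ℤ ≡ + 6 * (0ℤ * s)
          lemma M s = solve (M ∷ s ∷ [])
      squares : + 2 * T ≤ᶻ (M * M) * (+ ℓ * M) + M * E
      squares = subst₂ _≤ᶻ_ (ν-* all-parts (+ 2) Q)
        (trans (ν-+ all-parts _ _) (cong₂ _+_ (ν-const-all (M * M)) (ν-* all-parts M D)))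
        (ν-mono all-parts λ v _ → Q-bound v)
      -- Half of `c` is the degree of a vertex that sees half of every other part. The sum of
      -- squares is bounded from below by the tangent at this value.
      c : ℤ
      c = (+ ℓ - 1ℤ) * M
      mean-square : (+ 4 * c) * E ≤ᶻ + 4 * S + (c * c) * (+ ℓ * M)
      mean-square = subst₂ _≤ᶻ_ (ν-* all-parts (+ 4 * c) D)
        (trans (ν-+ all-parts _ _) (cong₂ _+_ (ν-* all-parts (+ 4) _) (ν-const-all (c * c))))
        (ν-mono all-parts λ v _ → pointwise (D v) c)
        where
        square-≥0 : ∀ i → 0ℤ ≤ᶻ i * i
        square-≥0 (+ n) = nat n ⊗ nat n
        square-≥0 -[1+ n ] = +≤+ z≤n
        pointwise : ∀ a c → (+ 4 * c) * a ≤ᶻ + 4 * (a * a) + c * c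
        pointwise a c = from-gap (square-≥0 (+ 2 * a - c)) (solve (a ∷ c ∷ []))
      arith : ∀ L M E X S T → + 13 ≤ᶻ L → 1ℤ ≤ᶻ M →
        X + S + S ≡ E * ((L - + 2) * M) + T + T →
        (1ℤ + M) * E ≤ᶻ + 6 * X →
        (+ 4 * ((L - 1ℤ) * M)) * E ≤ᶻ + 4 * S + (((L - 1ℤ) * M) * ((L - 1ℤ) * M)) * (L * M) →
        + 2 * T ≤ᶻ (M * M) * (L * M) + M * E →
        (L * M) * (L * M) ≤ᶻ + 2 * E + M * (L * M) → ⊥
      arith L M E X S T 13≤L 1≤M h₁ h₂ h₃ h₄ h₅ = negative-gap
        (nat 2 ⊗ gap h₂ ⊕ nat 12 ⊗ gap (ℤₚ.≤-reflexive h₁) ⊕ nat 6 ⊗ gap h₃ ⊕ nat 12 ⊗ gap h₄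
          ⊕ nat 6 ⊗ (gap 13≤L ⊕ nat 12) ⊗ M≥0 ⊗ gap h₅
          -- The cubic terms leave L (L - 13) M³, which is where 13 enters. Strictness comes from
          -- the 1 in `1ℤ + M`: it leaves (L - 1) L M², which is at least 1.
          ⊕ M≥0 ⊗ gap h₅ ⊕ gap 13≤L ⊗ (gap 13≤L ⊕ nat 13) ⊗ M≥0 ⊗ M≥0 ⊗ M≥0
          ⊕ gap h₅ ⊕ gap (1≤-* (1≤-* 1≤L-1 1≤L) (1≤-* 1≤M 1≤M)))
        (solve (L ∷ M ∷ E ∷ X ∷ S ∷ T ∷ []))
        where
        M≥0 : 0ℤ ≤ᶻ M
        M≥0 = ℤₚ.≤-trans (nat 1) 1≤M
        1≤L : 1ℤ ≤ᶻ L
        1≤L = ℤₚ.≤-trans (from-yes (1ℤ ≤ᶻ? + 13)) 13≤L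
        1≤L-1 : 1ℤ ≤ᶻ L - 1ℤ
        1≤L-1 = from-gap (gap 13≤L ⊕ nat 11) (lemma L)
          where
          lemma : ∀ L → (L - + 13) + + 11 ≡ (L - 1ℤ) - 1ℤ
          lemma L = solve (L ∷ [])

  -- The two neighbourhoods of a tight edge.

  module FromEdge (13≤ℓ : + 13 ≤ᶻ + ℓ) (u₀ v₀ : Fin N) (u₀v₀ : adj G u₀ v₀ ≡ true)
    (tight : + 6 * slack u₀ v₀ ≤ᶻ M) where

    A B R : Fin N → Bool
    A = adj G u₀
    B = adj G v₀
    R y = not (A y) ∧ not (B y)

    A-B-disjoint : ∀ y → A y ∧ B y ≡ false
    A-B-disjoint y with A y in uy | B y in vy
    ... | true  | true  = ⊥-elim (triangle-free u₀ v₀ y u₀v₀ vy uy)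
    ... | true  | false = refl
    ... | false | _     = refl

    light : Fin N → Fin ℓ → Bool
    light v k = does (excess (adj G v) k ≤ᶻ? 0ℤ)

    mid : Fin ℓ → Bool
    mid k = away u₀ v₀ k ∧ (light u₀ k ∧ light v₀ k)

    light-bound : ∀ v k → light v k ≡ true → + 2 * d k v ≤ᶻ M
    light-bound v k lk with excess (adj G v) k ≤ᶻ? 0ℤ
    ... | yes h = ℤₚ.i-j≤0⇒i≤j h

    mid-A : ∀ k → mid k ≡ true → + 2 * μ k (ι ∘ A) ≤ᶻ M
    mid-A k mk = light-bound u₀ k (proj₁ (∧-true {light u₀ k} (proj₂ (∧-true {away u₀ v₀ k} mk))))

    mid-B : ∀ k → mid k ≡ true → + 2 * μ k (ι ∘ B) ≤ᶻ M
    mid-B k mk = light-bound v₀ k (proj₂ (∧-true {light u₀ k} (proj₂ (∧-true {away u₀ v₀ k} mk))))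

    A+B+R : ∀ k → μ k (ι ∘ A) + μ k (ι ∘ B) + μ k (ι ∘ R) ≡ M
    A+B+R k = trans (trans (cong₂ _+_ (sym (ν-+ (k ==_) _ _)) refl) (sym (ν-+ (k ==_) _ _)))
      (trans (μ-cong k λ y _ → partition (A y) (B y) (A-B-disjoint y)) (trans (μ-const k 1ℤ) (ℤₚ.*-identityˡ M)))
      where
      partition : ∀ a b → a ∧ b ≡ false → ι a + ι b + ι (not a ∧ not b) ≡ 1ℤ
      partition true  false _ = refl
      partition false true  _ = refl
      partition false false _ = refl

    heavy-count : ∀ v → sum (λ k → ι (not (light v k))) ≤ᶻ + 2
    heavy-count v = sum-two-positive _ (+ 2) (nat 2)
      (λ k → ℤₚ.≤-trans (ι-≤1 _) (from-yes (1ℤ ≤ᶻ? + 2)))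
      (λ j k _ _ _ → ℤₚ.+-mono-≤ (ι-≤1 (not (light v j))) (ι-≤1 (not (light v k))))
      (λ i j k i≢j i≢k j≢k hi hj hk → no-three-majorities (adj G v) (neighbours-independent v) i j k i≢j i≢k j≢k
        (heavy i hi) (heavy j hj) (heavy k hk))
      where
      heavy : ∀ k → 1ℤ ≤ᶻ ι (not (light v k)) → 1ℤ ≤ᶻ excess (adj G v) k
      heavy k h with excess (adj G v) k ≤ᶻ? 0ℤ
      ... | no x≰0 = ≰⇒1+≤ x≰0
      heavy k (+≤+ ()) | yes _

    mid-count : + 7 ≤ᶻ count mid
    mid-count = arith (+ ℓ) (count mid) (sum (λ k → ι (not (light u₀ k)))) (sum (λ k → ι (not (light v₀ k))))
      13≤ℓ (heavy-count u₀) (heavy-count v₀)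
      (subst₂ _≤ᶻ_ (trans (sum-const ℓ 1ℤ) (ℤₚ.*-identityʳ (+ ℓ))) split
        (sum-mono λ k → cover (p u₀ == k) (p v₀ == k) (light u₀ k) (light v₀ k)))
      where
      cover : ∀ a b c d → 1ℤ ≤ᶻ
        ι ((not a ∧ not b) ∧ (c ∧ d)) + (ι a * 1ℤ + (ι b * 1ℤ + (ι (not c) + ι (not d))))
      cover = from-yes (∀? λ a → ∀? λ b → ∀? λ c → ∀? λ d → 1ℤ ≤ᶻ?
        ι ((not a ∧ not b) ∧ (c ∧ d)) + (ι a * 1ℤ + (ι b * 1ℤ + (ι (not c) + ι (not d)))))
      split : sum (λ k → ι (mid k) + (ι (p u₀ == k) * 1ℤ + (ι (p v₀ == k) * 1ℤ
                + (ι (not (light u₀ k)) + ι (not (light v₀ k)))))) ≡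
        count mid + (1ℤ + (1ℤ + (sum (λ k → ι (not (light u₀ k))) + sum (λ k → ι (not (light v₀ k))))))
      split = trans (∑-distrib-+ {ℓ} (ι ∘ mid) _) (cong₂ _+_ (refl {x = count mid})
        (trans (∑-distrib-+ {ℓ} _ _) (cong₂ _+_ (sum-== (p u₀) (λ _ → 1ℤ))
          (trans (∑-distrib-+ {ℓ} _ _) (cong₂ _+_ (sum-== (p v₀) (λ _ → 1ℤ))
            (∑-distrib-+ {ℓ} (λ k → ι (not (light u₀ k))) (λ k → ι (not (light v₀ k)))))))))
      arith : ∀ L n h h′ → + 13 ≤ᶻ L → h ≤ᶻ + 2 → h′ ≤ᶻ + 2 → L ≤ᶻ n + (1ℤ + (1ℤ + (h + h′))) → + 7 ≤ᶻ n
      arith L n h h′ p q q′ r = from-gap (gap p ⊕ gap q ⊕ gap q′ ⊕ gap r) (solve (L ∷ n ∷ h ∷ h′ ∷ []))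

    ρ : ℤ
    ρ = ν mid (ι ∘ R)

    0≤ρ : 0ℤ ≤ᶻ ρ
    0≤ρ = ν-≥0 mid λ y _ → ι-≥0 (R y)

    -- Since `A` and `B` are disjoint, the integrand of `slack` at a part is the mass of `R` there,
    -- so `ρ` is a partial sum of `slack u₀ v₀` with nonnegative terms left out.
    6ρ≤M : + 6 * ρ ≤ᶻ M
    6ρ≤M = ℤₚ.≤-trans (ℤₚ.*-monoˡ-≤-nonNeg (+ 6) ρ≤slack) tight
      where
      term : ∀ k → ι (mid k) * μ k (ι ∘ R) ≤ᶻ ι (away u₀ v₀ k) * (M - d k u₀ - d k v₀)
      term k = sub (away u₀ v₀ k) (light u₀ k ∧ light v₀ k) (d k u₀) (d k v₀) (μ k (ι ∘ R)) M
        (A+B+R k) (ν-≥0 (k ==_) λ y _ → ι-≥0 (R y))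
        where
        sub : ∀ x y a b r M → a + b + r ≡ M → 0ℤ ≤ᶻ r → ι (x ∧ y) * r ≤ᶻ ι x * (M - a - b)
        sub true  true  a b r _ refl 0≤r = ℤₚ.≤-reflexive (lemma a b r)
          where
          lemma : ∀ a b r → 1ℤ * r ≡ 1ℤ * (a + b + r - a - b)
          lemma a b r = solve (a ∷ b ∷ r ∷ [])
        sub true  false a b r _ refl 0≤r = from-gap 0≤r (lemma a b r)
          where
          lemma : ∀ a b r → r ≡ 1ℤ * (a + b + r - a - b) - 0ℤ * r
          lemma a b r = solve (a ∷ b ∷ r ∷ [])
        sub false y     a b r _ refl 0≤r = ℤₚ.≤-refl
      ρ≤slack : ρ ≤ᶻ slack u₀ v₀
      ρ≤slack = subst (_≤ᶻ slack u₀ v₀) (sym (ν-parts mid (ι ∘ R))) (sum-mono term)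

    -- Nonedges between the two neighbourhoods.

    gapAB : Fin N → Fin N → ℤ
    gapAB x y = ι (not (p x == p y) ∧ ((A x ∧ B y) ∧ not (adj G x y)))

    m₀ : ℤ
    m₀ = ν² mid mid gapAB

    same-part-nonadjacent : ∀ x y → (p x == p y) ∧ adj G x y ≡ false
    same-part-nonadjacent x y with p x == p y in eq
    ... | true  = e-same-part x y (==⇒≡ eq)
    ... | false = refl

    -- `A` and `B` are independent, so an edge that avoids `R` joins them, and it is not a gap.
    edge-cover : ∀ x y → e x y + (gapAB x y + gapAB y x) ≤ᶻ
      (ι (A x) * ι (B y) + ι (B x) * ι (A y)) + (ι (R x) * e x y + ι (R y) * e x y)
    edge-cover x y rewrite ==-sym (p y) (p x) | adj-sym G y x =
      check (p x == p y) (adj G x y) (A x) (B x) (A y) (B y) (same-part-nonadjacent x y)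
        (A-B-disjoint x) (A-B-disjoint y)
        (conflict (neighbours-independent u₀ x y)) (conflict (neighbours-independent v₀ x y))
      where
      check : ∀ s a x x′ y y′ → s ∧ a ≡ false → x ∧ x′ ≡ false → y ∧ y′ ≡ false →
        x ∧ y ∧ a ≡ false → x′ ∧ y′ ∧ a ≡ false →
        ι a + (ι (not s ∧ ((x ∧ y′) ∧ not a)) + ι (not s ∧ ((y ∧ x′) ∧ not a))) ≤ᶻ
        (ι x * ι y′ + ι x′ * ι y) + (ι (not x ∧ not x′) * ι a + ι (not y ∧ not y′) * ι a)
      check = from-yes (∀? λ s → ∀? λ a → ∀? λ x → ∀? λ x′ → ∀? λ y → ∀? λ y′ →
        (s ∧ a ≟ᵇ false) →-dec (x ∧ x′ ≟ᵇ false) →-dec (y ∧ y′ ≟ᵇ false) →-dec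
        (x ∧ y ∧ a ≟ᵇ false) →-dec (x′ ∧ y′ ∧ a ≟ᵇ false) →-dec
        (ι a + (ι (not s ∧ ((x ∧ y′) ∧ not a)) + ι (not s ∧ ((y ∧ x′) ∧ not a))) ≤ᶻ?
        (ι x * ι y′ + ι x′ * ι y) + (ι (not x ∧ not x′) * ι a + ι (not y ∧ not y′) * ι a)))

    -- On V_k × V_l with k ≢ l this is 4 m + 2 M (r_k + r_l) ≤ 4 r_k r_l + 4 e(R), where r_k is
    -- the mass of R in V_k; the terms with p x == p y make it hold for k ≡ l too.
    gap-lhs gap-rhs : Fin N → Fin N → ℤ
    gap-lhs x y = + 4 * (gapAB x y + gapAB y x) + + 2 * (ι (R x) * 1ℤ + 1ℤ * ι (R y))
    gap-rhs x y = + 4 * (ι (R x) * ι (R y))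
      + (+ 2 * (ι (R x) * ι (p x == p y) + ι (p x == p y) * ι (R y)) + + 4 * (ι (R x) * e x y + ι (R y) * e x y))

    gap-pair : ∀ k l → mid k ≡ true → mid l ≡ true →
      ν² (k ==_) (l ==_) gap-lhs ≤ᶻ ν² (k ==_) (l ==_) gap-rhs
    gap-pair k l mk ml with k ≟ᶠ l
    ... | yes refl = μ-mono k λ x px → μ-mono k λ y py → diagonal x y (trans px (sym py))
      where
      diagonal : ∀ x y → p x ≡ p y → gap-lhs x y ≤ᶻ gap-rhs x y
      diagonal x y px≡py rewrite ==-sym (p y) (p x) | trans (cong (p x ==_) (sym px≡py)) (==-refl (p x)) =
        check (R x) (R y) (adj G x y)
        where
        check : ∀ r r′ a → + 4 * (0ℤ + 0ℤ) + + 2 * (ι r * 1ℤ + 1ℤ * ι r′) ≤ᶻ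
          + 4 * (ι r * ι r′) + (+ 2 * (ι r * 1ℤ + 1ℤ * ι r′) + + 4 * (ι r * ι a + ι r′ * ι a))
        check = from-yes (∀? λ r → ∀? λ r′ → ∀? λ a →
          + 4 * (0ℤ + 0ℤ) + + 2 * (ι r * 1ℤ + 1ℤ * ι r′) ≤ᶻ?
          + 4 * (ι r * ι r′) + (+ 2 * (ι r * 1ℤ + 1ℤ * ι r′) + + 4 * (ι r * ι a + ι r′ * ι a)))
    ... | no k≢l = subst₂ _≤ᶻ_ (sym lhs) (sym rhs)
        (arith M (μ k (ι ∘ A)) (μ k (ι ∘ B)) (μ k (ι ∘ R)) (μ l (ι ∘ A)) (μ l (ι ∘ B)) (μ l (ι ∘ R))
          (∬ e) m Re (A+B+R k) (A+B+R l) (mid-A k mk) (mid-B k mk) (mid-A l ml) (mid-B l ml)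
          (dense k l k≢l) cover)
      where
      ∬ : (Fin N → Fin N → ℤ) → ℤ
      ∬ = ν² (k ==_) (l ==_)
      m Re : ℤ
      m  = ∬ (λ x y → gapAB x y + gapAB y x)
      Re = ∬ (λ x y → ι (R x) * e x y + ι (R y) * e x y)
      one : ∀ k → μ k (λ _ → 1ℤ) ≡ M
      one k = trans (μ-const k 1ℤ) (ℤₚ.*-identityˡ M)
      lhs : ∬ gap-lhs ≡ + 4 * m + + 2 * (μ k (ι ∘ R) * M + M * μ l (ι ∘ R))
      lhs = trans (ν²-+ (k ==_) (l ==_) _ _) (cong₂ _+_ (ν²-* (k ==_) (l ==_) (+ 4) _)
        (trans (ν²-* (k ==_) (l ==_) (+ 2) _) (cong (+ 2 *_) (trans (ν²-+ (k ==_) (l ==_) _ _) (cong₂ _+_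
          (trans (ν²-product (k ==_) (l ==_) (ι ∘ R) (λ _ → 1ℤ)) (cong (μ k (ι ∘ R) *_) (one l)))
          (trans (ν²-product (k ==_) (l ==_) (λ _ → 1ℤ) (ι ∘ R)) (cong (_* μ l (ι ∘ R)) (one k))))))))
      off : ∬ (λ x y → ι (R x) * ι (p x == p y) + ι (p x == p y) * ι (R y)) ≡ 0ℤ
      off = trans (μ-cong k λ x px → trans (μ-cong l λ y py → vanish x y px py)
              (trans (μ-const l 0ℤ) (ℤₚ.*-zeroˡ M))) (trans (μ-const k 0ℤ) (ℤₚ.*-zeroˡ M))
        where
        vanish : ∀ x y → p x ≡ k → p y ≡ l → ι (R x) * ι (p x == p y) + ι (p x == p y) * ι (R y) ≡ 0ℤ
        vanish x y refl refl rewrite ==-≢ k≢l = zero-sum (ι (R x)) (ι (R y))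
          where
          zero-sum : ∀ a b → a * 0ℤ + 0ℤ * b ≡ 0ℤ
          zero-sum a b = solve (a ∷ b ∷ [])
      rhs : ∬ gap-rhs ≡ + 4 * (μ k (ι ∘ R) * μ l (ι ∘ R)) + (+ 2 * 0ℤ + + 4 * Re)
      rhs = trans (ν²-+ (k ==_) (l ==_) _ _) (cong₂ _+_
        (trans (ν²-* (k ==_) (l ==_) (+ 4) _) (cong (+ 4 *_) (ν²-product (k ==_) (l ==_) (ι ∘ R) (ι ∘ R))))
        (trans (ν²-+ (k ==_) (l ==_) _ _) (cong₂ _+_
          (trans (ν²-* (k ==_) (l ==_) (+ 2) _) (cong (+ 2 *_) off)) (ν²-* (k ==_) (l ==_) (+ 4) _))))
      cover : ∬ e + m ≤ᶻ
        (μ k (ι ∘ A) * μ l (ι ∘ B) + μ k (ι ∘ B) * μ l (ι ∘ A)) + Re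
      cover = subst₂ _≤ᶻ_ (ν²-+ (k ==_) (l ==_) _ _)
        (trans (ν²-+ (k ==_) (l ==_) _ _) (cong₂ _+_ (trans (ν²-+ (k ==_) (l ==_) _ _) (cong₂ _+_
          (ν²-product (k ==_) (l ==_) (ι ∘ A) (ι ∘ B)) (ν²-product (k ==_) (l ==_) (ι ∘ B) (ι ∘ A)))) refl))
        (ν²-mono (k ==_) (l ==_) λ x y _ _ → edge-cover x y)
      arith : ∀ M a b r a′ b′ r′ E m Re → a + b + r ≡ M → a′ + b′ + r′ ≡ M →
        + 2 * a ≤ᶻ M → + 2 * b ≤ᶻ M → + 2 * a′ ≤ᶻ M → + 2 * b′ ≤ᶻ M → M * M ≤ᶻ + 2 * E →
        E + m ≤ᶻ (a * b′ + b * a′) + Re →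
        + 4 * m + + 2 * (r * M + M * r′) ≤ᶻ + 4 * (r * r′) + (+ 2 * 0ℤ + + 4 * Re)
      arith M a b r a′ b′ r′ E m Re refl eq ha hb ha′ hb′ hE h =
        subst (λ s → + 4 * m + + 2 * (r * M + M * s) ≤ᶻ + 4 * (r * s) + (+ 2 * 0ℤ + + 4 * Re))
          (trans (cong (λ s → s - a′ - b′) (sym eq)) (isolate a′ b′ r′))
          -- The products a b′ + b a′ are controlled by (M - 2a)(M - 2a′) + (M - 2b)(M - 2b′) ≥ 0,
          -- available because neither `A` nor `B` has a majority in a part of `mid`.
          (from-gap (nat 2 ⊗ gap hE ⊕ nat 4 ⊗ gap h ⊕ gap ha ⊗ gap ha′ ⊕ gap hb ⊗ gap hb′)
            (solve (a ∷ b ∷ r ∷ a′ ∷ b′ ∷ E ∷ m ∷ Re ∷ [])))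
        where
        isolate : ∀ a b r → a + b + r - a - b ≡ r
        isolate a b r = solve (a ∷ b ∷ r ∷ [])

    -- Summing `gap-pair`, the terms linear in the masses of `R` grow with the number of parts. By
    -- `degree-bound` the edges at `R` grow no faster, so these cancel; what remains is ρ² and the
    -- contribution ρM of equal parts.
    gap-bound : + 2 * m₀ ≤ᶻ ρ * ρ + ρ * M
    gap-bound = arith M (count mid * M) ρ m₀ RE
      (subst₂ _≤ᶻ_ lhs rhs (ν²-parts-mono mid mid gap-pair)) (subst₂ _≤ᶻ_ (ν-* mid (+ 2) _) (ν-*ʳ mid (count mid * M) (ι ∘ R))
        (ν-mono mid λ x mx → degree (ι (R x)) (ν mid (e x)) (count mid * M) (ι-≥0 (R x)) (degree-bound mid x mx)))
      where
      ∬ : (Fin N → Fin N → ℤ) → ℤ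
      ∬ = ν² mid mid
      RE : ℤ
      RE = ν mid (λ x → ι (R x) * ν mid (e x))
      degree : ∀ r D c → 0ℤ ≤ᶻ r → + 2 * D ≤ᶻ c → + 2 * (r * D) ≤ᶻ r * c
      degree r D c 0≤r h = from-gap (0≤r ⊗ gap h) (solve (r ∷ D ∷ c ∷ []))
      one : ν mid (λ _ → 1ℤ) ≡ count mid * M
      one = trans (ν-const mid 1ℤ) (ℤₚ.*-identityˡ (count mid * M))
      lhs : ∬ gap-lhs ≡ + 4 * (m₀ + m₀) + + 2 * (ρ * (count mid * M) + (count mid * M) * ρ)
      lhs = trans (ν²-+ mid mid _ _) (cong₂ _+_
        (trans (ν²-* mid mid (+ 4) _) (cong (+ 4 *_) (trans (ν²-+ mid mid gapAB (λ x y → gapAB y x))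
          (cong₂ _+_ (refl {x = m₀}) (sym (ν-swap mid mid gapAB))))))
        (trans (ν²-* mid mid (+ 2) _) (cong (+ 2 *_) (trans (ν²-+ mid mid _ _) (cong₂ _+_
          (trans (ν²-product mid mid (ι ∘ R) (λ _ → 1ℤ)) (cong (ρ *_) one))
          (trans (ν²-product mid mid (λ _ → 1ℤ) (ι ∘ R)) (cong (_* ρ) one)))))))
      restrict : ∀ x → mid (p x) ≡ true → ν mid (λ y → ι (p x == p y)) ≡ M
      restrict x mx = trans (ν-cong mid λ y _ → sym (ℤₚ.*-identityʳ (ι (p x == p y))))
        (trans (ν-restrict mid (p x) (λ _ → 1ℤ)) (trans (cong (λ b → ι b * μ (p x) (λ _ → 1ℤ)) mx)
          (trans (ℤₚ.*-identityˡ (μ (p x) (λ _ → 1ℤ))) (trans (μ-const (p x) 1ℤ) (ℤₚ.*-identityˡ M)))))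
      diag₁ : ∬ (λ x y → ι (R x) * ι (p x == p y)) ≡ ρ * M
      diag₁ = trans (ν-cong mid λ x mx → trans (ν-* mid (ι (R x)) _) (cong (ι (R x) *_) (restrict x mx)))
        (ν-*ʳ mid M (ι ∘ R))
      diag₂ : ∬ (λ x y → ι (p x == p y) * ι (R y)) ≡ ρ * M
      diag₂ = trans (ν-swap mid mid _) (trans (ν-cong mid λ y _ → ν-cong mid λ x _ →
        trans (ℤₚ.*-comm (ι (p x == p y)) (ι (R y))) (cong (λ b → ι (R y) * ι b) (==-sym (p x) (p y)))) diag₁)
      edges₂ : ∬ (λ x y → ι (R y) * e x y) ≡ RE
      edges₂ = trans (ν-swap mid mid _) (ν-cong mid λ y _ → trans (ν-* mid (ι (R y)) _)
        (cong (ι (R y) *_) (ν-cong mid λ x _ → e-sym x y)))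
      rhs : ∬ gap-rhs ≡ + 4 * (ρ * ρ) + (+ 2 * (ρ * M + ρ * M) + + 4 * (RE + RE))
      rhs = trans (ν²-+ mid mid _ _) (cong₂ _+_
        (trans (ν²-* mid mid (+ 4) _) (cong (+ 4 *_) (ν²-product mid mid (ι ∘ R) (ι ∘ R))))
        (trans (ν²-+ mid mid _ _) (cong₂ _+_
          (trans (ν²-* mid mid (+ 2) _) (cong (+ 2 *_) (trans (ν²-+ mid mid _ _) (cong₂ _+_ diag₁ diag₂))))
          (trans (ν²-* mid mid (+ 4) _) (cong (+ 4 *_) (trans (ν²-+ mid mid _ _) (cong₂ _+_
            (ν-cong mid λ x _ → ν-* mid (ι (R x)) (e x)) edges₂)))))))
      arith : ∀ M c ρ m RE →
        + 4 * (m + m) + + 2 * (ρ * c + c * ρ) ≤ᶻ + 4 * (ρ * ρ) + (+ 2 * (ρ * M + ρ * M) + + 4 * (RE + RE)) →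
        + 2 * RE ≤ᶻ ρ * c → + 2 * m ≤ᶻ ρ * ρ + ρ * M
      arith M c ρ m RE h h′ = cancel-pos (+ 4) (from-yes (1ℤ ≤ᶻ? + 4))
        (from-gap (gap h ⊕ nat 4 ⊗ gap h′) (solve (M ∷ c ∷ ρ ∷ m ∷ RE ∷ [])))

    -- The colouring.

    α β : Fin N → ℤ
    α t = ν mid (λ x → e t x * ι (A x))
    β t = ν mid (λ x → e t x * ι (B x))

    -- A neighbour of `t` in `A` and one in `B` are not adjacent, so they form a gap or share a
    -- part; in the part of the former, `B` has mass at most M/2.
    α-β-product : ∀ t → + 2 * (α t * β t) ≤ᶻ + 2 * m₀ + α t * M
    α-β-product t = arith (α t * β t) m₀ (α t * M) _
      (subst₂ _≤ᶻ_ (ν²-product mid mid _ _) (ν²-+ mid mid _ _)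
        (ν²-mono mid mid λ x y _ _ → pointwise x y))
      (subst₂ _≤ᶻ_ (ν-* mid (+ 2) _) (ν-*ʳ mid M _) (ν-mono mid λ x mx →
        ℤₚ.≤-trans (ℤₚ.≤-reflexive (cong (+ 2 *_) (ν-* mid (e t x * ι (A x)) _)))
          (scale (e t x * ι (A x)) _ (e-≥0 t x ⊗ ι-≥0 (A x)) (own x mx))))
      where
      own : ∀ x → mid (p x) ≡ true → + 2 * ν mid (λ y → ι (p x == p y) * ι (B y)) ≤ᶻ M
      own x mx = subst (λ s → + 2 * s ≤ᶻ M) (sym (trans (ν-restrict mid (p x) (ι ∘ B))
        (trans (cong (λ b → ι b * μ (p x) (ι ∘ B)) mx) (ℤₚ.*-identityˡ (μ (p x) (ι ∘ B)))))) (mid-B (p x) mx)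
      scale : ∀ a s → 0ℤ ≤ᶻ a → + 2 * s ≤ᶻ M → + 2 * (a * s) ≤ᶻ a * M
      scale a s 0≤a h = from-gap (0≤a ⊗ gap h) (lemma a s M)
        where
        lemma : ∀ a s M → a * (M - + 2 * s) ≡ a * M - + 2 * (a * s)
        lemma a s M = solve (a ∷ s ∷ M ∷ [])
      check : ∀ s a b c x y → b ∧ a ∧ c ≡ false →
        (ι b * ι x) * (ι c * ι y) ≤ᶻ ι (not s ∧ ((x ∧ y) ∧ not a)) + (ι b * ι x) * (ι s * ι y)
      check = from-yes (∀? λ s → ∀? λ a → ∀? λ b → ∀? λ c → ∀? λ x → ∀? λ y → (b ∧ a ∧ c ≟ᵇ false) →-dec
        ((ι b * ι x) * (ι c * ι y) ≤ᶻ? ι (not s ∧ ((x ∧ y) ∧ not a)) + (ι b * ι x) * (ι s * ι y)))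
      pointwise : ∀ x y → (e t x * ι (A x)) * (e t y * ι (B y)) ≤ᶻ
        gapAB x y + (e t x * ι (A x)) * (ι (p x == p y) * ι (B y))
      pointwise x y = check (p x == p y) (adj G x y) (adj G t x) (adj G t y) (A x) (B y)
        (conflict (triangle-free t x y))
      arith : ∀ q m a s → q ≤ᶻ m + s → + 2 * s ≤ᶻ a → + 2 * q ≤ᶻ + 2 * m + a
      arith q m a s h h′ = from-gap (nat 2 ⊗ gap h ⊕ gap h′) (solve (q ∷ m ∷ a ∷ s ∷ []))

    -- Two such degrees would give 2αβ - αM ≥ (2M/3)(M/3) = 8M²/36, while 2m₀ ≤ ρ² + ρM ≤ 7M²/36.
    -- The thresholds 2/3 and 1/6 are compatible by this margin.
    one-sided : ∀ t → + 2 * M ≤ᶻ + 3 * α t → + 2 * M ≤ᶻ + 3 * β t → ⊥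
    one-sided t = arith M (α t) (β t) m₀ ρ 1≤M 0≤ρ 6ρ≤M gap-bound (α-β-product t)
      where
      arith : ∀ M a b m ρ → 1ℤ ≤ᶻ M → 0ℤ ≤ᶻ ρ → + 6 * ρ ≤ᶻ M → + 2 * m ≤ᶻ ρ * ρ + ρ * M →
        + 2 * (a * b) ≤ᶻ + 2 * m + a * M → + 2 * M ≤ᶻ + 3 * a → + 2 * M ≤ᶻ + 3 * b → ⊥
      arith M a b m ρ 1≤M 0≤ρ hρ hm hab ha hb = negative-gap
        (nat 36 ⊗ gap hab ⊕ nat 36 ⊗ gap hm ⊕ nat 6 ⊗ 0≤ρ ⊗ gap hρ ⊕ nat 7 ⊗ gap hρ ⊗ M≥0
          ⊕ nat 8 ⊗ gap ha ⊗ gap hb ⊕ nat 4 ⊗ gap ha ⊗ M≥0 ⊕ nat 16 ⊗ gap hb ⊗ M≥0 ⊕ gap (1≤-* 1≤M 1≤M))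
        (solve (M ∷ a ∷ b ∷ m ∷ ρ ∷ []))
        where
        M≥0 : 0ℤ ≤ᶻ M
        M≥0 = ℤₚ.≤-trans (nat 1) 1≤M

    opaque
      -- The strict form of the threshold is what later keeps `θ true` below `+ 5 * M`.
      prefers-A : Fin N → Bool
      prefers-A t = does (1ℤ + + 3 * α t ≤ᶻ? + 2 * M)

      prefers-A-true : ∀ t → prefers-A t ≡ true → 1ℤ + + 3 * α t ≤ᶻ + 2 * M
      prefers-A-true t eq with 1ℤ + + 3 * α t ≤ᶻ? + 2 * M
      ... | yes h = h

      prefers-A-false : ∀ t → prefers-A t ≡ false → 1ℤ + + 3 * β t ≤ᶻ + 2 * M
      prefers-A-false t eq with 1ℤ + + 3 * α t ≤ᶻ? + 2 * M
      ... | no α≰ with + 2 * M ≤ᶻ? + 3 * β t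
      ... | yes β≥ = ⊥-elim (one-sided t (ℤₚ.≮⇒≥ (α≰ ∘ <⇒1+≤)) β≥)
      ... | no  β≱ = ≰⇒1+≤ β≱

    colour : Fin N → Bool
    colour y = A y ∨ (not (B y) ∧ prefers-A y)

    -- Bad edges and nonedges on parts with excess of one sign.

    module SameSign (J : Fin ℓ → Bool) (J⊆mid : ∀ k → J k ≡ true → mid k ≡ true) (4≤J : + 4 ≤ᶻ count J)
      (same-sign : ∀ k l → J k ≡ true → J l ≡ true → 0ℤ ≤ᶻ excess colour k * excess colour l) where

      ∬ : (Fin N → Fin N → ℤ) → ℤ
      ∬ = ν² J J

      F : Fin N → ℤ
      F x = ν J (bad colour x)

      F-≥0 : ∀ x → 0ℤ ≤ᶻ F x
      F-≥0 x = ν-≥0 J λ y _ → ι-≥0 _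

      -- As z in R is left out, a nonedge between R and A ∪ B is charged to its end in R only,
      -- where the weak bound θ true on F suffices.
      far : Fin N → Fin N → ℤ
      far x z = ι ((not (p x == p z) ∧ not (R z)) ∧ ((colour x xor colour z) ∧ not (adj G x z)))

      far-≥0 : ∀ x z → 0ℤ ≤ᶻ far x z
      far-≥0 x z = ι-≥0 _

      H : Fin N → ℤ
      H x = ν J (far x)

      -- Six times the bound on `F`. Outside `R`, bad edges lead into `R` only, hence have mass at
      -- most ρ ≤ M/6. In `R` they lead into `R` or into the preferred side, where the mass of
      -- neighbours is less than 2M/3.
      θ : Bool → ℤ
      θ true  = + 5 * M - 1ℤ
      θ false = M

      ν-J≤mid : ∀ {f} → (∀ v → 0ℤ ≤ᶻ f v) → ν J f ≤ᶻ ν mid f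
      ν-J≤mid = ν-⊆ J mid J⊆mid

      unsettled-arith : ∀ s f ρ M → f ≤ᶻ s + ρ → 1ℤ + + 3 * s ≤ᶻ + 2 * M → + 6 * ρ ≤ᶻ M → + 6 * f ≤ᶻ + 5 * M - 1ℤ
      unsettled-arith s f ρ M h h′ hρ = from-gap (nat 6 ⊗ gap h ⊕ nat 2 ⊗ gap h′ ⊕ gap hρ ⊕ nat 1)
        (solve (s ∷ f ∷ ρ ∷ M ∷ []))

      settled-arith : ∀ f ρ M → f ≤ᶻ ρ → + 6 * ρ ≤ᶻ M → + 6 * f ≤ᶻ M
      settled-arith f ρ M h hρ = from-gap (nat 6 ⊗ gap h ⊕ gap hρ) (solve (f ∷ ρ ∷ M ∷ []))

      R-mass : ν J (ι ∘ R) ≤ᶻ ρ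
      R-mass = ν-J≤mid λ y → ι-≥0 (R y)

      F-settled : ∀ x → R x ≡ false → F x ≤ᶻ ρ
      F-settled x Rx = ℤₚ.≤-trans (ν-mono J λ y _ →
        settled-bad (adj G x y) (A x) (B x) (A y) (B y) (prefers-A x) (prefers-A y) Rx
          (A-B-disjoint x) (A-B-disjoint y)
          (conflict (neighbours-independent u₀ x y)) (conflict (neighbours-independent v₀ x y))) R-mass

      F-unsettled : ∀ x (S : Fin N → Bool) → (∀ y → bad colour x y ≤ᶻ e x y * ι (S y) + ι (R y)) →
        F x ≤ᶻ ν mid (λ y → e x y * ι (S y)) + ρ
      F-unsettled x S h = ℤₚ.≤-trans (ν-mono J λ y _ → h y) (ℤₚ.≤-trans (ℤₚ.≤-reflexive (ν-+ J _ _))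
        (ℤₚ.+-mono-≤ (ν-J≤mid λ y → e-≥0 x y ⊗ ι-≥0 (S y)) R-mass))

      F-unsettled-A : ∀ x → R x ≡ true → prefers-A x ≡ true → + 6 * F x ≤ᶻ + 5 * M - 1ℤ
      F-unsettled-A x Rx px = unsettled-arith (α x) (F x) ρ M
        (F-unsettled x A λ y → unsettled-bad-A (adj G x y) (A x) (B x) (A y) (B y) (prefers-A x) (prefers-A y)
          Rx (A-B-disjoint y) px)
        (prefers-A-true x px) 6ρ≤M

      F-unsettled-B : ∀ x → R x ≡ true → prefers-A x ≡ false → + 6 * F x ≤ᶻ + 5 * M - 1ℤ
      F-unsettled-B x Rx px = unsettled-arith (β x) (F x) ρ M
        (F-unsettled x B λ y → unsettled-bad-B (adj G x y) (A x) (B x) (A y) (B y) (prefers-A x) (prefers-A y)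
          Rx (A-B-disjoint y) px)
        (prefers-A-false x px) 6ρ≤M

      F-bound : ∀ x → + 6 * F x ≤ᶻ θ (R x)
      F-bound x = by-value (λ r → + 6 * F x ≤ᶻ θ r) (R x)
        (λ Rx → settled-arith (F x) ρ M (F-settled x Rx) 6ρ≤M)
        (λ Rx → by-value (λ _ → + 6 * F x ≤ᶻ + 5 * M - 1ℤ) (prefers-A x) (F-unsettled-B x Rx) (F-unsettled-A x Rx))

      side-mass : ∀ S → (∀ k → mid k ≡ true → M ≤ᶻ + 2 * μ k (ι ∘ S) + + 2 * μ k (ι ∘ R)) →
        + 4 * M ≤ᶻ + 2 * ν J (ι ∘ S) + + 2 * ρ
      side-mass S h = ℤₚ.≤-trans (subst (+ 4 * M ≤ᶻ_) (sym one) (four (count J) M 4≤J 0≤M))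
        (ℤₚ.≤-trans (ν-parts-mono J λ k jk →
            subst₂ _≤ᶻ_ (sym (trans (μ-const k 1ℤ) (ℤₚ.*-identityˡ M)))
              (sym (trans (ν-+ (k ==_) _ _) (cong₂ _+_ (ν-* (k ==_) (+ 2) (ι ∘ S)) (ν-* (k ==_) (+ 2) (ι ∘ R)))))
              (h k (J⊆mid k jk)))
          (ℤₚ.≤-trans (ℤₚ.≤-reflexive (trans (ν-+ J _ _) (cong₂ _+_ (ν-* J (+ 2) (ι ∘ S)) (ν-* J (+ 2) (ι ∘ R)))))
            (ℤₚ.+-monoʳ-≤ (+ 2 * ν J (ι ∘ S)) (ℤₚ.*-monoˡ-≤-nonNeg (+ 2) (ν-J≤mid λ y → ι-≥0 (R y))))))
        where
        one : ν J (λ _ → 1ℤ) ≡ count J * M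
        one = trans (ν-const J 1ℤ) (ℤₚ.*-identityˡ (count J * M))
        four : ∀ c M → + 4 ≤ᶻ c → 0ℤ ≤ᶻ M → + 4 * M ≤ᶻ c * M
        four c M h 0≤M = from-gap (gap h ⊗ 0≤M) (solve (c ∷ M ∷ []))

      -- The vertices of a side S outside the parts of x and y have mass at least M - ρ.
      charge : ∀ (S : Fin N → Bool) x y → J (p x) ≡ true → J (p y) ≡ true →
        (∀ k → mid k ≡ true → + 2 * μ k (ι ∘ S) ≤ᶻ M) →
        (∀ k → mid k ≡ true → M ≤ᶻ + 2 * μ k (ι ∘ S) + + 2 * μ k (ι ∘ R)) →
        (∀ z → ι (S z) ≤ᶻ (ι (p x == p z) * ι (S z) + ι (p y == p z) * ι (S z)) + (far x z + far y z)) →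
        + 5 * M ≤ᶻ + 6 * (H x + H y)
      charge S x y jx jy small large h = arith M ρ (ν J (ι ∘ S)) (μ (p x) (ι ∘ S)) (μ (p y) (ι ∘ S)) (H x + H y)
        6ρ≤M (side-mass S large) (small (p x) (J⊆mid (p x) jx)) (small (p y) (J⊆mid (p y) jy))
        (subst (ν J (ι ∘ S) ≤ᶻ_)
          (trans (ν-+ J _ _) (cong₂ _+_
            (trans (ν-+ J _ _) (cong₂ _+_ (own x jx) (own y jy))) (ν-+ J (far x) (far y))))
          (ν-mono J λ z _ → h z))
        where
        own : ∀ x → J (p x) ≡ true → ν J (λ z → ι (p x == p z) * ι (S z)) ≡ μ (p x) (ι ∘ S)
        own x jx = trans (ν-restrict J (p x) (ι ∘ S))
          (trans (cong (λ b → ι b * μ (p x) (ι ∘ S)) jx) (ℤₚ.*-identityˡ (μ (p x) (ι ∘ S))))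
        arith : ∀ M ρ s a b h → + 6 * ρ ≤ᶻ M → + 4 * M ≤ᶻ + 2 * s + + 2 * ρ → + 2 * a ≤ᶻ M → + 2 * b ≤ᶻ M →
          s ≤ᶻ (a + b) + h → + 5 * M ≤ᶻ + 6 * h
        arith M ρ s a b h h₁ h₂ h₃ h₄ h₅ = from-gap
          (gap h₁ ⊕ nat 3 ⊗ gap h₂ ⊕ nat 3 ⊗ gap h₃ ⊕ nat 3 ⊗ gap h₄ ⊕ nat 6 ⊗ gap h₅)
          (solve (M ∷ ρ ∷ s ∷ a ∷ b ∷ h ∷ []))

      large-A : ∀ k → mid k ≡ true → M ≤ᶻ + 2 * μ k (ι ∘ A) + + 2 * μ k (ι ∘ R)
      large-A k mk = arith (μ k (ι ∘ A)) (μ k (ι ∘ B)) (μ k (ι ∘ R)) M (A+B+R k) (mid-B k mk)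
        where
        arith : ∀ a b r M → a + b + r ≡ M → + 2 * b ≤ᶻ M → M ≤ᶻ + 2 * a + + 2 * r
        arith a b r _ refl h = from-gap (gap h) (solve (a ∷ b ∷ r ∷ []))

      large-B : ∀ k → mid k ≡ true → M ≤ᶻ + 2 * μ k (ι ∘ B) + + 2 * μ k (ι ∘ R)
      large-B k mk = arith (μ k (ι ∘ A)) (μ k (ι ∘ B)) (μ k (ι ∘ R)) M (A+B+R k) (mid-A k mk)
        where
        arith : ∀ a b r M → a + b + r ≡ M → + 2 * a ≤ᶻ M → M ≤ᶻ + 2 * b + + 2 * r
        arith a b r _ refl h = from-gap (gap h) (solve (a ∷ b ∷ r ∷ []))

      -- The ends of a bad edge share a colour, so the nonedges are sought towards the side of the
      -- other colour: `B` for `true`, `A` for `false`.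
      bad-charge : ∀ x y → J (p x) ≡ true → J (p y) ≡ true →
        + 5 * M * bad colour x y ≤ᶻ + 6 * (bad colour x y * H x + bad colour x y * H y)
      bad-charge x y jx jy = by-cases (adj G x y) refl (colour x) refl (colour y) refl
        where
        zeros : ∀ m a b → m * 0ℤ ≡ + 6 * (0ℤ * a + 0ℤ * b)
        zeros m a b = solve (m ∷ a ∷ b ∷ [])
        ones : ∀ a b → + 6 * (a + b) ≡ + 6 * (1ℤ * a + 1ℤ * b)
        ones a b = solve (a ∷ b ∷ [])
        no-common : adj G x y ≡ true → ∀ z → adj G y z ∧ adj G x z ≡ false
        no-common xy z with adj G y z in yz | adj G x z in xz
        ... | true  | true  = ⊥-elim (triangle-free x y z xy yz xz)
        ... | true  | false = refl
        ... | false | _     = refl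
        by-cases : ∀ a → adj G x y ≡ a → ∀ c → colour x ≡ c → ∀ c′ → colour y ≡ c′ →
          + 5 * M * ι (a ∧ not (c xor c′)) ≤ᶻ + 6 * (ι (a ∧ not (c xor c′)) * H x + ι (a ∧ not (c xor c′)) * H y)
        by-cases false _ _ _ _ _ = ℤₚ.≤-reflexive (zeros (+ 5 * M) (H x) (H y))
        by-cases true _ true _ false _ = ℤₚ.≤-reflexive (zeros (+ 5 * M) (H x) (H y))
        by-cases true _ false _ true _ = ℤₚ.≤-reflexive (zeros (+ 5 * M) (H x) (H y))
        by-cases true xy true cx true cy = subst₂ _≤ᶻ_ (sym (ℤₚ.*-identityʳ (+ 5 * M))) (ones (H x) (H y))
          (charge B x y jx jy mid-B large-B λ z → opposite-B (colour x) (colour y) (p x == p z) (p y == p z)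
            (adj G x z) (adj G y z) (A z) (B z) (prefers-A z) cx cy (no-common xy z) (A-B-disjoint z))
        by-cases true xy false cx false cy = subst₂ _≤ᶻ_ (sym (ℤₚ.*-identityʳ (+ 5 * M))) (ones (H x) (H y))
          (charge A x y jx jy mid-A large-A λ z → opposite-A (colour x) (colour y) (p x == p z) (p y == p z)
            (adj G x z) (adj G y z) (A z) (B z) (prefers-A z) cx cy (no-common xy z))

      bad-sym : ∀ x y → bad colour x y ≡ bad colour y x
      bad-sym x y = cong₂ (λ a b → ι (a ∧ not b)) (adj-sym G x y) (xor-comm (colour x) (colour y))

      -- With exactly one end in `R`, only that end is charged, with weight 5M - 1. With no end in
      -- `R`, both are, with 2M ≤ 5M - 1 in total. With two ends in `R`, `far` vanishes in both
      -- directions.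
      miss-weights : ∀ s r r′ c c′ a → 1ℤ ≤ᶻ M →
        θ r * ι ((not s ∧ not r′) ∧ ((c xor c′) ∧ not a)) + θ r′ * ι ((not s ∧ not r) ∧ ((c xor c′) ∧ not a)) ≤ᶻ
        (+ 5 * M - 1ℤ) * ι (not s ∧ (not a ∧ (c xor c′)))
      miss-weights s r r′ c c′ a 1≤M = ℤₚ.≤-trans (core s r r′ ((c xor c′) ∧ not a))
        (ℤₚ.≤-reflexive (cong (λ b → (+ 5 * M - 1ℤ) * ι (not s ∧ b)) (∧-comm (c xor c′) (not a))))
        where
        θ≥ : ∀ r → 0ℤ ≤ᶻ θ r
        θ≥ true  = five M 1≤M
          where
          five : ∀ M → 1ℤ ≤ᶻ M → 0ℤ ≤ᶻ + 5 * M - 1ℤ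
          five M h = from-gap (nat 5 ⊗ gap h ⊕ nat 4) (solve (M ∷ []))
        θ≥ false = 0≤M
        left : ∀ a b → a * 1ℤ + b * 0ℤ ≡ a * 1ℤ
        left a b = solve (a ∷ b ∷ [])
        zero-both : ∀ a b c → a * 0ℤ + b * 0ℤ ≡ c * 0ℤ
        zero-both a b c = solve (a ∷ b ∷ c ∷ [])
        right : ∀ a b → b * 0ℤ + a * 1ℤ ≡ a * 1ℤ
        right a b = solve (a ∷ b ∷ [])
        both : ∀ M → 1ℤ ≤ᶻ M → M * 1ℤ + M * 1ℤ ≤ᶻ (+ 5 * M - 1ℤ) * 1ℤ
        both M h = from-gap (nat 3 ⊗ gap h ⊕ nat 2) (solve (M ∷ []))
        none : ∀ a c → 0ℤ ≤ᶻ c → a * 0ℤ + a * 0ℤ ≤ᶻ c * 1ℤ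
        none a c h = from-gap h (solve (a ∷ c ∷ []))
        core : ∀ s r r′ b → θ r * ι ((not s ∧ not r′) ∧ b) + θ r′ * ι ((not s ∧ not r) ∧ b) ≤ᶻ
          (+ 5 * M - 1ℤ) * ι (not s ∧ b)
        core true  r r′ b = ℤₚ.≤-reflexive (zero-both (θ r) (θ r′) (+ 5 * M - 1ℤ))
        core false true  true  true  = none (+ 5 * M - 1ℤ) (+ 5 * M - 1ℤ) (θ≥ true)
        core false true  false true  = ℤₚ.≤-reflexive (left (+ 5 * M - 1ℤ) M)
        core false false true  true  = ℤₚ.≤-reflexive (right (+ 5 * M - 1ℤ) M)
        core false false false true  = both M 1≤M
        core false true  true  false = ℤₚ.≤-reflexive (zero-both (+ 5 * M - 1ℤ) (+ 5 * M - 1ℤ) (+ 5 * M - 1ℤ))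
        core false true  false false = ℤₚ.≤-reflexive (zero-both (+ 5 * M - 1ℤ) M (+ 5 * M - 1ℤ))
        core false false true  false = ℤₚ.≤-reflexive (zero-both M (+ 5 * M - 1ℤ) (+ 5 * M - 1ℤ))
        core false false false false = ℤₚ.≤-reflexive (zero-both M M (+ 5 * M - 1ℤ))

      miss≤bad : ∬ (miss colour) ≤ᶻ ∬ (bad colour)
      miss≤bad = ν²-parts-mono J J pair
        where
        pair : ∀ k l → J k ≡ true → J l ≡ true →
          ν² (k ==_) (l ==_) (miss colour) ≤ᶻ ν² (k ==_) (l ==_) (bad colour)
        pair k l jk jl with k ≟ᶠ l
        ... | yes refl = μ-mono k λ x px → μ-mono k λ y py →
                subst (λ b → ι (not b ∧ (not (adj G x y) ∧ (colour x xor colour y))) ≤ᶻ bad colour x y)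
                  (sym (trans (cong₂ _==_ px py) (==-refl k))) (ι-≥0 (adj G x y ∧ not (colour x xor colour y)))
        ... | no k≢l = cancel-pos (+ 2) (from-yes (1ℤ ≤ᶻ? + 2))
                (arith (ν² (k ==_) (l ==_) (miss colour)) _ (ν² (k ==_) (l ==_) (bad colour)) (same-sign k l jk jl) (cut-density colour k l k≢l))
          where
          arith : ∀ m q b → 0ℤ ≤ᶻ q → + 2 * m + q ≤ᶻ + 2 * b → + 2 * m ≤ᶻ + 2 * b
          arith m q b h h′ = from-gap (h ⊕ gap h′) (solve (m ∷ q ∷ b ∷ []))

      -- Summed over both ends of every bad edge, `bad-charge` produces each `H x` as often as `F x`
      -- says. The chain is 5M bad ≤ 12 FH ≤ (5M - 1) miss ≤ (5M - 1) bad.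
      bad-≤0 : ∬ (bad colour) ≤ᶻ 0ℤ
      bad-≤0 = arith M (∬ (bad colour)) (∬ (miss colour)) FH 1≤M charged weighed miss≤bad
        where
        FH : ℤ
        FH = ν J (λ x → F x * H x)
        charged : + 5 * M * ∬ (bad colour) ≤ᶻ + 6 * (FH + FH)
        charged = subst₂ _≤ᶻ_ (ν²-* J J (+ 5 * M) (bad colour))
          (trans (ν²-* J J (+ 6) _) (cong (+ 6 *_) (trans (ν²-+ J J _ _) (cong₂ _+_ first second))))
          (ν²-mono J J bad-charge)
          where
          first : ∬ (λ x y → bad colour x y * H x) ≡ FH
          first = ν-cong J λ x _ → ν-*ʳ J (H x) (bad colour x)
          second : ∬ (λ x y → bad colour x y * H y) ≡ FH
          second = trans (ν-swap J J _) (trans (ν-cong J λ y _ → ν-cong J λ x _ →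
            cong (_* H y) (bad-sym x y)) first)
        Θ : ℤ
        Θ = ν J (λ x → θ (R x) * H x)
        6FH≤Θ : + 6 * FH ≤ᶻ Θ
        6FH≤Θ = subst (_≤ᶻ Θ) (ν-* J (+ 6) _) (ν-mono J λ x _ →
          scale (F x) (H x) (θ (R x)) (ν-≥0 J λ z _ → far-≥0 x z) (F-bound x))
          where
          scale : ∀ f h t → 0ℤ ≤ᶻ h → + 6 * f ≤ᶻ t → + 6 * (f * h) ≤ᶻ t * h
          scale f h t h≥0 le = from-gap (gap le ⊗ h≥0) (solve (f ∷ h ∷ t ∷ []))
        2Θ≤ : Θ + Θ ≤ᶻ (+ 5 * M - 1ℤ) * ∬ (miss colour)
        2Θ≤ = subst₂ _≤ᶻ_ (trans (ν²-+ J J _ _) (cong₂ _+_ first second)) (ν²-* J J (+ 5 * M - 1ℤ) (miss colour))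
          (ν²-mono J J λ x z _ _ → pointwise x z)
          where
          first : ∬ (λ x z → θ (R x) * far x z) ≡ Θ
          first = ν-cong J λ x _ → ν-* J (θ (R x)) (far x)
          second : ∬ (λ x z → θ (R z) * far z x) ≡ Θ
          second = trans (ν-swap J J _) first
          pointwise : ∀ x z → θ (R x) * far x z + θ (R z) * far z x ≤ᶻ (+ 5 * M - 1ℤ) * miss colour x z
          pointwise x z = subst (λ f → θ (R x) * far x z + θ (R z) * f ≤ᶻ (+ 5 * M - 1ℤ) * miss colour x z)
            (flip (p x == p z) (p z == p x) (colour x) (colour z) (adj G x z) (adj G z x) (==-sym (p x) (p z)) (adj-sym G x z))
            (miss-weights (p x == p z) (R x) (R z) (colour x) (colour z) (adj G x z) 1≤M)
            where
            flip : ∀ s s′ c c′ a a′ → s ≡ s′ → a ≡ a′ →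
              ι ((not s ∧ not (R x)) ∧ ((c xor c′) ∧ not a)) ≡ ι ((not s′ ∧ not (R x)) ∧ ((c′ xor c) ∧ not a′))
            flip s _ c c′ a _ refl refl = cong (λ b → ι ((not s ∧ not (R x)) ∧ (b ∧ not a))) (xor-comm c c′)
        weighed : + 12 * FH ≤ᶻ (+ 5 * M - 1ℤ) * ∬ (miss colour)
        weighed = twice FH Θ _ 6FH≤Θ 2Θ≤
          where
          twice : ∀ f t m → + 6 * f ≤ᶻ t → t + t ≤ᶻ m → + 12 * f ≤ᶻ m
          twice f t m h h′ = from-gap (nat 2 ⊗ gap h ⊕ gap h′) (solve (f ∷ t ∷ m ∷ []))
        arith : ∀ M b m f → 1ℤ ≤ᶻ M → + 5 * M * b ≤ᶻ + 6 * (f + f) →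
          + 12 * f ≤ᶻ (+ 5 * M - 1ℤ) * m → m ≤ᶻ b → b ≤ᶻ 0ℤ
        arith M b m f 1≤M h₁ h₂ h₃ = from-gap
          (gap h₁ ⊕ gap h₂ ⊕ (nat 5 ⊗ gap 1≤M ⊕ nat 4) ⊗ gap h₃)
          (solve (M ∷ b ∷ m ∷ f ∷ []))

      no-bad : ∀ x y → J (p x) ≡ true → J (p y) ≡ true → bad colour x y ≤ᶻ 0ℤ
      no-bad x y jx jy = ν-vanish J (λ y _ → ι-≥0 (adj G x y ∧ not (colour x xor colour y)))
        (ν-vanish J (λ x _ → F-≥0 x) bad-≤0 x jx) y jy

      no-miss : ∀ x y → J (p x) ≡ true → J (p y) ≡ true → miss colour x y ≤ᶻ 0ℤ
      no-miss x y jx jy = ν-vanish J {miss colour x} (λ y _ → ι-≥0 _)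
        (ν-vanish J {λ x → ν J (miss colour x)} (λ x _ → ν-≥0 J λ y _ → ι-≥0 _) (ℤₚ.≤-trans miss≤bad bad-≤0) x jx) y jy

      balanced-pair : ∀ k l → J k ≡ true → J l ≡ true → k ≢ l → excess colour k * excess colour l ≤ᶻ 0ℤ
      balanced-pair k l jk jl k≢l = arith (ν² (k ==_) (l ==_) (miss colour)) _ (ν² (k ==_) (l ==_) (bad colour))
        (ν²-≥0 (k ==_) (l ==_) λ x y → ι-≥0 _) no-bad-pair (cut-density colour k l k≢l)
        where
        no-bad-pair : ν² (k ==_) (l ==_) (bad colour) ≤ᶻ 0ℤ
        no-bad-pair = ℤₚ.≤-trans (μ-mono k {_} {λ _ → 0ℤ} λ x px → ℤₚ.≤-trans
            (μ-mono l {_} {λ _ → 0ℤ} λ y py → no-bad x y (trans (cong J px) jk) (trans (cong J py) jl))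
            (ℤₚ.≤-reflexive (trans (μ-const l 0ℤ) (ℤₚ.*-zeroˡ M))))
          (ℤₚ.≤-reflexive (trans (μ-const k 0ℤ) (ℤₚ.*-zeroˡ M)))
        arith : ∀ m q b → 0ℤ ≤ᶻ m → b ≤ᶻ 0ℤ → + 2 * m + q ≤ᶻ + 2 * b → q ≤ᶻ 0ℤ
        arith m q b h₁ h₂ h₃ = from-gap (nat 2 ⊗ h₁ ⊕ nat 2 ⊗ gap h₂ ⊕ gap h₃) (solve (m ∷ q ∷ b ∷ []))

  -- The balanced complete bipartite core.

  -- Three parts serve two purposes: one of them avoids the parts of any two given vertices, and a
  -- single part weighs less than half of the core.
  record Core : Set where
    field
      J : Fin ℓ → Bool
      c : Fin N → Bool
      3≤J : + 3 ≤ᶻ count J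
      balanced : ∀ k → J k ≡ true → excess c k ≡ 0ℤ
      no-bad : ∀ x y → J (p x) ≡ true → J (p y) ≡ true → bad c x y ≤ᶻ 0ℤ
      no-miss : ∀ x y → J (p x) ≡ true → J (p y) ≡ true → miss c x y ≤ᶻ 0ℤ

  does-≤ : ∀ {i j} → does (i ≤ᶻ? j) ≡ true → i ≤ᶻ j
  does-≤ {i} {j} eq with i ≤ᶻ? j
  ... | yes h = h

  does-≟ : ∀ {i j} → does (i ≟ᶻ j) ≡ true → i ≡ j
  does-≟ {i} {j} eq with i ≟ᶻ j
  ... | yes h = h

  module _ (13≤ℓ : + 13 ≤ᶻ + ℓ) (u₀ v₀ : Fin N) (u₀v₀ : adj G u₀ v₀ ≡ true)
    (tight : + 6 * slack u₀ v₀ ≤ᶻ M) where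

    open FromEdge 13≤ℓ u₀ v₀ u₀v₀ tight

    same-sign-core : ∀ J → (∀ k → J k ≡ true → mid k ≡ true) → + 4 ≤ᶻ count J →
      (∀ k l → J k ≡ true → J l ≡ true → 0ℤ ≤ᶻ excess colour k * excess colour l) → Core
    same-sign-core J J⊆mid 4≤J same-sign = record
      { J = J₀
      ; c = colour
      ; 3≤J = arith (count J) (count J₀) (sum (ι ∘ J₁)) 4≤J one-unbalanced
          (subst (count J ≤ᶻ_) (∑-distrib-+ {ℓ} (ι ∘ J₀) (ι ∘ J₁)) (sum-mono λ k → split (J k) (does (excess colour k ≟ᶻ 0ℤ))))
      ; balanced = λ k jk → does-≟ (proj₂ (∧-true {J k} jk))
      ; no-bad = λ x y jx jy → no-bad x y (J₀⊆J (p x) jx) (J₀⊆J (p y) jy)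
      ; no-miss = λ x y jx jy → no-miss x y (J₀⊆J (p x) jx) (J₀⊆J (p y) jy)
      }
      where
      open SameSign J J⊆mid 4≤J same-sign
      J₀ J₁ : Fin ℓ → Bool
      J₀ k = J k ∧ does (excess colour k ≟ᶻ 0ℤ)
      J₁ k = J k ∧ not (does (excess colour k ≟ᶻ 0ℤ))
      J₀⊆J : ∀ k → J₀ k ≡ true → J k ≡ true
      J₀⊆J k jk = proj₁ (∧-true {J k} jk)
      split : ∀ a b → ι a ≤ᶻ ι (a ∧ b) + ι (a ∧ not b)
      split = from-yes (∀? λ a → ∀? λ b → ι a ≤ᶻ? ι (a ∧ b) + ι (a ∧ not b))
      unbalanced : ∀ k → 1ℤ ≤ᶻ ι (J₁ k) → J k ≡ true × excess colour k ≢ 0ℤ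
      unbalanced k h = proj₁ parts , λ eq → case trans (sym (proj₂ parts)) (cong not (dec-true (excess colour k ≟ᶻ 0ℤ) eq)) of λ ()
        where
        parts : J k ≡ true × not (does (excess colour k ≟ᶻ 0ℤ)) ≡ true
        parts = ∧-true {J k} (ι-true h)
      -- Without bad edges, `cut-density` makes the product of two excesses nonpositive. As the
      -- signs agree, it is 0, so two parts cannot both be unbalanced.
      one-unbalanced : sum (ι ∘ J₁) ≤ᶻ 1ℤ
      one-unbalanced = sum-one-positive (ι ∘ J₁) 1ℤ (nat 1) (λ k → ι-≤1 (J₁ k)) λ k l k≢l hk hl →
        let jk , xk = unbalanced k hk ; jl , xl = unbalanced l hl in
        case ℤₚ.i*j≡0⇒i≡0∨j≡0 (excess colour k)
          (ℤₚ.≤-antisym (balanced-pair k l jk jl k≢l) (same-sign k l jk jl)) of λ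
          { (inj₁ eq) → xk eq ; (inj₂ eq) → xl eq }
      arith : ∀ n n₀ n₁ → + 4 ≤ᶻ n → n₁ ≤ᶻ 1ℤ → n ≤ᶻ n₀ + n₁ → + 3 ≤ᶻ n₀
      arith n n₀ n₁ h₁ h₂ h₃ = from-gap (gap h₁ ⊕ gap h₂ ⊕ gap h₃) (solve (n ∷ n₀ ∷ n₁ ∷ []))

    J₊ J₋ : Fin ℓ → Bool
    J₊ k = mid k ∧ does (0ℤ ≤ᶻ? excess colour k)
    J₋ k = mid k ∧ does (excess colour k ≤ᶻ? 0ℤ)

    edge-core : Core
    edge-core with + 4 ≤ᶻ? count J₊ | + 4 ≤ᶻ? count J₋
    ... | yes 4≤J₊ | _ = same-sign-core J₊ (λ k jk → proj₁ (∧-true {mid k} jk)) 4≤J₊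
          λ k l jk jl → does-≤ {0ℤ} {excess colour k} (proj₂ (∧-true {mid k} jk)) ⊗ does-≤ {0ℤ} {excess colour l} (proj₂ (∧-true {mid l} jl))
    ... | no _ | yes 4≤J₋ = same-sign-core J₋ (λ k jk → proj₁ (∧-true {mid k} jk)) 4≤J₋
          λ k l jk jl → negatives (excess colour k) (excess colour l)
            (does-≤ (proj₂ (∧-true {mid k} jk))) (does-≤ (proj₂ (∧-true {mid l} jl)))
          where
          negatives : ∀ a b → a ≤ᶻ 0ℤ → b ≤ᶻ 0ℤ → 0ℤ ≤ᶻ a * b
          negatives a b ha hb = from-gap (gap ha ⊗ gap hb) (solve (a ∷ b ∷ []))
    ... | no J₊<4 | no J₋<4 = ⊥-elim (arith (count mid) (count J₊) (count J₋) mid-count (≰⇒1+≤ J₊<4) (≰⇒1+≤ J₋<4)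
          (subst (count mid ≤ᶻ_) (∑-distrib-+ {ℓ} (ι ∘ J₊) (ι ∘ J₋)) (sum-mono λ k → cover (mid k) (excess colour k))))
          where
          cover : ∀ m x → ι m ≤ᶻ ι (m ∧ does (0ℤ ≤ᶻ? x)) + ι (m ∧ does (x ≤ᶻ? 0ℤ))
          cover false x = ℤₚ.≤-refl
          cover true x with 0ℤ ≤ᶻ? x | x ≤ᶻ? 0ℤ
          ... | yes _  | yes _  = from-yes (1ℤ ≤ᶻ? + 2)
          ... | yes _  | no _   = ℤₚ.≤-refl
          ... | no _   | yes _  = ℤₚ.≤-refl
          ... | no x≱0 | no x≰0 = ⊥-elim (x≱0 (ℤₚ.<⇒≤ (ℤₚ.≰⇒> x≰0)))
          arith : ∀ n a b → + 7 ≤ᶻ n → 1ℤ + a ≤ᶻ + 4 → 1ℤ + b ≤ᶻ + 4 → n ≤ᶻ a + b → ⊥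
          arith n a b h₁ h₂ h₃ h₄ = negative-gap (gap h₁ ⊕ gap h₂ ⊕ gap h₃ ⊕ gap h₄) (solve (n ∷ a ∷ b ∷ []))

  Bichromatic : (Fin N → Bool) → Set
  Bichromatic κ = ∀ x y → adj G x y ≡ true → κ x xor κ y ≡ true

  -- Extending the bipartition of the core to all vertices.

  module FromCore (core : Core) where
    open Core core

    core-edge : ∀ x y → J (p x) ≡ true → J (p y) ≡ true → adj G x y ≡ true → c x xor c y ≡ true
    core-edge x y jx jy xy = decide (c x xor c y) (subst (λ a → ι (a ∧ not (c x xor c y)) ≤ᶻ 0ℤ) xy (no-bad x y jx jy))
      where
      decide : ∀ b → ι (true ∧ not b) ≤ᶻ 0ℤ → b ≡ true
      decide true  _ = refl
      decide false (+≤+ ())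

    core-complete : ∀ x y → J (p x) ≡ true → J (p y) ≡ true → p x ≢ p y → c x xor c y ≡ true → adj G x y ≡ true
    core-complete x y jx jy px≢py cxy = decide (p x == p y) (adj G x y) (c x xor c y) (==-≢ px≢py) cxy (no-miss x y jx jy)
      where
      decide : ∀ s a b → s ≡ false → b ≡ true → ι (not s ∧ (not a ∧ b)) ≤ᶻ 0ℤ → a ≡ true
      decide _ true  _ _ _ _ = refl
      decide _ false _ refl refl (+≤+ ())

    -- The class opposite to `b`: what a vertex that is to receive the colour `b` should see of the
    -- core.
    side : Bool → Fin N → ℤ
    side b v = ι (c v xor b)

    side-part : ∀ b k → J k ≡ true → + 2 * μ k (side b) ≡ M
    side-part false k jk = trans (cong (+ 2 *_) (μ-cong k λ v _ → cong ι (xor-identityʳ (c v))))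
      (ℤₚ.i-j≡0⇒i≡j (+ 2 * μ k (ι ∘ c)) M (balanced k jk))
    side-part true k jk = trans (cong (+ 2 *_) (trans (μ-cong k λ v _ → cong ι (flip (c v))) (μ-not k c)))
      (arith M (μ k (ι ∘ c)) (balanced k jk))
      where
      flip : ∀ b → b xor true ≡ not b
      flip true  = refl
      flip false = refl
      arith : ∀ M a → + 2 * a - M ≡ 0ℤ → + 2 * (M - a) ≡ M
      arith M a eq = trans (lemma M a) (trans (cong (λ t → M - t) eq) (ℤₚ.+-identityʳ M))
        where
        lemma : ∀ M a → + 2 * (M - a) ≡ M - (+ 2 * a - M)
        lemma M a = solve (M ∷ a ∷ [])

    side-mass : ∀ b → + 2 * ν J (side b) ≡ count J * M
    side-mass b = trans (sym (ν-* J (+ 2) (side b))) (trans (ℤₚ.≤-antisym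
        (ν-parts-mono J λ k jk → ℤₚ.≤-reflexive (eq k jk)) (ν-parts-mono J λ k jk → ℤₚ.≤-reflexive (sym (eq k jk))))
      (trans (ν-const J 1ℤ) (ℤₚ.*-identityˡ (count J * M))))
      where
      eq : ∀ k → J k ≡ true → μ k (λ v → + 2 * side b v) ≡ μ k (λ _ → 1ℤ)
      eq k jk = trans (ν-* (k ==_) (+ 2) (side b)) (trans (side-part b k jk) (sym (trans (μ-const k 1ℤ) (ℤₚ.*-identityˡ M))))

    CoreNeighbour : Fin N → Bool → Fin N → Set
    CoreNeighbour z b v = adj G z v ≡ true × J (p v) ≡ true × c v ≡ b

    neighbour? : ∀ z b → Dec (∃[ v ] CoreNeighbour z b v)
    neighbour? z b = any? λ v → (adj G z v ≟ᵇ true) ×-dec (J (p v) ≟ᵇ true) ×-dec (c v ≟ᵇ b)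

    opposite-neighbours : ∀ z x y → CoreNeighbour z true x → CoreNeighbour z false y → p x ≡ p y
    opposite-neighbours z x y (zx , jx , cx) (zy , jy , cy) with p x ≟ᶠ p y
    ... | yes eq = eq
    ... | no px≢py = ⊥-elim (triangle-free z x y zx (core-complete x y jx jy px≢py (cong₂ _xor_ cx cy)) zy)

    -- Core neighbours of opposite colours in different parts would close a triangle. If both
    -- colours occur, all core neighbours therefore share one part, and their mass is at most M,
    -- against at least 3M/2 for half of the core. The spare `M` rules this case out in
    -- `neighbourhood`.
    one-part-or-one-side : ∀ z → + 2 * ν J (e z) + M ≤ᶻ count J * M ⊎
      (∃[ b ] ∀ v → J (p v) ≡ true → e z v ≤ᶻ side b v)
    one-part-or-one-side z with neighbour? z true | neighbour? z false
    ... | yes (x , nx) | yes (y , ny) = inj₁ (arith (ν J (e z)) M (count J) 0≤M 3≤J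
            (ℤₚ.≤-trans (ν-mono J {g = λ v → ι (p x == p v) * 1ℤ} λ v jv → inside v jv)
              (ℤₚ.≤-reflexive (trans (ν-restrict J (p x) (λ _ → 1ℤ)) (trans
                (cong₂ (λ b m → ι b * m) (proj₁ (proj₂ nx)) (trans (μ-const (p x) 1ℤ) (ℤₚ.*-identityˡ M)))
                (ℤₚ.*-identityˡ M))))))
      where
      px≡pv : ∀ v b → CoreNeighbour z b v → p x ≡ p v
      px≡pv v true  nv = trans (opposite-neighbours z x y nx ny) (sym (opposite-neighbours z v y nv ny))
      px≡pv v false nv = opposite-neighbours z x v nx nv
      inside : ∀ v → J (p v) ≡ true → e z v ≤ᶻ ι (p x == p v) * 1ℤ
      inside v jv with adj G z v in zv
      ... | false = ι-≥0 (p x == p v) ⊗ nat 1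
      ... | true  = ℤₚ.≤-reflexive (sym (cong (λ b → ι b * 1ℤ)
                      (trans (cong (p x ==_) (sym (px≡pv v (c v) (zv , jv , refl)))) (==-refl (p x)))))
      arith : ∀ d M n → 0ℤ ≤ᶻ M → + 3 ≤ᶻ n → d ≤ᶻ M → + 2 * d + M ≤ᶻ n * M
      arith d M n h₁ h₂ h₃ = from-gap (gap h₂ ⊗ h₁ ⊕ nat 2 ⊗ gap h₃) (solve (d ∷ M ∷ n ∷ []))
    ... | no none | _ = inj₂ (true , λ v jv → inside v jv)
      where
      inside : ∀ v → J (p v) ≡ true → e z v ≤ᶻ side true v
      inside v jv with adj G z v in zv | c v in cv
      ... | false | b     = ι-≥0 (b xor true)
      ... | true  | false = ℤₚ.≤-refl
      ... | true  | true  = ⊥-elim (none (v , zv , jv , cv))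
    ... | yes _ | no none = inj₂ (false , λ v jv → inside v jv)
      where
      inside : ∀ v → J (p v) ≡ true → e z v ≤ᶻ side false v
      inside v jv with adj G z v in zv | c v in cv
      ... | false | b     = ι-≥0 (b xor false)
      ... | true  | true  = ℤₚ.≤-refl
      ... | true  | false = ⊥-elim (none (v , zv , jv , cv))

    half-degree : ∀ z → + 2 * ν J (e z) ≤ᶻ count J * M
    half-degree z with one-part-or-one-side z
    ... | inj₁ h = from-gap (gap h ⊕ 0≤M) (lemma (+ 2 * ν J (e z)) M (count J * M))
      where
      lemma : ∀ d M n → n - (d + M) + M ≡ n - d
      lemma d M n = solve (d ∷ M ∷ n ∷ [])
    ... | inj₂ (b , h) = ℤₚ.≤-trans (ℤₚ.*-monoˡ-≤-nonNeg (+ 2) (ν-mono J h)) (ℤₚ.≤-reflexive (side-mass b))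

    -- Density makes the average degree into the core, taken over the part of `z`, at least half of
    -- the core. By `half-degree` no vertex exceeds this value, so none falls below it.
    full-degree : ∀ z → J (p z) ≡ false → count J * M ≤ᶻ + 2 * ν J (e z)
    -- The difference is written with the factor `- 1ℤ` so that `ν-+` and `ν-*` integrate it.
    full-degree z jz = deficit (ν-vanish (p z ==_) {λ x → count J * M + - 1ℤ * (+ 2 * ν J (e x))}
        (λ x _ → from-gap (gap (half-degree x)) (shape (count J * M) (+ 2 * ν J (e x))))
        total z (==-refl (p z)))
      where
      shape : ∀ a b → a - b ≡ a + - 1ℤ * b - 0ℤ
      shape a b = solve (a ∷ b ∷ [])
      deficit : ∀ {a b} → a + - 1ℤ * b ≤ᶻ 0ℤ → a ≤ᶻ b
      deficit {a} {b} h = from-gap (gap h) (lemma a b)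
        where
        lemma : ∀ a b → 0ℤ - (a + - 1ℤ * b) ≡ b - a
        lemma a b = solve (a ∷ b ∷ [])
      dense-core : (count J * M) * M ≤ᶻ + 2 * ν² (p z ==_) J e
      dense-core = subst₂ _≤ᶻ_ lhs rhs (ν-parts-mono J {λ _ → M} {λ y → + 2 * μ (p z) (λ x → e x y)} λ k jk →
        subst₂ _≤ᶻ_ (sym (μ-const k M))
          (sym (trans (ν-* (k ==_) (+ 2) _) (cong (+ 2 *_) (ν-swap (k ==_) (p z ==_) (λ y x → e x y)))))
          (dense (p z) k λ pz≡k → case trans (sym jz) (trans (cong J pz≡k) jk) of λ ()))
        where
        lhs : ν J (λ _ → M) ≡ (count J * M) * M
        lhs = trans (ν-const J M) (ℤₚ.*-comm M (count J * M))
        rhs : ν J (λ y → + 2 * μ (p z) (λ x → e x y)) ≡ + 2 * ν² (p z ==_) J e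
        rhs = trans (ν-* J (+ 2) _) (cong (+ 2 *_) (ν-swap J (p z ==_) (λ y x → e x y)))
      total : ν (p z ==_) (λ x → count J * M + - 1ℤ * (+ 2 * ν J (e x))) ≤ᶻ 0ℤ
      total = subst (_≤ᶻ 0ℤ) (sym (trans (ν-+ (p z ==_) _ _) (cong₂ _+_ (μ-const (p z) (count J * M))
          (trans (ν-* (p z ==_) (- 1ℤ) _) (cong (- 1ℤ *_) (ν-* (p z ==_) (+ 2) _))))))
        (arith ((count J * M) * M) (+ 2 * ν² (p z ==_) J e) dense-core)
        where
        arith : ∀ a b → a ≤ᶻ b → a + - 1ℤ * b ≤ᶻ 0ℤ
        arith a b h = from-gap (gap h) (solve (a ∷ b ∷ []))

    -- For a vertex of the core, `b` is its own colour. For any other vertex, `full-degree` excludes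
    -- the first case of `one-part-or-one-side` and forces equality in the second.
    neighbourhood : ∀ z → ∃[ b ] ∀ y → J (p y) ≡ true → p z ≢ p y → adj G z y ≡ c y xor b
    neighbourhood z = by-value (λ _ → ∃[ b ] ∀ y → J (p y) ≡ true → p z ≢ p y → adj G z y ≡ c y xor b)
        (J (p z)) outside inside
      where
      inside : J (p z) ≡ true → ∃[ b ] ∀ y → J (p y) ≡ true → p z ≢ p y → adj G z y ≡ c y xor b
      inside jz = c z , λ y jy pz≢py → agree (adj G z y) (c z) (c y) (core-edge z y jz jy) (core-complete z y jz jy pz≢py)
        where
        agree : ∀ a b b′ → (a ≡ true → b xor b′ ≡ true) → (b xor b′ ≡ true → a ≡ true) → a ≡ b′ xor b
        agree true  b b′ f g = trans (sym (f refl)) (xor-comm b b′)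
        agree false true  true  f g = refl
        agree false false false f g = refl
        agree false true  false f g = g refl
        agree false false true  f g = g refl
      outside : J (p z) ≡ false → ∃[ b ] ∀ y → J (p y) ≡ true → p z ≢ p y → adj G z y ≡ c y xor b
      outside jz with one-part-or-one-side z
      ... | inj₁ h = ⊥-elim (negative-gap (gap h ⊕ gap (full-degree z jz) ⊕ gap 1≤M)
              (lemma (+ 2 * ν J (e z)) (count J * M) M))
        where
        lemma : ∀ d n M → n - (d + M) + (d - n) + (M - 1ℤ) ≡ - 1ℤ
        lemma d n M = solve (d ∷ n ∷ M ∷ [])
      ... | inj₂ (b , h) = b , λ y jy _ → agree (adj G z y) (c y xor b) (h y jy)
              (from-gap (gap (ν-vanish J {λ v → side b v + - 1ℤ * e z v} (λ v jv → from-gap (gap (h v jv)) (shape (side b v) (e z v)))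
                total y jy)) (shape′ (side b y) (e z y)))
        where
        shape : ∀ a b → a - b ≡ a + - 1ℤ * b - 0ℤ
        shape a b = solve (a ∷ b ∷ [])
        shape′ : ∀ a b → 0ℤ - (a + - 1ℤ * b) ≡ b - a
        shape′ a b = solve (a ∷ b ∷ [])
        agree : ∀ a b → ι a ≤ᶻ ι b → ι b ≤ᶻ ι a → a ≡ b
        agree true  true  _ _ = refl
        agree false false _ _ = refl
        agree true  false (+≤+ ()) _
        agree false true  _ (+≤+ ())
        total : ν J (λ v → side b v + - 1ℤ * e z v) ≤ᶻ 0ℤ
        total = subst (_≤ᶻ 0ℤ) (sym (trans (ν-+ J _ _) (cong₂ _+_ (refl {x = ν J (side b)}) (ν-* J (- 1ℤ) (e z)))))
          (arith (ν J (side b)) (ν J (e z)) (count J * M) (side-mass b) (full-degree z jz))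
          where
          arith : ∀ s d n → + 2 * s ≡ n → n ≤ᶻ + 2 * d → s + - 1ℤ * d ≤ᶻ 0ℤ
          arith s d _ refl h = cancel-pos (+ 2) (from-yes (1ℤ ≤ᶻ? + 2)) (from-gap (gap h) (solve (s ∷ d ∷ [])))

    κ : Fin N → Bool
    κ z = proj₁ (neighbourhood z)

    side-inhabited : ∀ b k → J k ≡ true → ∃[ y ] (p y ≡ k × c y xor b ≡ true)
    side-inhabited b k jk with any? (λ y → (p y ≟ᶠ k) ×-dec (c y xor b ≟ᵇ true))
    ... | yes found = found
    ... | no none = ⊥-elim (negative-gap (gap empty ⊕ gap (ℤₚ.≤-reflexive (sym (side-part b k jk)))
            ⊕ gap empty ⊕ gap 1≤M) (lemma (μ k (side b)) M))
      where
      empty : μ k (side b) ≤ᶻ 0ℤ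
      empty = ℤₚ.≤-trans (μ-mono k {g = λ _ → 0ℤ} λ y py → absent y py)
        (ℤₚ.≤-reflexive (trans (μ-const k 0ℤ) (ℤₚ.*-zeroˡ M)))
        where
        absent : ∀ y → p y ≡ k → side b y ≤ᶻ 0ℤ
        absent y py with c y xor b in eq
        ... | true  = ⊥-elim (none (y , py , eq))
        ... | false = ℤₚ.≤-refl
      lemma : ∀ s M → (0ℤ - s) + (+ 2 * s - M) + (0ℤ - s) + (M - 1ℤ) ≡ - 1ℤ
      lemma s M = solve (s ∷ M ∷ [])

    third-part : ∀ i i′ → ∃[ k ] (J k ≡ true × i ≢ k × i′ ≢ k)
    third-part i i′ with sum-pigeonhole {f = λ k → ι (i == k) * 1ℤ + ι (i′ == k) * 1ℤ} {g = ι ∘ J}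
      (ℤₚ.≤-trans (ℤₚ.≤-reflexive (cong (λ t → 1ℤ + t) (trans (∑-distrib-+ {ℓ} _ _)
        (cong₂ _+_ (sum-== i (λ _ → 1ℤ)) (sum-== i′ (λ _ → 1ℤ)))))) 3≤J)
    ... | k , h = k , proj₁ parts , ≢ i (proj₁ (proj₂ parts)) , ≢ i′ (proj₂ (proj₂ parts))
      where
      check : ∀ a a′ b → 1ℤ + (ι a * 1ℤ + ι a′ * 1ℤ) ≤ᶻ ι b → b ≡ true × a ≡ false × a′ ≡ false
      check = from-yes (∀? λ a → ∀? λ a′ → ∀? λ b → (1ℤ + (ι a * 1ℤ + ι a′ * 1ℤ) ≤ᶻ? ι b) →-dec
        ((b ≟ᵇ true) ×-dec (a ≟ᵇ false) ×-dec (a′ ≟ᵇ false)))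
      parts : J k ≡ true × (i == k) ≡ false × (i′ == k) ≡ false
      parts = check (i == k) (i′ == k) (J k) h
      ≢ : ∀ i → (i == k) ≡ false → i ≢ k
      ≢ i eq refl = case trans (sym eq) (==-refl i) of λ ()

    -- Adjacent vertices with equal `κ` would see the same nonempty class of a core part that
    -- contains neither of them, hence have a common neighbour.
    κ-bichromatic : Bichromatic κ
    κ-bichromatic v v′ vv′ = by-value (λ b → b ≡ true) (κ v xor κ v′) clash (λ _ → refl)
      where
      clash : κ v xor κ v′ ≡ false → false ≡ true
      clash same with third-part (p v) (p v′)
      ... | k , jk , pv≢k , pv′≢k with side-inhabited (κ v) k jk
      ... | y , refl , cy = ⊥-elim (triangle-free v v′ y vv′
              (trans (proj₂ (neighbourhood v′) y jk pv′≢k) (trans (cong (c y xor_) (sym (equal (κ v) (κ v′) same))) cy))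
              (trans (proj₂ (neighbourhood v) y jk pv≢k) cy))
        where
        equal : ∀ a b → a xor b ≡ false → a ≡ b
        equal true  true  _ = refl
        equal false false _ = refl

  bipartite : + 13 ≤ᶻ + ℓ → ∃[ κ ] Bichromatic κ
  bipartite 13≤ℓ with tight-edge 13≤ℓ
  ... | u , v , uv , tight = FromCore.κ core , FromCore.κ-bichromatic core
    where
    core : Core
    core = edge-core 13≤ℓ u v uv tight

  -- Structure forced by a bipartition.

  module _ (κ : Fin N → Bool) (bichromatic : Bichromatic κ) where

    bichromatic-cut : ∀ i j → i ≢ j → + 2 * ν² (i ==_) (j ==_) (miss κ) + excess κ i * excess κ j ≤ᶻ 0ℤ
    bichromatic-cut i j i≢j = ℤₚ.≤-trans (cut-density κ i j i≢j) (ℤₚ.≤-trans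
      (ℤₚ.*-monoˡ-≤-nonNeg (+ 2) {y = 0ℤ} (ℤₚ.≤-trans
        (μ-mono i {g = λ _ → 0ℤ} λ x _ → ℤₚ.≤-trans (μ-mono j {g = λ _ → 0ℤ} λ y _ → none x y)
          (ℤₚ.≤-reflexive (trans (μ-const j 0ℤ) (ℤₚ.*-zeroˡ M))))
        (ℤₚ.≤-reflexive (trans (μ-const i 0ℤ) (ℤₚ.*-zeroˡ M))))) ℤₚ.≤-refl)
      where
      none : ∀ x y → bad κ x y ≤ᶻ 0ℤ
      none x y with adj G x y in xy
      ... | false = ℤₚ.≤-refl
      ... | true  rewrite bichromatic x y xy = ℤₚ.≤-refl

    -- Consequently at most one part has positive and at most one negative excess; these become the
    -- first two parts of the class.
    opposite-excess : ∀ i j → i ≢ j → excess κ i * excess κ j ≤ᶻ 0ℤ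
    opposite-excess i j i≢j = arith _ _ (ν²-≥0 (i ==_) (j ==_) λ x y → ι-≥0 _) (bichromatic-cut i j i≢j)
      where
      arith : ∀ m q → 0ℤ ≤ᶻ m → + 2 * m + q ≤ᶻ 0ℤ → q ≤ᶻ 0ℤ
      arith m q h h′ = from-gap (nat 2 ⊗ h ⊕ gap h′) (solve (m ∷ q ∷ []))

    complete-across : ∀ x y → p x ≢ p y → excess κ (p x) * excess κ (p y) ≡ 0ℤ → κ x xor κ y ≡ true → adj G x y ≡ true
    complete-across x y px≢py q≡0 κxy = decide (p x == p y) (adj G x y) (κ x xor κ y) (==-≢ px≢py) κxy
      (ν-vanish (p y ==_) {miss κ x} (λ y _ → ι-≥0 _)
        (ν-vanish (p x ==_) {λ x → ν (p y ==_) (miss κ x)} (λ x _ → ν-≥0 (p y ==_) λ y _ → ι-≥0 _)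
          (arith (ν² (p x ==_) (p y ==_) (miss κ)) _ q≡0 (bichromatic-cut (p x) (p y) px≢py)) x (==-refl (p x)))
        y (==-refl (p y)))
      where
      decide : ∀ s a b → s ≡ false → b ≡ true → ι (not s ∧ (not a ∧ b)) ≤ᶻ 0ℤ → a ≡ true
      decide _ true  _ _ _ _ = refl
      decide _ false _ refl refl (+≤+ ())
      arith : ∀ m q → q ≡ 0ℤ → + 2 * m + q ≤ᶻ 0ℤ → m ≤ᶻ 0ℤ
      arith m _ refl h = cancel-pos (+ 2) (from-yes (1ℤ ≤ᶻ? + 2)) (from-gap (gap h) (solve (m ∷ [])))

-- List counts as integer sums, and a common multiple.

length-filter : ∀ {a} {A : Set a} {P : A → Set} (P? : Decidable P) {n} (f : Fin n → A) →
  + length (filter P? (tabulate f)) ≡ sum (λ v → ι (does (P? (f v))))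
length-filter P? {zero}  f = refl
length-filter P? {suc n} f with does (P? (f zero))
... | true  = cong (λ s → 1ℤ + s) (length-filter P? (f ∘ suc))
... | false = trans (length-filter P? (f ∘ suc)) (sym (ℤₚ.+-identityˡ _))

zero-term : ∀ a s → 0ℤ * a + s ≡ s
zero-term a s = solve (a ∷ s ∷ [])

length-filter₂ : ∀ {a} {A : Set a} {P Q : A → Set} (P? : Decidable P) (Q? : Decidable Q) {n} (f : Fin n → A) →
  + length (filter Q? (filter P? (tabulate f))) ≡ sum (λ v → ι (does (P? (f v))) * ι (does (Q? (f v))))
length-filter₂ P? Q? {zero}  f = refl
length-filter₂ P? Q? {suc n} f with does (P? (f zero))
... | false = trans (length-filter₂ P? Q? (f ∘ suc)) (sym (zero-term (ι (does (Q? (f zero)))) _))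
... | true with does (Q? (f zero))
...   | true  = cong (λ s → 1ℤ + s) (length-filter₂ P? Q? (f ∘ suc))
...   | false = trans (length-filter₂ P? Q? (f ∘ suc)) (sym (ℤₚ.+-identityˡ _))

sum-filter : ∀ {a} {A : Set a} {P : A → Set} (P? : Decidable P) (h : A → ℕ) {n} (f : Fin n → A) →
  + sumᴸ (map h (filter P? (tabulate f))) ≡ sum (λ v → ι (does (P? (f v))) * + h (f v))
sum-filter P? h {zero}  f = refl
sum-filter P? h {suc n} f with does (P? (f zero))
... | true  = trans (ℤₚ.pos-+ (h (f zero)) _) (cong₂ _+_ (sym (ℤₚ.*-identityˡ (+ h (f zero)))) (sum-filter P? h (f ∘ suc)))
... | false = trans (sum-filter P? h (f ∘ suc)) (sym (zero-term (+ h (f zero)) _))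

partSize-sum : ∀ {N ℓ} (p : Partition N ℓ) k → + partSize p k ≡ sum (λ v → ι (k == p v))
partSize-sum {N} p k = trans (length-filter (λ u → p u ≟ᶠ k) id) (sum-cong-≗ {N} λ v → cong ι (==-sym (p v) k))

does-true : ∀ b → does (b ≟ᵇ true) ≡ b
does-true true  = refl
does-true false = refl

crossEdges-sum : ∀ {N ℓ} (G : Graph N) (p : Partition N ℓ) i j → + crossEdges G p i j ≡
  sum (λ u → ι (i == p u) * sum (λ v → ι (j == p v) * ι (adj G u v)))
crossEdges-sum {N} G p i j = trans (sum-filter (λ u → p u ≟ᶠ i) _ id) (sum-cong-≗ {N} λ u →
  cong₂ (λ b s → ι b * s) (==-sym (p u) i) (trans (length-filter₂ (λ v → p v ≟ᶠ j) (λ v → adj G u v ≟ᵇ true) id)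
    (sum-cong-≗ {N} λ v → cong₂ (λ b b′ → ι b * ι b′) (==-sym (p v) j) (does-true (adj G u v)))))

-- The cofactors `q` become the vertex weights that give every part the mass `M`. Minimality is
-- irrelevant, so the product is taken.
common-multiple : ∀ {ℓ} (n : Fin ℓ → ℤ) → (∀ k → 1ℤ ≤ᶻ n k) →
  Σ ℤ λ M → Σ (Fin ℓ → ℤ) λ q → 1ℤ ≤ᶻ M × (∀ k → 1ℤ ≤ᶻ q k) × (∀ k → q k * n k ≡ M)
common-multiple {zero}  n 1≤n = 1ℤ , (λ ()) , ℤₚ.≤-refl , (λ ()) , λ ()
common-multiple {suc ℓ} n 1≤n with common-multiple (n ∘ suc) (1≤n ∘ suc)
... | M , q , 1≤M , 1≤q , qn≡M = n zero * M , q′ , 1≤-* (1≤n zero) 1≤M , 1≤q′ , eq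
  where
  q′ : Fin (suc ℓ) → ℤ
  q′ zero    = M
  q′ (suc k) = n zero * q k
  1≤q′ : ∀ k → 1ℤ ≤ᶻ q′ k
  1≤q′ zero    = 1≤M
  1≤q′ (suc k) = 1≤-* (1≤n zero) (1≤q k)
  eq : ∀ k → q′ k * n k ≡ n zero * M
  eq zero    = ℤₚ.*-comm M (n zero)
  eq (suc k) = trans (ℤₚ.*-assoc (n zero) (q k) (n (suc k))) (cong (n zero *_) (qn≡M k))

-- Enumeration of a Boolean subset.

-- The recursion splits on `b zero` exactly as `nth` does, so that `Fin (size b)` reduces along with
-- it.
size : ∀ {N} → (Fin N → Bool) → ℕ
size {zero}  b = 0
size {suc N} b = if b zero then suc (size (b ∘ suc)) else size (b ∘ suc)

size-sum : ∀ {N} (b : Fin N → Bool) → + size b ≡ sum (ι ∘ b)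
size-sum {zero}  b = refl
size-sum {suc N} b with b zero
... | true  = cong (λ s → 1ℤ + s) (size-sum (b ∘ suc))
... | false = trans (size-sum (b ∘ suc)) (sym (ℤₚ.+-identityˡ _))

nth : ∀ {N} (b : Fin N → Bool) → Fin (size b) → Fin N
nth {suc N} b t with b zero
nth {suc N} b zero    | true  = zero
nth {suc N} b (suc t) | true  = suc (nth (b ∘ suc) t)
nth {suc N} b t       | false = suc (nth (b ∘ suc) t)

nth-∈ : ∀ {N} (b : Fin N → Bool) t → b (nth b t) ≡ true
nth-∈ {suc N} b t with b zero in eq
nth-∈ {suc N} b zero    | true  = eq
nth-∈ {suc N} b (suc t) | true  = nth-∈ (b ∘ suc) t
nth-∈ {suc N} b t       | false = nth-∈ (b ∘ suc) t

nth-surjective : ∀ {N} (b : Fin N → Bool) v → b v ≡ true → ∃[ t ] nth b t ≡ v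
nth-surjective {suc N} b v       bv with b zero in eq
nth-surjective {suc N} b zero    bv | true  = zero , refl
nth-surjective {suc N} b (suc v) bv | true  = let t , nth≡v = nth-surjective (b ∘ suc) v bv in suc t , cong suc nth≡v
nth-surjective {suc N} b zero    bv | false = case trans (sym eq) bv of λ ()
nth-surjective {suc N} b (suc v) bv | false = let t , nth≡v = nth-surjective (b ∘ suc) v bv in t , cong suc nth≡v

rank : ∀ {N} (b : Fin N → Bool) v → b v ≡ true → Fin (size b)
rank b v bv = proj₁ (nth-surjective b v bv)

nth-rank : ∀ {N} (b : Fin N → Bool) v (bv : b v ≡ true) → nth b (rank b v bv) ≡ v
nth-rank b v bv = proj₂ (nth-surjective b v bv)

nth-injective : ∀ {N} (b : Fin N → Bool) t t′ → nth b t ≡ nth b t′ → t ≡ t′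
nth-injective {suc N} b t t′ eq with b zero
nth-injective {suc N} b zero    zero     eq | true  = refl
nth-injective {suc N} b (suc t) (suc t′) eq | true  = cong suc (nth-injective (b ∘ suc) t t′ (suc-injective eq))
nth-injective {suc N} b t       t′       eq | false = nth-injective (b ∘ suc) t t′ (suc-injective eq)

-- Moving the exceptional parts to the front.

transposeˡ : ∀ {n} (i j : Fin n) → transpose i j ⟨$⟩ʳ i ≡ j
transposeˡ i j rewrite dec-true (i ≟ᶠ i) refl = refl

transpose-fixed : ∀ {n} (i j k : Fin n) → k ≢ i → k ≢ j → transpose i j ⟨$⟩ʳ k ≡ k
transpose-fixed i j k k≢i k≢j rewrite dec-false (k ≟ᶠ i) k≢i | dec-false (k ≟ᶠ j) k≢j = refl

-- First `τ` exchanges the second position with the preimage of `b` under `σ`, then `σ` sends zero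
-- to `a`. The preimage is not zero, as `a ≢ b`, so `τ` leaves zero in place.
to-front : ∀ {n} (a b : Fin (suc (suc n))) → a ≢ b →
  Σ (Permutation′ (suc (suc n))) λ π → π ⟨$⟩ʳ zero ≡ a × π ⟨$⟩ʳ suc zero ≡ b
to-front a b a≢b = τ ∘ₚ σ , first , second
  where
  σ τ : Permutation′ _
  σ = transpose zero a
  b′ : Fin _
  b′ = σ ⟨$⟩ˡ b
  τ = transpose (suc zero) b′
  b′≢0 : zero ≢ b′
  b′≢0 eq = a≢b (trans (sym (transposeˡ zero a)) (trans (cong (σ ⟨$⟩ʳ_) eq) (inverseʳ σ)))
  first : σ ⟨$⟩ʳ (τ ⟨$⟩ʳ zero) ≡ a
  first = trans (cong (σ ⟨$⟩ʳ_) (transpose-fixed (suc zero) b′ zero (λ ()) b′≢0)) (transposeˡ zero a)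
  second : σ ⟨$⟩ʳ (τ ⟨$⟩ʳ suc zero) ≡ b
  second = trans (cong (σ ⟨$⟩ʳ_) (transposeˡ (suc zero) b′)) (inverseʳ σ)

other : ∀ {n} (a : Fin (suc (suc n))) → ∃[ b ] a ≢ b
other zero    = suc zero , λ ()
other (suc a) = zero , λ ()

nonpositive-factor : ∀ i j → 1ℤ ≤ᶻ j → i * j ≤ᶻ 0ℤ → i ≤ᶻ 0ℤ
nonpositive-factor i j 1≤j h = cancel-pos j 1≤j (from-gap (gap h) (solve (i ∷ j ∷ [])))

nonnegative-factor : ∀ i j → j ≤ᶻ - 1ℤ → i * j ≤ᶻ 0ℤ → 0ℤ ≤ᶻ i
nonnegative-factor i j j≤-1 h = cancel-pos (- j) (ℤₚ.neg-mono-≤ j≤-1) (from-gap (gap h) (lemma i j))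
  where
  lemma : ∀ i j → 0ℤ - i * j ≡ - j * i - - j * 0ℤ
  lemma i j = solve (i ∷ j ∷ [])

nonpositive : ∀ {n} (x : Fin n → ℤ) → ¬ (∃[ i ] 1ℤ ≤ᶻ x i) → ∀ k → x k ≤ᶻ 0ℤ
nonpositive x none k with pos? (x k)
... | inj₁ h = h
... | inj₂ h = ⊥-elim (none (k , h))

-- A part with positive x, if there is one, is chosen as a, and one with negative x as b.
exceptional-parts : ∀ {n} (x : Fin (suc (suc n)) → ℤ) → (∀ i j → i ≢ j → x i * x j ≤ᶻ 0ℤ) →
  ∃[ a ] ∃[ b ] (a ≢ b × (∀ k → k ≢ a → x k ≤ᶻ 0ℤ) × (∀ k → k ≢ b → 0ℤ ≤ᶻ x k))
exceptional-parts {n} x opposite with any? (λ i → 1ℤ ≤ᶻ? x i) | any? (λ i → x i ≤ᶻ? - 1ℤ)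
... | yes (a , xa) | yes (b , xb) = a , b , (λ { refl → case ℤₚ.≤-trans xa xb of λ () }) ,
        (λ k k≢a → nonpositive-factor (x k) (x a) xa (opposite k a k≢a)) , λ k k≢b → nonnegative-factor (x k) (x b) xb (opposite k b k≢b)
... | yes (a , xa) | no none = a , proj₁ (other a) , proj₂ (other a) ,
        (λ k k≢a → nonpositive-factor (x k) (x a) xa (opposite k a k≢a)) , λ k _ → ≰⇒1+≤ λ h → none (k , h)
... | no none | yes (b , xb) = proj₁ (other b) , b , proj₂ (other b) ∘ sym ,
        (λ k _ → nonpositive x none k) , λ k k≢b → nonnegative-factor (x k) (x b) xb (opposite k b k≢b)
... | no none | no none′ = zero , suc zero , (λ ()) , (λ k _ → nonpositive x none k) , λ k _ → ≰⇒1+≤ λ h → none′ (k , h)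

-- The isomorphism with a graph of the class.

in-class : Fin 2 → Bool → Bool
in-class zero       b = b
in-class (suc zero) b = not b

class : Bool → Fin 2
class true  = s1
class false = s2

in-class-class : ∀ b → in-class (class b) b ≡ true
in-class-class true  = refl
in-class-class false = refl

class-unique : ∀ s b → in-class s b ≡ true → class b ≡ s
class-unique zero       true  _ = refl
class-unique (suc zero) false _ = refl

same-class : ∀ a b → class a ≡ class b → a xor b ≡ false
same-class true  true  _ = refl
same-class false false _ = refl

different-class : ∀ a b → class a ≢ class b → a xor b ≡ true
different-class true  true  ne = ⊥-elim (ne refl)
different-class true  false ne = refl
different-class false true  ne = refl
different-class false false ne = ⊥-elim (ne refl)

Fin⇒0< : ∀ {n} → Fin n → 0 ℕ.< n
Fin⇒0< zero    = s≤s z≤n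
Fin⇒0< (suc _) = s≤s z≤n

module Isomorphism {N m} (G : Graph N) (p : Partition N (suc (suc m))) (κ : Fin N → Bool)
  (π : Permutation′ (suc (suc m)))
  (partite : IsPartite G p) (bichromatic : ∀ x y → adj G x y ≡ true → κ x xor κ y ≡ true)
  (q x : Fin (suc (suc m)) → ℤ) (1≤q : ∀ k → 1ℤ ≤ᶻ q k)
  (imbalance : ∀ k → x k ≡
    q k * (+ size (λ v → (k == p v) ∧ κ v) - + size (λ v → (k == p v) ∧ not (κ v))))
  (x-first : 0ℤ ≤ᶻ x (π ⟨$⟩ʳ zero)) (x-second : x (π ⟨$⟩ʳ suc zero) ≤ᶻ 0ℤ)
  (x-rest : ∀ i → x (π ⟨$⟩ʳ suc (suc i)) ≡ 0ℤ)
  (complete : ∀ u v → p u ≢ p v → x (p u) * x (p v) ≡ 0ℤ → κ u xor κ v ≡ true → adj G u v ≡ true)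
  where

  private
    ℓ : ℕ
    ℓ = suc (suc m)

  members : Fin ℓ → Fin 2 → Fin N → Bool
  members i s v = ((π ⟨$⟩ʳ i) == p v) ∧ in-class s (κ v)

  n : Fin ℓ → Fin 2 → ℕ
  n i s = size (members i s)

  index : Fin N → Fin ℓ
  index v = π ⟨$⟩ˡ p v

  member : ∀ v → members (index v) (class (κ v)) v ≡ true
  member v = cong₂ _∧_ (trans (cong (_== p v) (inverseʳ π)) (==-refl (p v))) (in-class-class (κ v))

  to : Fin N → GVertex n
  to v = index v , class (κ v) , rank (members (index v) (class (κ v))) v (member v)

  from : GVertex n → Fin N
  from (i , s , t) = nth (members i s) t

  from-∈ : ∀ i s t → members i s (from (i , s , t)) ≡ true
  from-∈ i s t = nth-∈ (members i s) t

  from-part : ∀ i s t → p (from (i , s , t)) ≡ π ⟨$⟩ʳ i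
  from-part i s t = sym (==⇒≡ (proj₁ (∧-true (from-∈ i s t))))

  from-class : ∀ i s t → class (κ (from (i , s , t))) ≡ s
  from-class i s t = class-unique s _ (proj₂ (∧-true {(π ⟨$⟩ʳ i) == p (from (i , s , t))} (from-∈ i s t)))

  to∘from : ∀ y → to (from y) ≡ y
  to∘from (i , s , t) = position (from (i , s , t)) i s t
    (trans (cong (π ⟨$⟩ˡ_) (from-part i s t)) (inverseˡ π)) (from-class i s t) refl
    where
    -- With `from (i , s , t)` generalised to `v`, both index equations can be matched with `refl`,
    -- and only the ranks remain to be compared.
    position : ∀ v i s (t : Fin (n i s)) → index v ≡ i → class (κ v) ≡ s → nth (members i s) t ≡ v → to v ≡ (i , s , t)
    position v i s t refl refl eq = cong (λ t → i , s , t)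
      (nth-injective (members i s) _ t (trans (nth-rank (members i s) v (member v)) (sym eq)))

  from∘to : ∀ v → from (to v) ≡ v
  from∘to v = nth-rank (members (index v) (class (κ v))) v (member v)

  -- Adjacency is pulled back along `from`, so the deleted edges are whatever is absent between the
  -- first two parts and need no description of their own.
  E : GVertex n → GVertex n → Set
  E y y′ = adj G (from y) (from y′) ≡ true

  x-part : ∀ i → x (π ⟨$⟩ʳ i) ≡ q (π ⟨$⟩ʳ i) * (+ n i s1 - + n i s2)
  x-part i = imbalance (π ⟨$⟩ʳ i)

  s2≤s1 : ∀ i → 0ℤ ≤ᶻ x (π ⟨$⟩ʳ i) → n i s2 ≤ n i s1
  s2≤s1 i h = ℤₚ.drop‿+≤+ (arith (q (π ⟨$⟩ʳ i)) (+ n i s1) (+ n i s2) (1≤q (π ⟨$⟩ʳ i)) (subst (0ℤ ≤ᶻ_) (x-part i) h))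
    where
    arith : ∀ q a b → 1ℤ ≤ᶻ q → 0ℤ ≤ᶻ q * (a - b) → b ≤ᶻ a
    arith q a b 1≤q h = cancel-pos q 1≤q (from-gap h (lemma q a b))
      where
      lemma : ∀ q a b → q * (a - b) ≡ q * a - q * b
      lemma q a b = solve (q ∷ a ∷ b ∷ [])

  s1≤s2 : ∀ i → x (π ⟨$⟩ʳ i) ≤ᶻ 0ℤ → n i s1 ≤ n i s2
  s1≤s2 i h = ℤₚ.drop‿+≤+ (arith (q (π ⟨$⟩ʳ i)) (+ n i s1) (+ n i s2) (1≤q (π ⟨$⟩ʳ i)) (subst (_≤ᶻ 0ℤ) (x-part i) h))
    where
    arith : ∀ q a b → 1ℤ ≤ᶻ q → q * (a - b) ≤ᶻ 0ℤ → a ≤ᶻ b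
    arith q a b 1≤q h = cancel-pos q 1≤q (from-gap (gap h) (lemma q a b))
      where
      lemma : ∀ q a b → 0ℤ - q * (a - b) ≡ q * b - q * a
      lemma q a b = solve (q ∷ a ∷ b ∷ [])

  admissible : Admissible n
  admissible = first , second , rest , nonempty
    where
    first : ∀ i → toℕ i ≡ 0 → n i s2 ≤ n i s1
    first zero _ = s2≤s1 zero x-first
    second : ∀ i → toℕ i ≡ 1 → n i s1 ≤ n i s2
    second (suc zero) _ = s1≤s2 (suc zero) x-second
    rest : ∀ i → 2 ≤ toℕ i → n i s1 ≡ n i s2
    rest (suc zero) (s≤s ())
    rest (suc (suc i)) _ = ℕₚ.≤-antisym (s1≤s2 (suc (suc i)) (ℤₚ.≤-reflexive (x-rest i)))
      (s2≤s1 (suc (suc i)) (ℤₚ.≤-reflexive (sym (x-rest i))))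
    nonempty : ∀ i → 0 ℕ.< n i s1 ℕ.+ n i s2
    nonempty i with proj₂ partite (π ⟨$⟩ʳ i)
    ... | u , pu = by-value (λ b → κ u ≡ b → 0 ℕ.< n i s1 ℕ.+ n i s2) (κ u)
        (λ κu _ → ℕₚ.<-≤-trans (Fin⇒0< (rank (members i s2) u (cong₂ _∧_ here (cong not κu)))) (ℕₚ.m≤n+m (n i s2) (n i s1)))
        (λ κu _ → ℕₚ.<-≤-trans (Fin⇒0< (rank (members i s1) u (cong₂ _∧_ here κu))) (ℕₚ.m≤m+n (n i s1) (n i s2)))
        refl
      where
      here : ((π ⟨$⟩ʳ i) == p u) ≡ true
      here = trans (cong ((π ⟨$⟩ʳ i) ==_) pu) (==-refl (π ⟨$⟩ʳ i))

  E⇒barEdge : ∀ y y′ → E y y′ → barEdge {n = n} y y′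
  E⇒barEdge (i , s , t) (i′ , s′ , t′) edge = i≢i′ , s≢s′
    where
    i≢i′ : i ≢ i′
    i≢i′ refl = proj₁ partite _ _ edge (trans (from-part i s t) (sym (from-part i s′ t′)))
    s≢s′ : s ≢ s′
    s≢s′ refl = case trans (sym (same-class (κ (from (i , s , t))) (κ (from (i′ , s , t′)))
      (trans (from-class i s t) (sym (from-class i′ s t′))))) (bichromatic _ _ edge) of λ ()

  -- Every later part has excess 0. Hence `complete` applies to all pairs of parts except the first
  -- two, the only place where edges may be missing.
  product-zero : ∀ i i′ → i ≢ i′ →
    ¬ ((toℕ i ≡ 0 × toℕ i′ ≡ 1) ⊎ (toℕ i ≡ 1 × toℕ i′ ≡ 0)) → x (π ⟨$⟩ʳ i) * x (π ⟨$⟩ʳ i′) ≡ 0ℤ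
  product-zero (suc (suc i)) i′ _ _ = trans (cong (_* x (π ⟨$⟩ʳ i′)) (x-rest i)) (ℤₚ.*-zeroˡ (x (π ⟨$⟩ʳ i′)))
  product-zero i (suc (suc i′)) _ _ = trans (cong (x (π ⟨$⟩ʳ i) *_) (x-rest i′)) (ℤₚ.*-zeroʳ (x (π ⟨$⟩ʳ i)))
  product-zero zero       zero       ne _ = ⊥-elim (ne refl)
  product-zero zero       (suc zero) _ nb = ⊥-elim (nb (inj₁ (refl , refl)))
  product-zero (suc zero) zero       _ nb = ⊥-elim (nb (inj₂ (refl , refl)))
  product-zero (suc zero) (suc zero) ne _ = ⊥-elim (ne refl)

  barEdge⇒E : ∀ y y′ → barEdge {n = n} y y′ → ¬ Between12 {n = n} y y′ → E y y′
  barEdge⇒E (i , s , t) (i′ , s′ , t′) (i≢i′ , s≢s′) nb = complete u v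
    (λ eq → i≢i′ (trans (sym (inverseˡ π)) (trans (cong (π ⟨$⟩ˡ_)
      (trans (sym (from-part i s t)) (trans eq (from-part i′ s′ t′)))) (inverseˡ π))))
    (trans (cong₂ (λ k l → x k * x l) (from-part i s t) (from-part i′ s′ t′)) (product-zero i i′ i≢i′ nb))
    (different-class (κ u) (κ v) λ eq → s≢s′ (trans (sym (from-class i s t)) (trans eq (from-class i′ s′ t′))))
    where
    u v : Fin N
    u = from (i , s , t)
    v = from (i′ , s′ , t′)

  isomorphism : IsoToG3 ℓ G
  isomorphism = n , E ,
    (admissible , (λ y y′ edge → trans (adj-sym G (from y′) (from y)) edge) , E⇒barEdge , barEdge⇒E) ,
    mk↔ₛ′ to from to∘from from∘to ,
    λ u v → mk⇔ (trans (cong₂ (adj G) (from∘to u) (from∘to v))) (trans (sym (cong₂ (adj G) (from∘to u) (from∘to v))))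

-- Vertex weights and the final assembly.

triangle? : ∀ {N} (G : Graph N) → Dec (HasTriangle G)
triangle? G = any? λ u → any? λ v → any? λ w →
  (adj G u v ≟ᵇ true) ×-dec (adj G v w ≟ᵇ true) ×-dec (adj G u w ≟ᵇ true)

module Weights {N m} (G : Graph N) (p : Partition N (suc (suc m))) (13≤ℓ : 13 ≤ suc (suc m))
  (partite : IsPartite G p) (half-dense : HalfDense G p) (no-triangle : ¬ HasTriangle G)
  (M : ℤ) (q : Fin (suc (suc m)) → ℤ) (1≤M : 1ℤ ≤ᶻ M) (1≤q : ∀ k → 1ℤ ≤ᶻ q k)
  (qn≡M : ∀ k → q k * + partSize p k ≡ M) where

  private
    ℓ : ℕ
    ℓ = suc (suc m)

  w : Fin N → ℤ
  w v = q (p v)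

  weighted : ∀ k (f : Fin N → ℤ) → sum (λ v → w v * (ι (k == p v) * f v)) ≡ q k * sum (λ v → ι (k == p v) * f v)
  weighted k f = trans (sum-cong-≗ {N} term) (sym (*-distribˡ-sum {N} (q k) _))
    where
    term : ∀ v → w v * (ι (k == p v) * f v) ≡ q k * (ι (k == p v) * f v)
    term v with k ≟ᶠ p v
    ... | yes refl = refl
    ... | no _     = zeros (w v) (q k) (f v)
      where
      zeros : ∀ a b c → a * (0ℤ * c) ≡ b * (0ℤ * c)
      zeros a b c = solve (a ∷ b ∷ c ∷ [])

  mass : ∀ k → sum (λ v → w v * (ι (k == p v) * 1ℤ)) ≡ M
  mass k = trans (weighted k (λ _ → 1ℤ)) (trans (cong (q k *_) (trans
    (sum-cong-≗ {N} λ v → ℤₚ.*-identityʳ (ι (k == p v))) (sym (partSize-sum p k)))) (qn≡M k))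

  open Measure p w M (λ v → 1≤q (p v)) 1≤M mass

  edges : ∀ i j → ν² (i ==_) (j ==_) (λ x y → ι (adj G x y)) ≡ q i * (q j * + crossEdges G p i j)
  edges i j = trans (ν-cong (i ==_) λ x _ → trans (ν-def (j ==_) _) (weighted j _))
    (trans (ν-def (i ==_) _) (trans (weighted i _) (cong (q i *_) (trans (sum-cong-≗ {N} λ x →
      rotate (ι (i == p x)) (q j) (sum (λ y → ι (j == p y) * ι (adj G x y))))
      (trans (sym (*-distribˡ-sum {N} (q j) _)) (cong (q j *_) (sym (crossEdges-sum G p i j))))))))
    where
    rotate : ∀ a b c → a * (b * c) ≡ b * (a * c)
    rotate a b c = solve (a ∷ b ∷ c ∷ [])

  dense : ∀ i j → i ≢ j → M * M ≤ᶻ + 2 * ν² (i ==_) (j ==_) (λ x y → ι (adj G x y))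
  dense i j i≢j = subst₂ _≤ᶻ_ (cong₂ _*_ (qn≡M i) (qn≡M j)) (cong (+ 2 *_) (sym (edges i j)))
    (arith (q i) (q j) (+ partSize p i) (+ partSize p j) (+ crossEdges G p i j) (0≤q i) (0≤q j)
      (subst₂ _≤ᶻ_ (ℤₚ.pos-* (partSize p i) (partSize p j)) (ℤₚ.pos-* 2 (crossEdges G p i j)) (+≤+ (half-dense i j i≢j))))
    where
    0≤q : ∀ k → 0ℤ ≤ᶻ q k
    0≤q k = ℤₚ.≤-trans (nat 1) (1≤q k)
    arith : ∀ q q′ a a′ c → 0ℤ ≤ᶻ q → 0ℤ ≤ᶻ q′ → a * a′ ≤ᶻ + 2 * c → (q * a) * (q′ * a′) ≤ᶻ + 2 * (q * (q′ * c))
    arith q q′ a a′ c h h′ le = from-gap (h ⊗ h′ ⊗ gap le) (solve (q ∷ q′ ∷ a ∷ a′ ∷ c ∷ []))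

  triangle-free : ∀ x y z → adj G x y ≡ true → adj G y z ≡ true → adj G x z ≡ true → ⊥
  triangle-free x y z xy yz xz = no-triangle (x , y , z , xy , yz , xz)

  open TriangleFree G p w M (λ v → 1≤q (p v)) 1≤M mass (proj₁ partite) triangle-free dense

  imbalance : ∀ (κ : Fin N → Bool) k → excess κ k ≡
    q k * (+ size (λ v → (k == p v) ∧ κ v) - + size (λ v → (k == p v) ∧ not (κ v)))
  imbalance κ k = arith (q k) (μ k (ι ∘ κ)) M (+ partSize p k)
    (+ size (λ v → (k == p v) ∧ κ v)) (+ size (λ v → (k == p v) ∧ not (κ v)))
    (trans (ν-def (k ==_) (ι ∘ κ)) (trans (weighted k (ι ∘ κ)) (cong (q k *_) (trans
      (sum-cong-≗ {N} λ v → sym (ι-∧ (k == p v) (κ v))) (sym (size-sum λ v → (k == p v) ∧ κ v))))))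
    (sym (qn≡M k))
    (trans (partSize-sum p k) (trans (sum-cong-≗ {N} λ v → ι-split (k == p v) (κ v))
      (trans (∑-distrib-+ {N} (λ v → ι ((k == p v) ∧ κ v)) (λ v → ι ((k == p v) ∧ not (κ v))))
        (sym (cong₂ _+_ (size-sum λ v → (k == p v) ∧ κ v) (size-sum λ v → (k == p v) ∧ not (κ v)))))))
    where
    ι-∧ : ∀ a b → ι (a ∧ b) ≡ ι a * ι b
    ι-∧ = from-yes (∀? λ a → ∀? λ b → ι (a ∧ b) ≟ᶻ ι a * ι b)
    ι-split : ∀ a b → ι a ≡ ι (a ∧ b) + ι (a ∧ not b)
    ι-split = from-yes (∀? λ a → ∀? λ b → ι a ≟ᶻ ι (a ∧ b) + ι (a ∧ not b))
    arith : ∀ q m M n a b → m ≡ q * a → M ≡ q * n → n ≡ a + b → + 2 * m - M ≡ q * (a - b)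
    arith q _ _ _ a b refl refl refl = solve (q ∷ a ∷ b ∷ [])

  module _ (κ : Fin N → Bool) (bichromatic : Bichromatic κ) where

    arrange : ∀ a b → a ≢ b → (∀ k → k ≢ a → excess κ k ≤ᶻ 0ℤ) → (∀ k → k ≢ b → 0ℤ ≤ᶻ excess κ k) →
      ∀ (π : Permutation′ ℓ) → π ⟨$⟩ʳ zero ≡ a → π ⟨$⟩ʳ suc zero ≡ b → IsoToG3 ℓ G
    arrange a b a≢b ≤0 ≥0 π π0≡a π1≡b =
      Isomorphism.isomorphism G p κ π partite bichromatic q (excess κ) 1≤q (imbalance κ)
        (≥0 (π ⟨$⟩ʳ zero) (a≢b ∘ trans (sym π0≡a)))
        (≤0 (π ⟨$⟩ʳ suc zero) λ eq → a≢b (trans (sym eq) π1≡b))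
        (λ i → ℤₚ.≤-antisym
          (≤0 (π ⟨$⟩ʳ suc (suc i)) λ eq → distinct i zero (λ ()) (trans eq (sym π0≡a)))
          (≥0 (π ⟨$⟩ʳ suc (suc i)) λ eq → distinct i (suc zero) (λ ()) (trans eq (sym π1≡b))))
        (complete-across κ bichromatic)
      where
      distinct : ∀ i j → suc (suc i) ≢ j → π ⟨$⟩ʳ suc (suc i) ≢ π ⟨$⟩ʳ j
      distinct i j ne eq = ne (trans (sym (inverseˡ π)) (trans (cong (π ⟨$⟩ˡ_) eq) (inverseˡ π)))

    bichromatic-structure : IsoToG3 ℓ G
    bichromatic-structure =
      let a , b , a≢b , ≤0 , ≥0 = exceptional-parts (excess κ) (opposite-excess κ bichromatic)
          π , π0≡a , π1≡b = to-front a b a≢b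
      in arrange a b a≢b ≤0 ≥0 π π0≡a π1≡b

  structure : IsoToG3 ℓ G
  structure = let κ , bichromatic = bipartite (+≤+ 13≤ℓ) in bichromatic-structure κ bichromatic

partSize-≥1 : ∀ {N ℓ} (G : Graph N) (p : Partition N ℓ) → IsPartite G p → ∀ k → 1ℤ ≤ᶻ + partSize p k
partSize-≥1 G p partite k with proj₂ partite k
... | u , refl = subst (1ℤ ≤ᶻ_) (sym (partSize-sum p (p u)))
  (ℤₚ.≤-trans (ℤₚ.≤-reflexive (cong ι (sym (==-refl (p u))))) (term-≤-sum (λ v → ι-≥0 (p u == p v)) u))

triangle-free-structure : ∀ ℓ → 13 ≤ ℓ → ∀ N (G : Graph N) (p : Partition N ℓ) →
  IsPartite G p → HalfDense G p → ¬ HasTriangle G → IsoToG3 ℓ G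
triangle-free-structure (suc zero) (s≤s ())
triangle-free-structure (suc (suc m)) 13≤ℓ N G p partite half-dense no-triangle =
  let M , q , 1≤M , 1≤q , qn≡M = common-multiple (λ k → + partSize p k) (partSize-≥1 G p partite)
  in Weights.structure G p 13≤ℓ partite half-dense no-triangle M q 1≤M 1≤q qn≡M

theorem4 : (ℓ : ℕ) → 13 ≤ ℓ → (N : ℕ) (G : Graph N) (p : Partition N ℓ) →
    IsPartite G p → HalfDense G p → HasTriangle G ⊎ IsoToG3 ℓ G
theorem4 ℓ 13≤ℓ N G p partite half-dense = decide (triangle? G)
  where
  decide : Dec (HasTriangle G) → HasTriangle G ⊎ IsoToG3 ℓ G
  decide (yes triangle)   = inj₁ triangle
  decide (no no-triangle) = inj₂ (triangle-free-structure ℓ 13≤ℓ N G p partite half-dense no-triangle)
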